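{- The following statements hold (all graphs considered are finite, simple and connected). \begin{enumerate} \item For every tree $T$ of order $n$, $\mathrm{avp}(S_n) \le \mathrm{avp}(T) \le \mathrm{avp}(P_n)$. \item There exist non-isomorphic trees $T_1$ and $T_2$ with the same order and with $\mathrm{avp}(T_1)=\mathrm{avp}(T_2)$. \item The set of values of the ratio $\mathrm{avp}(G,v)/\mathrm{avp}(G)$, where $G$ ranges over all graphs of order at least $2$ and $v$ over all vertices of $G$, is dense in $\mathbb{R}^+=(0,+\infty)$. Restricted to trees, i.e. when $G$ ranges over all trees of order at least $2$ and $v$ over all vertices of $G$, this set of values is dense in $(1/2,+\infty)$. \item A vertex $v$ at which $\mathrm{avp}(G,v)$ is maximum can have any degree: for every integer $d\ge 1$ there exist a graph $G$ and a vertex $v$ of $G$ of degree $d$ such that $\mathrm{avp}(G,v)\ge \mathrm{avp}(G,w)$ for all vertices $w$ of $G$. \item Every tree $T$ which is not a star has a $1$-associate $T'$ with $\mathrm{avp}(T')<\mathrm{avp}(T)$. \item Both removing an edge in a graph and contracting an edge in a tree can increase the average path length: there exist a graph $G$ and an edge $e$ of $G$ such that $G-e$ is connected and $\mathrm{avp}(G-e)>\mathrm{avp}(G)$, and there exist a tree $T$ and an edge $f$ of $T$ such that $\mathrm{avp}(T/f)>\mathrm{avp}(T)$. \item For every integer $r\ge 3$, there are graphs $G$ of arbitrarily large order $n$ with minimum degree $\delta(G)\ge r$ for which $\mathrm{avp}(G)=O(\log n)$. That is, for every $r \ge 3$ there are a constant $C_r$ and graphs $G$ of arbitrarily large order $n$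 with $\delta(G)\ge r$ and $\mathrm{avp}(G)\le C_r\log n$. \item For every graph $G$ of order $n$, $\mathrm{avp}(S_n)\le \mathrm{avp}(G)\le \mathrm{avp}(K_n)$. \end{enumerate}
   Context: The order of a graph is its number of vertices. $P_n$, $S_n$ and $K_n$ denote the path, the star and the complete graph of order $n$, respectively (so $S_n=K_{1,n-1}$). For a graph $G$ of order $n$ and an integer $i \ge 0$, $\mathrm{pn}_i(G)$ denotes the number of paths of length $i$ in $G$, i.e. the number of (not necessarily induced) subgraphs of $G$ isomorphic to $P_{i+1}$; paths are thus unoriented, and the single vertices are the paths of length $0$. The path number is $\mathrm{pn}(G)=\sum_{i=0}^{n-1}\mathrm{pn}_i(G)$, and the average path length (average length of the subpaths of $G$) is $$\mathrm{avp}(G)=\frac{\sum_{i=0}^{n-1} i\cdot \mathrm{pn}_i(G)}{\mathrm{pn}(G)}.$$ For a vertex $v$ of $G$, the local average path length $\mathrm{avp}(G,v)$ is the average length of all paths in $G$ containing $v$ (as an end vertex or internal vertex, including the path of length $0$ consisting of $v$ alone). A $1$-associate of a tree $T$ is a tree on the same vertex set obtained from $T$ by removing one edge and adding one edge. $G-e$ denotes the graph obtained from $G$ by deleting the edge $e$ (keeping all vertices), and $T/f$ the tree obtained from $T$ by contracting the edge $f$. -}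

module Defs where

open import Level using (0ℓ)
open import Data.Fin.Base using (Fin; toℕ; punchOut)
import Data.Fin.Base as Fin
open import Data.Fin.Properties using (any?; _≟_; _≤?_)
open import Data.Integer.Base using (+_)
open import Data.List.Base as List
  using (List; length; filter; allFin; upTo; cartesianProductWith)
open import Data.Nat.ListAction using (sum)
open import Data.Nat.Base as ℕ using (ℕ; zero; suc; _+_; _*_)
import Data.Nat.Properties as ℕ
open import Data.Product.Base using (Σ-syntax; ∃-syntax; _×_; _,_)
open import Data.Rational.Base as ℚ using (ℚ; 0ℚ; _÷_)
open import Data.Sum.Base as Sum using (_⊎_; inj₁; inj₂)
open import Data.Vec.Base as Vec using (Vec; []; _∷_; head; last)
open import Data.Vec.Relation.Unary.AllPairs using (allPairs?)
open import Data.Vec.Relation.Unary.Linked using (Linked; linked?)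
open import Data.Vec.Relation.Unary.Unique.Propositional using (Unique)
open import Function.Base using (_∘_)
open import Function.Bundles using (_↔_; _⇔_; Inverse)
open import Relation.Binary.Construct.Closure.ReflexiveTransitive using (Star)
open import Relation.Binary.Core using (Rel)
open import Relation.Binary.Definitions using (Decidable; Symmetric; Irreflexive)
open import Relation.Binary.PropositionalEquality
  using (_≡_; _≢_; refl; sym; ≢-sym)
open import Relation.Nullary using (¬_; Dec; yes; no)
open import Relation.Nullary.Decidable using (¬?; _×-dec_; _⊎-dec_)
open import Relation.Unary using (Pred)
import Relation.Unary as U

------------------------------------------------------------------------
-- Finite simple graphs

record Graph (n : ℕ) : Set₁ where
  field
    Adj     : Rel (Fin n) 0ℓ
    adj?    : Decidable Adj
    symm    : Symmetric Adj
    irrefl  : Irreflexive _≡_ Adj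

open Graph public

private
  variable
    m n k : ℕ

-- Equality of graphs on the same vertex set.
_≈_ : Graph n → Graph n → Set
G ≈ H = ∀ x y → Adj G x y ⇔ Adj H x y

_≅_ : Graph m → Graph n → Set
_≅_ {m} {n} G H =
  Σ[ f ∈ Fin m ↔ Fin n ]
    (∀ x y → Adj G x y ⇔ Adj H (Inverse.to f x) (Inverse.to f y))

degree : (G : Graph n) → Fin n → ℕ
degree {n} G v = length (filter (adj? G v) (allFin n))

Connected : Graph n → Set
Connected {n} G = 1 ℕ.≤ n × (∀ x y → Star (Adj G) x y)

IsVertexPath : Graph n → Vec (Fin n) k → Set
IsVertexPath G p = Unique p × Linked (Adj G) p

Acyclic : Graph n → Set
Acyclic {n} G =
  ∀ {k} (c : Vec (Fin n) (3 + k)) → IsVertexPath G c → ¬ Adj G (last c) (head c)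

IsTree : Graph n → Set
IsTree G = Connected G × Acyclic G

------------------------------------------------------------------------
-- Paths and their average length

-- A path subgraph of positive length is traced by exactly two vertex
-- sequences, one the reverse of the other, and their ends are distinct;
-- requiring head ≤ last selects exactly one of the two.
IsPath : Graph n → Vec (Fin n) (suc k) → Set
IsPath G p = IsVertexPath G p × head p Fin.≤ last p

isPath? : (G : Graph n) → U.Decidable (IsPath {k = k} G)
isPath? G p =
  (allPairs? (λ x y → ¬? (x ≟ y)) p ×-dec linked? (adj? G) p)
  ×-dec (head p ≤? last p)

allVecs : ∀ n k → List (Vec (Fin n) k)
allVecs n zero    = List.[ [] ]
allVecs n (suc k) = cartesianProductWith _∷_ (allFin n) (allVecs n k)

-- The paths of length i: i edges, hence i + 1 vertices.
paths : Graph n → (i : ℕ) → List (Vec (Fin n) (suc i))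
paths {n} G i = filter (isPath? G) (allVecs n (suc i))

module _ {n : ℕ} where
  open import Data.Vec.Membership.DecPropositional (_≟_ {n}) using (_∈?_)

  pathsThrough : Graph n → Fin n → (i : ℕ) → List (Vec (Fin n) (suc i))
  pathsThrough G v i = filter (v ∈?_) (paths G i)

∑< : ℕ → (ℕ → ℕ) → ℕ
∑< n f = sum (List.map f (upTo n))

-- Total quotient, with the dummy value 0 for denominator 0.
quotient : ℕ → ℕ → ℚ
quotient a zero        = 0ℚ
quotient a b@(suc _)   = + a ℚ./ b

-- The average of the lengths i < n, where length i occurs c i times.
averageLength : ℕ → (ℕ → ℕ) → ℚ
averageLength n c = quotient (∑< n (λ i → i * c i)) (∑< n c)

-- The number of paths is positive unless n is 0.
avp : Graph n → ℚ
avp {n} G = averageLength n (λ i → length (paths G i))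

-- The number of paths is positive, since v alone is one of them.
avpAt : Graph n → Fin n → ℚ
avpAt {n} G v = averageLength n (λ i → length (pathsThrough G v i))

------------------------------------------------------------------------
-- Particular graphs

complete : ∀ n → Graph n
complete n = record
  { Adj    = _≢_
  ; adj?   = λ x y → ¬? (x ≟ y)
  ; symm   = ≢-sym
  ; irrefl = λ x≡y x≢y → x≢y x≡y
  }

path : ∀ n → Graph n
path n = record
  { Adj    = λ x y → toℕ y ≡ suc (toℕ x) ⊎ toℕ x ≡ suc (toℕ y)
  ; adj?   = λ x y → (toℕ y ℕ.≟ suc (toℕ x)) ⊎-dec (toℕ x ℕ.≟ suc (toℕ y))
  ; symm   = Sum.swap
  ; irrefl = λ { refl (inj₁ e) → ℕ.1+n≢n (sym e)
               ; refl (inj₂ e) → ℕ.1+n≢n (sym e) }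
  }

-- K₁,ₙ₋₁, with centre 0.
star : ∀ n → Graph n
star n = record
  { Adj    = λ x y → x ≢ y × (toℕ x ≡ 0 ⊎ toℕ y ≡ 0)
  ; adj?   = λ x y → ¬? (x ≟ y) ×-dec ((toℕ x ℕ.≟ 0) ⊎-dec (toℕ y ℕ.≟ 0))
  ; symm   = λ (x≢y , c) → ≢-sym x≢y , Sum.swap c
  ; irrefl = λ x≡y (x≢y , _) → x≢y x≡y
  }

------------------------------------------------------------------------
-- Edge operations

-- Equality of the unordered pairs {x , y} and {a , b}.
SamePair : (x y a b : Fin n) → Set
SamePair x y a b = (x ≡ a × y ≡ b) ⊎ (x ≡ b × y ≡ a)

samePair? : (x y a b : Fin n) → Dec (SamePair x y a b)
samePair? x y a b = (x ≟ a ×-dec y ≟ b) ⊎-dec (x ≟ b ×-dec y ≟ a)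

samePair-swap : {x y a b : Fin n} → SamePair x y a b → SamePair y x a b
samePair-swap (inj₁ (p , q)) = inj₂ (q , p)
samePair-swap (inj₂ (p , q)) = inj₁ (q , p)

removeEdge : Graph n → (a b : Fin n) → Graph n
removeEdge G a b = record
  { Adj    = λ x y → Adj G x y × ¬ SamePair x y a b
  ; adj?   = λ x y → adj? G x y ×-dec ¬? (samePair? x y a b)
  ; symm   = λ (e , ne) → symm G e , ne ∘ samePair-swap
  ; irrefl = λ x≡y (e , _) → irrefl G x≡y e
  }

addEdge : Graph n → (a b : Fin n) → a ≢ b → Graph n
addEdge G a b a≢b = record
  { Adj    = λ x y → Adj G x y ⊎ SamePair x y a b
  ; adj?   = λ x y → adj? G x y ⊎-dec samePair? x y a b
  ; symm   = Sum.map (symm G) samePair-swap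
  ; irrefl = λ { x≡y (inj₁ e) → irrefl G x≡y e
               ; refl (inj₂ (inj₁ (refl , refl))) → a≢b refl
               ; refl (inj₂ (inj₂ (refl , refl))) → a≢b refl }
  }

OneAssociate : Graph n → Graph n → Set
OneAssociate {n} T T′ =
  IsTree T′ ×
  (∃[ a ] ∃[ b ] ∃[ c ] ∃[ d ] Σ[ c≢d ∈ c ≢ d ]
    Adj T a b × ¬ Adj (removeEdge T a b) c d ×
    T′ ≈ addEdge (removeEdge T a b) c d c≢d)

-- The quotient map identifying u with v: u and v have the same image, and
-- the vertices other than u are mapped bijectively onto Fin n.
merge : (u v : Fin (suc n)) → u ≢ v → Fin (suc n) → Fin n
merge u v u≢v w with u ≟ w
... | yes _   = punchOut u≢v
... | no  u≢w = punchOut u≢w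

-- Contraction of the edge u v; loops and multiple edges are discarded.
contract : (G : Graph (suc n)) (u v : Fin (suc n)) → Adj G u v → Graph n
contract {n} G u v e = record
  { Adj    = λ x y → x ≢ y × ∃[ a ] ∃[ b ] (π a ≡ x × π b ≡ y × Adj G a b)
  ; adj?   = λ x y → ¬? (x ≟ y) ×-dec
                     any? λ a → any? λ b → π a ≟ x ×-dec π b ≟ y ×-dec adj? G a b
  ; symm   = λ { (x≢y , a , b , p , q , ab) → ≢-sym x≢y , b , a , q , p , symm G ab }
  ; irrefl = λ x≡y (x≢y , _) → x≢y x≡y
  }
  where
  π : Fin (suc n) → Fin n
  π = merge u v (λ u≡v → irrefl G u≡v e)

------------------------------------------------------------------------
-- Ratios and density

-- The values avp(G,v) / avp(G) for G of order at least 2 in the class 𝒞.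
RatioValue : (∀ {n} → Graph n → Set) → Pred ℚ _
RatioValue 𝒞 r =
  ∃[ n ] Σ[ G ∈ Graph n ] Σ[ v ∈ Fin n ]
    2 ℕ.≤ n × 𝒞 G ×
    Σ[ nz ∈ ℚ.NonZero (avp G) ] r ≡ (avpAt G v ÷ avp G) {{nz}}

-- Density in the real interval (c , +∞), tested on the open intervals with
-- rational endpoints, which form a base of its topology.
DenseAbove : ∀ {ℓ} → ℚ → Pred ℚ ℓ → Set ℓ
DenseAbove c S =
  ∀ p q → c ℚ.≤ p → p ℚ.< q → ∃[ r ] (S r × p ℚ.< r × r ℚ.< q)

{-# OPTIONS --safe #-}

-- Counting a path once in each direction turns avp G into A / (n + B), where B is the number of oriented paths of
-- G and A the sum of their lengths.
--
-- Trees: between any two vertices there is one path, so B = n² and A is the sum of all distances. Growing a tree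
-- vertex by vertex, the k-th vertex adds at most 2 (1 + ⋯ + (k - 1)) to A, with equality for the path. If T is not
-- a star, take an edge uv with neither end a leaf, with the side of u no larger than the side of v; moving a leaf
-- on the side of u that is furthest from v one step towards v lowers the sum of the distances.
--
-- Graphs: a path of length i has at most n - 1 - i extensions at its head, with equality in the complete graph,
-- which gives the upper bound by a Chebyshev-type inequality. For the lower bound let R be the number of oriented
-- paths of length at least 2 and m the number of edges: for an edge ab and another vertex z, a path from z reaches
-- one of a, b first, and the edge ab prolongs it; hence R ≥ m (n - 2). With m ≥ n - 1 this is the value of the star.
--
-- Density: joining rooted graphs by an edge between their roots changes B, A and the number and total length of the
-- paths from the root by explicit polynomials, so that the ratios along suitable families converge to any given
-- rational number. In trees, spiders with many legs of length ℓ and one leg of length a, with v at its end, give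
-- 1/2 + a / (ℓ + 1); K₂,g with a path ending in v and a path ending in a large star
-- attached at one of its hubs gives every positive rational.
--
-- In K_{r,m} no path is longer than 2r, so its average path length is even bounded.
module Submission where

open import Defs
open import Data.Bool.Base using (true; false; if_then_else_)
open import Data.Empty using (⊥; ⊥-elim)
open import Data.Fin.Base using (Fin; zero; suc; toℕ; fromℕ<; _↑ˡ_; _↑ʳ_; splitAt)
import Data.Fin.Base as Fin
open import Data.Fin.Permutation using (transpose)
open import Data.Fin.Properties as Fin using (_≟_; any?; all?; toℕ-injective; suc-injective; toℕ-↑ˡ; toℕ-↑ʳ; splitAt-↑ˡ; splitAt-↑ʳ; splitAt⁻¹-↑ˡ; splitAt⁻¹-↑ʳ; ↑ˡ-injective; ↑ʳ-injective)
import Data.Integer.Base as ℤ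
import Data.Integer.Properties as ℤ
open import Data.Integer.Base using (+_)
open import Data.List.Base as List using (List; []; _∷_; _++_; length; filter; allFin; cartesianProductWith)
open import Data.List.Membership.Propositional using (_∈_; _∉_)
open import Data.List.Membership.Propositional.Properties using (∈-++⁻; ∈-++⁺ˡ; ∈-++⁺ʳ; ∈-map⁺; ∈-map⁻)
import Data.List.Properties as List
open import Data.List.Relation.Unary.Any using (here; there)
open import Data.Nat.Base as ℕ using (ℕ; zero; suc; _+_; _*_; _∸_; _^_; _≤_; _<_; z≤n; s≤s; z<s)
open import Data.Nat.ListAction using () renaming (sum to sumˡ)
open import Data.Nat.ListAction.Properties using (sum-++)
open import Data.Nat.Logarithm using (⌊log₂_⌋; ⌊log₂⌋-mono-≤)
import Data.Nat.Properties as ℕ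
open import Algebra.Properties.Semiring.Sum ℕ.+-*-semiring using (sum; sum-permute)
open import Data.Nat.Tactic.RingSolver using (solve-∀)
open import Data.Product.Base as Product using (Σ-syntax; ∃-syntax; _×_; _,_; proj₁; proj₂)
open import Data.Rational.Base as ℚ using (ℚ; 0ℚ; ½)
import Data.Rational.Properties as ℚ
import Data.Rational.Unnormalised.Base as ℚᵘ
import Data.Rational.Unnormalised.Properties as ℚᵘ
open import Data.Sum.Base as Sum using (_⊎_; inj₁; inj₂)
open import Data.Unit.Base using (⊤; tt)
open import Data.Vec.Base using (Vec; []; _∷_; head; tail; last; toList; reverse; _∷ʳ_)
import Data.Vec.Membership.DecPropositional as VDec
import Data.Vec.Membership.Propositional as V
open import Data.Vec.Membership.Propositional.Properties using (∈-toList⁺; ∈-toList⁻)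
open import Data.Vec.Properties using (reverse-∷; last-reverse; reverse-involutive)
open import Data.Vec.Relation.Unary.All as All using (All; []; _∷_)
open import Data.Vec.Relation.Unary.AllPairs using (allPairs?; []; _∷_)
import Data.Vec.Relation.Unary.Any as VAny
open import Data.Vec.Relation.Unary.Linked as Linked using (Linked; linked?; []; [-]; _∷_)
open import Data.Vec.Relation.Unary.Unique.Propositional using (Unique)
open import Function.Base using (_∘_; id; case_of_)
open import Function.Bundles using (_⇔_; _↔_; Equivalence; Inverse; mk⇔)
open import Relation.Binary.Construct.Closure.ReflexiveTransitive as Star using (Star; ε; _◅_; _◅◅_; gmap)
open import Relation.Binary.PropositionalEquality using (_≡_; _≢_; refl; sym; trans; cong; cong₂; subst; subst₂; ≢-sym; module ≡-Reasoning)
open import Relation.Nullary using (¬_; Dec; yes; no; does; contradiction)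
open import Relation.Nullary.Decidable using (¬?; _×-dec_; from-yes)

-- Paths grow one vertex at a time at the head, with the visited vertices kept in a list. `E` sums a
-- weight over all the ways to do so, so that every count obeys a linear recursion; `∑ⱽ-unoriented`
-- and `∑ⱽ-E` tie it to the vectors of the definitions. A single vertex has only one orientation,
-- whence the n in A / (n + B). Trees are handled through functions d satisfying `TreeMetric`. Its
-- conditions speak of single vertices and edges, can be checked anew after joining two trees or
-- moving a leaf, and imply acyclicity, so that no cycle has to be traced in a modified tree. The
-- barrier 1/2: in a tree a path is fixed by its ends, and by the triangle inequality an average
-- pair of vertices is at most twice as far apart as an average vertex is from v. Smaller ratios
-- need path ends of unequal weight. K₂,g provides them: it has g + 2 vertices, but about g² paths
-- from a hub and only O(g³) paths in all.

infixl 7 _when_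

private
  variable
    n m k i j l : ℕ
    P Q : Set
    G : Graph n
    x y z : Fin n
    vis vis′ v₀ L : List (Fin n)

-- Finite sums and indicators

opaque

  -- Opaque, so that an indicator stays a recognisable summand in goals. It depends on the decision
  -- through `does` alone.
  _when_ : {P : Set} → ℕ → Dec P → ℕ
  k when d = if does d then k else 0

  when-yes : ∀ {k} (d : Dec P) → P → k when d ≡ k
  when-yes (yes _) _ = refl
  when-yes (no ¬p) p = contradiction p ¬p

  when-no : ∀ {k} (d : Dec P) → ¬ P → k when d ≡ 0
  when-no (yes p) ¬p = contradiction p ¬p
  when-no (no _) _ = refl

  when-cong : ∀ {k l} (d : Dec P) → (P → k ≡ l) → k when d ≡ l when d
  when-cong (yes p) e = e p
  when-cong (no _) _ = refl

  when-mono : ∀ {k l} (d : Dec P) → (P → k ≤ l) → k when d ≤ l when d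
  when-mono (yes p) e = e p
  when-mono (no _) _ = z≤n

  when-≤ : ∀ k (d : Dec P) → k when d ≤ k
  when-≤ k (yes _) = ℕ.≤-refl
  when-≤ k (no _) = z≤n

  when-⇔ : ∀ {k} (d : Dec P) (e : Dec Q) → (P → Q) → (Q → P) → k when d ≡ k when e
  when-⇔ (yes p) e f g = sym (when-yes e (f p))
  when-⇔ (no ¬p) e f g = sym (when-no e (¬p ∘ g))

  when-0 : (d : Dec P) → 0 when d ≡ 0
  when-0 (yes _) = refl
  when-0 (no _) = refl

  when-+ : ∀ k l (d : Dec P) → (k + l) when d ≡ k when d + l when d
  when-+ k l (yes _) = refl
  when-+ k l (no _) = refl

  when-* : ∀ c k (d : Dec P) → c * (k when d) ≡ (c * k) when d
  when-* c k (yes _) = refl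
  when-* c k (no _) = ℕ.*-zeroʳ c

  when-compl : ∀ k (d : Dec P) (e : Dec Q) → (P → ¬ Q) → (¬ P → Q) →
               k when d + k when e ≡ k
  when-compl k (yes p) e f g = trans (cong (k ℕ.+_) (when-no e (f p))) (ℕ.+-identityʳ k)
  when-compl k (no ¬p) e f g = when-yes e (g ¬p)

  -- Defined directly, and opaque, so that unification never unfolds it; ∑≡sum gives access to the library sum.
  ∑ : (Fin n → ℕ) → ℕ
  ∑ {zero} f = 0
  ∑ {suc n} f = f zero + ∑ (f ∘ suc)

  ∑≡sum : (f : Fin n → ℕ) → ∑ f ≡ sum f
  ∑≡sum {zero} f = refl
  ∑≡sum {suc n} f = cong (f zero ℕ.+_) (∑≡sum (f ∘ suc))

  ∑-suc : (f : Fin (suc n) → ℕ) → ∑ f ≡ f zero + ∑ (f ∘ suc)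
  ∑-suc f = refl

  ∑-cong : ∀ {f g : Fin n → ℕ} → (∀ x → f x ≡ g x) → ∑ f ≡ ∑ g
  ∑-cong {zero} h = refl
  ∑-cong {suc n} h = cong₂ _+_ (h zero) (∑-cong (h ∘ suc))

  ∑-zero : ∀ {f : Fin n → ℕ} → (∀ x → f x ≡ 0) → ∑ f ≡ 0
  ∑-zero {zero} h = refl
  ∑-zero {suc n} h = cong₂ _+_ (h zero) (∑-zero (h ∘ suc))

  ∑-mono : ∀ {f g : Fin n → ℕ} → (∀ x → f x ≤ g x) → ∑ f ≤ ∑ g
  ∑-mono {zero} h = z≤n
  ∑-mono {suc n} h = ℕ.+-mono-≤ (h zero) (∑-mono (h ∘ suc))

  ∑-const : ∀ n c → ∑ {n} (λ _ → c) ≡ n * c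
  ∑-const zero c = refl
  ∑-const (suc n) c = cong (c ℕ.+_) (∑-const n c)

  +-interchange : ∀ a b c d → (a + b) + (c + d) ≡ (a + c) + (b + d)
  +-interchange = solve-∀

  ∑-+ : (f g : Fin n → ℕ) → ∑ (λ x → f x + g x) ≡ ∑ f + ∑ g
  ∑-+ {zero} f g = refl
  ∑-+ {suc n} f g = trans (cong (f zero + g zero ℕ.+_) (∑-+ (f ∘ suc) (g ∘ suc)))
                          (+-interchange (f zero) (g zero) _ _)

  ∑-comm : (f : Fin m → Fin n → ℕ) → ∑ (λ x → ∑ (f x)) ≡ ∑ (λ y → ∑ λ x → f x y)
  ∑-comm {zero} {n} f = sym (∑-zero {n} λ _ → refl)
  ∑-comm {suc m} f = trans (cong (∑ (f zero) ℕ.+_) (∑-comm (f ∘ suc)))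
                           (sym (∑-+ (f zero) λ y → ∑ λ x → f (suc x) y))

  ∑-permute : (π : Fin m ↔ Fin n) (f : Fin n → ℕ) → ∑ f ≡ ∑ (f ∘ Inverse.to π)
  ∑-permute π f = trans (∑≡sum f) (trans (sum-permute f π) (sym (∑≡sum (f ∘ Inverse.to π))))

  ∑-*ˡ : ∀ c (f : Fin n → ℕ) → ∑ (λ x → c * f x) ≡ c * ∑ f
  ∑-*ˡ {zero} c f = sym (ℕ.*-zeroʳ c)
  ∑-*ˡ {suc n} c f = trans (cong (c * f zero ℕ.+_) (∑-*ˡ c (f ∘ suc)))
                           (sym (ℕ.*-distribˡ-+ c (f zero) _))

  ∑-*ʳ : ∀ c (f : Fin n → ℕ) → ∑ (λ x → f x * c) ≡ ∑ f * c
  ∑-*ʳ c f = trans (∑-cong λ x → ℕ.*-comm (f x) c) (trans (∑-*ˡ c f) (ℕ.*-comm c _))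

  ∑-when : ∀ (f : Fin n → ℕ) (d : Dec P) → ∑ (λ (x : Fin n) → f x when d) ≡ (∑ f) when d
  ∑-when f (yes _) = refl
  ∑-when {n} f (no _) = ∑-zero {n} λ _ → refl

  ∑-δ : ∀ (y : Fin n) (f : Fin n → ℕ) → ∑ (λ (x : Fin n) → f x when (x ≟ y)) ≡ f y
  ∑-δ {suc n} zero f = trans (cong (f zero ℕ.+_) (∑-zero {n} λ x → refl)) (ℕ.+-identityʳ _)
  ∑-δ {suc n} (suc y) f = trans (∑-cong {n} λ x → when-⇔ (suc x ≟ suc y) (x ≟ y) suc-injective (cong suc)) (∑-δ y (f ∘ suc))

  ∑-≥ : ∀ (f : Fin n → ℕ) y → f y ≤ ∑ f
  ∑-≥ f zero = ℕ.m≤m+n _ _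
  ∑-≥ f (suc y) = ℕ.≤-trans (∑-≥ (f ∘ suc) y) (ℕ.m≤n+m _ _)

  ∑-unique : ∀ (y : Fin n) (f : Fin n → ℕ) → (∀ x → x ≢ y → f x ≡ 0) → ∑ f ≡ f y
  ∑-unique y f h = trans (∑-cong λ x → eq x (x ≟ y)) (∑-δ y f)
    where
    eq : ∀ x (d : Dec (x ≡ y)) → f x ≡ f x when d
    eq x (yes _) = refl
    eq x (no x≢y) = h x x≢y

  ∑-↑ : ∀ m (f : Fin (m + n) → ℕ) →
        ∑ (λ (x : Fin (m + n)) → f x) ≡ ∑ (λ (x : Fin m) → f (x ↑ˡ n)) + ∑ (λ (y : Fin n) → f (m ↑ʳ y))
  ∑-↑ zero f = refl
  ∑-↑ {n} (suc m) f = trans (cong (f zero ℕ.+_) (∑-↑ {n} m (f ∘ suc))) (sym (ℕ.+-assoc (f zero) _ _))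

-- Ranges are summed through `Fin`, so that the lemmas on `∑` serve for them as well.
∑ℕ : ℕ → (ℕ → ℕ) → ℕ
∑ℕ n f = ∑ λ (i : Fin n) → f (toℕ i)

opaque
  unfolding ∑ _when_

  ∑ℕ-suc : ∀ n f → ∑ℕ (suc n) f ≡ f 0 + ∑ℕ n (f ∘ suc)
  ∑ℕ-suc n f = refl

  ∑-toℕ-↑ : ∀ m n (f : ℕ → ℕ) → (∀ j → f (m + j) ≡ 0) →
            ∑ℕ (m + n) f ≡ ∑ℕ m f
  ∑-toℕ-↑ m n f h = begin
    ∑ (λ (i : Fin (m + n)) → f (toℕ i)) ≡⟨ ∑-↑ {n} m _ ⟩
    ∑ (λ (i : Fin m) → f (toℕ (i ↑ˡ n))) + ∑ (λ (j : Fin n) → f (toℕ (m ↑ʳ j))) ≡⟨ cong₂ _+_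
      (∑-cong {m} λ x → cong f (toℕ-↑ˡ x n)) (∑-zero {n} λ y → trans (cong f (toℕ-↑ʳ m y)) (h (toℕ y))) ⟩
    ∑ (λ (i : Fin m) → f (toℕ i)) + 0 ≡⟨ ℕ.+-identityʳ _ ⟩
    ∑ (λ (i : Fin m) → f (toℕ i)) ∎
    where open ≡-Reasoning

  ∑-support : ∀ (f : ℕ → ℕ) → m ≤ n → (∀ j → m ≤ j → f j ≡ 0) → ∑ℕ n f ≡ ∑ℕ m f
  ∑-support {m} {n} f m≤n h = subst (λ k → ∑ℕ k f ≡ ∑ℕ m f) (ℕ.m+[n∸m]≡n m≤n)
    (∑-toℕ-↑ m (n ∸ m) f λ j → h (m + j) (ℕ.m≤m+n m j))

  ∑-δℕ : ∀ n (f : ℕ → ℕ) j → j < n → ∑ℕ n (λ i → f i when (j ℕ.≟ i)) ≡ f j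
  ∑-δℕ (suc n) f zero _ = trans (cong (f 0 ℕ.+_) (∑-zero {n} λ x → refl)) (ℕ.+-identityʳ _)
  ∑-δℕ (suc n) f (suc j) (s≤s j<n) =
    trans (∑-cong {n} λ x → when-⇔ (suc j ℕ.≟ suc (toℕ x)) (j ℕ.≟ toℕ x) ℕ.suc-injective (cong suc)) (∑-δℕ n (f ∘ suc) j j<n)

  ∑<-sum : ∀ n f → ∑< n f ≡ ∑ℕ n f
  ∑<-sum n f = trans (cong sumˡ (List.map-upTo f n)) (go n f)
    where
    go : ∀ n f → sumˡ (List.applyUpTo f n) ≡ ∑ℕ n f
    go zero f = refl
    go (suc n) f = cong (f 0 ℕ.+_) (go n (f ∘ suc))

  sum-tabulate : ∀ (f : Fin n → ℕ) → sumˡ (List.tabulate f) ≡ ∑ f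
  sum-tabulate {zero} f = refl
  sum-tabulate {suc n} f = cong (f zero ℕ.+_) (sum-tabulate (f ∘ suc))

  length-filter : ∀ {A : Set} {P : A → Set} (P? : ∀ x → Dec (P x)) xs →
                  length (filter P? xs) ≡ sumˡ (List.map (λ x → 1 when P? x) xs)
  length-filter P? [] = refl
  length-filter P? (x ∷ xs) with does (P? x)
  ... | true = cong suc (length-filter P? xs)
  ... | false = length-filter P? xs

  length-filter-allFin : ∀ {P : Fin n → Set} (P? : ∀ x → Dec (P x)) →
                         length (filter P? (allFin n)) ≡ ∑ (λ x → 1 when P? x)
  length-filter-allFin {n} P? = begin
    length (filter P? (allFin n)) ≡⟨ length-filter P? (allFin n) ⟩
    sumˡ (List.map (λ x → 1 when P? x) (allFin n)) ≡⟨ cong sumˡ (List.map-tabulate {n = n} id _) ⟩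
    sumˡ (List.tabulate λ x → 1 when P? x) ≡⟨ sum-tabulate {n} _ ⟩
    ∑ (λ x → 1 when P? x) ∎
    where open ≡-Reasoning

-- Enumerating vertex paths by prepending

module _ {n : ℕ} where
  open import Data.List.Membership.DecPropositional (_≟_ {n}) public using (_∈?_)

  opaque
    fresh? : (x : Fin n) (L : List (Fin n)) → Dec (x ∉ L)
    fresh? x L = ¬? (x ∈? L)

data Distinct {n : ℕ} : List (Fin n) → Set where
  [] : Distinct []
  _∷_ : x ∉ L → Distinct L → Distinct (x ∷ L)

∑-∈-∷ : y ∉ L → (f : Fin n → ℕ) →
        ∑ (λ z → f z when (z ∈? (y ∷ L))) ≡ f y + ∑ (λ z → f z when (z ∈? L))
∑-∈-∷ {y = y} {L} y∉L f = begin
  ∑ (λ z → f z when (z ∈? (y ∷ L))) ≡⟨ ∑-cong split ⟩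
  ∑ (λ z → f z when (z ≟ y) + f z when (z ∈? L)) ≡⟨ ∑-+ _ _ ⟩
  ∑ (λ z → f z when (z ≟ y)) + ∑ (λ z → f z when (z ∈? L)) ≡⟨ cong (ℕ._+ _) (∑-δ y f) ⟩
  f y + ∑ (λ z → f z when (z ∈? L)) ∎
  where
  open ≡-Reasoning
  split : ∀ z → f z when (z ∈? (y ∷ L)) ≡ f z when (z ≟ y) + f z when (z ∈? L)
  split z = go (z ≟ y)
    where
    go : Dec (z ≡ y) → f z when (z ∈? (y ∷ L)) ≡ f z when (z ≟ y) + f z when (z ∈? L)
    go (yes refl) = trans (when-yes (z ∈? (z ∷ L)) (here refl))
      (sym (trans (cong₂ _+_ (when-yes (z ≟ z) refl) (when-no (z ∈? L) y∉L)) (ℕ.+-identityʳ _)))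
    go (no z≢y) = trans
      (when-⇔ (z ∈? (y ∷ L)) (z ∈? L) (λ { (here e) → contradiction e z≢y ; (there h) → h }) there)
      (sym (cong (ℕ._+ _) (when-no (z ≟ y) z≢y)))

count-∈ : {L : List (Fin n)} → Distinct L → ∑ (λ z → 1 when (z ∈? L)) ≡ length L
count-∈ [] = ∑-zero λ z → when-no (z ∈? []) (λ ())
count-∈ (y∉L ∷ d) = trans (∑-∈-∷ y∉L (λ _ → 1)) (cong suc (count-∈ d))

count-fresh : {L : List (Fin n)} → Distinct L → ∑ (λ z → 1 when fresh? z L) + length L ≡ n
count-fresh {n} {L} d = begin
  ∑ (λ z → 1 when fresh? z L) + length L ≡⟨ cong (∑ (λ z → 1 when fresh? z L) ℕ.+_) (count-∈ d) ⟨
  ∑ (λ z → 1 when fresh? z L) + ∑ (λ z → 1 when (z ∈? L)) ≡⟨ ∑-+ _ _ ⟨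
  ∑ (λ z → 1 when fresh? z L + 1 when (z ∈? L)) ≡⟨ ∑-cong (λ z → trans (ℕ.+-comm (1 when fresh? z L) _)
                                                                     (when-compl 1 (z ∈? L) (fresh? z L) (λ p ¬p → ¬p p) id)) ⟩
  ∑ {n} (λ _ → 1) ≡⟨ ∑-const n 1 ⟩
  n * 1 ≡⟨ ℕ.*-identityʳ n ⟩
  n ∎
  where open ≡-Reasoning

distinct-≤ : {L : List (Fin n)} → Distinct L → length L ≤ n
distinct-≤ d = ℕ.≤-trans (ℕ.m≤n+m _ _) (ℕ.≤-reflexive (count-fresh d))

-- A vertex path is stored as its head x and the list vis of its further vertices.
Weight : ℕ → Set
Weight n = Fin n → List (Fin n) → ℕ

step : Graph n → Weight n → Weight n
step G w x vis = ∑ λ z → w z (x ∷ vis) when fresh? z (x ∷ vis) when adj? G z x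

-- E G i w x vis sums w over the paths arising from x ∷ vis by prepending i vertices.
E : Graph n → ℕ → Weight n → Weight n
E G zero w = w
E G (suc i) w = E G i (step G w)

-- The recursion of `E` splits off the vertex prepended last; this form splits off the first one,
-- for arguments that follow a path from its fixed end.
E-step : ∀ (G : Graph n) i w → E G (suc i) w ≡ step G (E G i w)
E-step G zero w = refl
E-step G (suc i) w = E-step G i (step G w)

-- These are the configurations over which `E` sums, so weights need to be compared on them only.
-- With `v₀ = []` they are the paths of length `i` between `x` and `y`; a nonempty `v₀` is an
-- earlier history whose vertices are forbidden.
data Ext {n : ℕ} (G : Graph n) (y : Fin n) (v₀ : List (Fin n)) : ℕ → Fin n → List (Fin n) → Set where
  base : Ext G y v₀ 0 y v₀
  grow : ∀ {i x z vis} → Adj G z x → z ∉ (x ∷ vis) → Ext G y v₀ i x vis → Ext G y v₀ (suc i) z (x ∷ vis)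

step-mono : ∀ (G : Graph n) {w w′ : Weight n} {x vis} →
            (∀ z → Adj G z x → z ∉ (x ∷ vis) → w z (x ∷ vis) ≤ w′ z (x ∷ vis)) →
            step G w x vis ≤ step G w′ x vis
step-mono G h = ∑-mono λ z → when-mono (adj? G z _) λ e → when-mono (fresh? z _) λ f → h z e f

module _ (G : Graph n) {y : Fin n} {v₀ : List (Fin n)} where

  E-mono : ∀ i {w w′ : Weight n} → (∀ {x vis} → Ext G y v₀ i x vis → w x vis ≤ w′ x vis) →
           E G i w y v₀ ≤ E G i w′ y v₀
  E-mono zero h = h base
  E-mono (suc i) {w} {w′} h = E-mono i λ p → step-mono G {w} {w′} λ z e f → h (grow e f p)

  E-cong : ∀ i {w w′ : Weight n} → (∀ {x vis} → Ext G y v₀ i x vis → w x vis ≡ w′ x vis) →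
           E G i w y v₀ ≡ E G i w′ y v₀
  E-cong i h = ℕ.≤-antisym (E-mono i λ p → ℕ.≤-reflexive (h p)) (E-mono i λ p → ℕ.≤-reflexive (sym (h p)))

  E-≥ : ∀ {i x vis} (w : Weight n) → Ext G y v₀ i x vis → w x vis ≤ E G i w y v₀
  E-≥ w base = ℕ.≤-refl
  E-≥ {x = z} {x ∷ vis} w (grow e f p) = ℕ.≤-trans (ℕ.≤-trans
    (ℕ.≤-reflexive (sym (trans (when-yes (adj? G z x) e) (when-yes (fresh? z (x ∷ vis)) f))))
    (∑-≥ (λ z → w z (x ∷ vis) when fresh? z (x ∷ vis) when adj? G z x) z))
    (E-≥ (step G w) p)

Ext-length : ∀ {G : Graph n} → Ext G y v₀ i x vis → length vis ≡ i + length v₀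
Ext-length base = refl
Ext-length (grow _ _ p) = cong suc (Ext-length p)

Ext-distinct : ∀ {G : Graph n} → Distinct (y ∷ v₀) → Ext G y v₀ i x vis → Distinct (x ∷ vis)
Ext-distinct d base = d
Ext-distinct d (grow _ f p) = f ∷ Ext-distinct d p

E-∑ : ∀ {m} (G : Graph n) i (w : Fin m → Weight n) y v₀ →
      E G i (λ x vis → ∑ λ a → w a x vis) y v₀ ≡ ∑ λ a → E G i (w a) y v₀
E-∑ G zero w y v₀ = refl
E-∑ {m = m} G (suc i) w y v₀ = trans (E-cong G i λ {x} {vis} _ → lem x vis) (E-∑ G i (λ a → step G (w a)) y v₀)
  where
  lem : ∀ x vis → step G (λ x vis → ∑ λ a → w a x vis) x vis ≡ ∑ λ a → step G (w a) x vis
  lem x vis = trans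
    (∑-cong λ z → trans (cong (_when adj? G z x) (sym (∑-when {m} (λ a → w a z (x ∷ vis)) (fresh? z (x ∷ vis)))))
                        (sym (∑-when {m} _ (adj? G z x))))
    (∑-comm λ z a → w a z (x ∷ vis) when fresh? z (x ∷ vis) when adj? G z x)

E-+ : ∀ (G : Graph n) i (w w′ : Weight n) y v₀ →
      E G i (λ x vis → w x vis + w′ x vis) y v₀ ≡ E G i w y v₀ + E G i w′ y v₀
E-+ G zero w w′ y v₀ = refl
E-+ G (suc i) w w′ y v₀ = trans (E-cong G i λ {x} {vis} _ → lem x vis) (E-+ G i (step G w) (step G w′) y v₀)
  where
  lem : ∀ x vis → step G (λ x vis → w x vis + w′ x vis) x vis ≡ step G w x vis + step G w′ x vis
  lem x vis = trans (∑-cong λ z → trans (cong (_when adj? G z x) (when-+ (w z (x ∷ vis)) _ (fresh? z _))) (when-+ (w z (x ∷ vis) when fresh? z (x ∷ vis)) _ (adj? G z x)))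
    (∑-+ _ _)

E-* : ∀ (G : Graph n) i c (w : Weight n) y v₀ →
      E G i (λ x vis → c * w x vis) y v₀ ≡ c * E G i w y v₀
E-* G zero c w y v₀ = refl
E-* G (suc i) c w y v₀ = trans (E-cong G i λ {x} {vis} _ → lem x vis) (E-* G i c (step G w) y v₀)
  where
  lem : ∀ x vis → step G (λ x vis → c * w x vis) x vis ≡ c * step G w x vis
  lem x vis = trans (∑-cong λ z → sym (trans (when-* c _ (adj? G z x)) (cong (_when adj? G z x) (when-* c _ (fresh? z _)))))
    (∑-*ˡ c _)

E-0 : ∀ (G : Graph n) i y v₀ → E G i (λ _ _ → 0) y v₀ ≡ 0
E-0 G i y v₀ = E-* G i 0 (λ _ _ → 0) y v₀

-- A surviving configuration would list more than `n` distinct vertices.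
E-long : ∀ (G : Graph n) i w {y v₀} → Distinct (y ∷ v₀) → n < i + suc (length v₀) → E G i w y v₀ ≡ 0
E-long {n} G i w {y} {v₀} d n< = trans (E-cong G i λ p → ⊥-elim (ℕ.<⇒≱ (absurd p) (distinct-≤ (Ext-distinct d p)))) (E-0 G i y v₀)
  where
  absurd : ∀ {x vis} → Ext G y v₀ i x vis → n < suc (length vis)
  absurd p = subst (n <_) (trans (ℕ.+-suc i _) (cong suc (sym (Ext-length p)))) n<

one : Weight n
one _ _ = 1

single : (y : Fin n) → Distinct (y ∷ [])
single y = (λ ()) ∷ []

-- The number of vertex paths of length i, both orientations counted.
oriented : Graph n → ℕ → ℕ
oriented G i = ∑ λ y → E G i one y []

orientedAt : Graph n → Fin n → ℕ → ℕ
orientedAt G v i = ∑ λ y → E G i (λ x vis → 1 when (v ∈? (x ∷ vis))) y []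

oriented-zero : (G : Graph n) → oriented G 0 ≡ n
oriented-zero {n} G = trans (∑-const n 1) (ℕ.*-identityʳ n)

oriented-long : ∀ (G : Graph n) i → n ≤ i → oriented G i ≡ 0
oriented-long {n} G i n≤i = ∑-zero λ y → E-long G i one (single y) (ℕ.≤-trans (s≤s n≤i) (ℕ.≤-reflexive (ℕ.+-comm 1 i)))

-- From enumerated vectors to prepended paths

∑ⱽ : ∀ k → (Vec (Fin n) k → ℕ) → ℕ
∑ⱽ zero f = f []
∑ⱽ (suc k) f = ∑ λ x → ∑ⱽ k (λ p → f (x ∷ p))

∑ⱽ-cong : ∀ k {f g : Vec (Fin n) k → ℕ} → (∀ p → f p ≡ g p) → ∑ⱽ k f ≡ ∑ⱽ k g
∑ⱽ-cong zero h = h []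
∑ⱽ-cong (suc k) h = ∑-cong λ x → ∑ⱽ-cong k λ p → h (x ∷ p)

∑ⱽ-+ : ∀ k (f g : Vec (Fin n) k → ℕ) → ∑ⱽ k (λ p → f p + g p) ≡ ∑ⱽ k f + ∑ⱽ k g
∑ⱽ-+ zero f g = refl
∑ⱽ-+ (suc k) f g = trans (∑-cong λ x → ∑ⱽ-+ k (λ p → f (x ∷ p)) (λ p → g (x ∷ p))) (∑-+ _ _)

∑ⱽ-∑ : ∀ {m} k (f : Fin m → Vec (Fin n) k → ℕ) → ∑ⱽ k (λ p → ∑ λ x → f x p) ≡ ∑ λ x → ∑ⱽ k (f x)
∑ⱽ-∑ zero f = refl
∑ⱽ-∑ (suc k) f = trans (∑-cong λ y → ∑ⱽ-∑ k (λ x p → f x (y ∷ p))) (∑-comm λ y x → ∑ⱽ k (λ p → f x (y ∷ p)))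

∑ⱽ-∷ʳ : ∀ k (f : Vec (Fin n) (suc k) → ℕ) → ∑ⱽ (suc k) f ≡ ∑ λ x → ∑ⱽ k (λ p → f (p ∷ʳ x))
∑ⱽ-∷ʳ zero f = refl
∑ⱽ-∷ʳ (suc k) f = trans (∑-cong λ y → ∑ⱽ-∷ʳ k (λ p → f (y ∷ p))) (∑-comm λ y x → ∑ⱽ k (λ p → f (y ∷ (p ∷ʳ x))))

∑ⱽ-reverse : ∀ k (f : Vec (Fin n) k → ℕ) → ∑ⱽ k (λ p → f (reverse p)) ≡ ∑ⱽ k f
∑ⱽ-reverse zero f = refl
∑ⱽ-reverse (suc k) f = begin
  ∑ (λ x → ∑ⱽ k (λ p → f (reverse (x ∷ p)))) ≡⟨ ∑-cong (λ x → ∑ⱽ-cong k λ p → cong f (reverse-∷ x p)) ⟩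
  ∑ (λ x → ∑ⱽ k (λ p → f (reverse p ∷ʳ x))) ≡⟨ ∑-cong (λ x → ∑ⱽ-reverse k (λ p → f (p ∷ʳ x))) ⟩
  ∑ (λ x → ∑ⱽ k (λ p → f (p ∷ʳ x))) ≡⟨ ∑ⱽ-∷ʳ k f ⟨
  ∑ⱽ (suc k) f ∎
  where open ≡-Reasoning

sum-allVecs : ∀ k (g : Vec (Fin n) k → ℕ) → sumˡ (List.map g (allVecs n k)) ≡ ∑ⱽ k g
sum-allVecs zero g = ℕ.+-identityʳ (g [])
sum-allVecs {n} (suc k) g = begin
  sumˡ (List.map g (cartesianProductWith _∷_ (allFin n) (allVecs n k))) ≡⟨ product (allFin n) ⟩
  sumˡ (List.map (λ x → ∑ⱽ k (λ p → g (x ∷ p))) (allFin n)) ≡⟨ cong sumˡ (List.map-tabulate {n = n} id _) ⟩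
  sumˡ (List.tabulate (λ x → ∑ⱽ k (λ p → g (x ∷ p)))) ≡⟨ sum-tabulate {n} _ ⟩
  ∑ⱽ (suc k) g ∎
  where
  open ≡-Reasoning
  product : ∀ xs → sumˡ (List.map g (cartesianProductWith _∷_ xs (allVecs n k))) ≡
                   sumˡ (List.map (λ x → ∑ⱽ k (λ p → g (x ∷ p))) xs)
  product [] = refl
  product (x ∷ xs) = trans (cong sumˡ (List.map-++ g (List.map (x ∷_) (allVecs n k)) _))
    (trans (sum-++ (List.map g (List.map (x ∷_) (allVecs n k))) _)
      (cong₂ _+_ (trans (cong sumˡ (sym (List.map-∘ (allVecs n k)))) (sum-allVecs k (λ p → g (x ∷ p)))) (product xs)))

isVertexPath? : (G : Graph n) (p : Vec (Fin n) k) → Dec (IsVertexPath G p)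
isVertexPath? G p = allPairs? (λ x y → ¬? (x ≟ y)) p ×-dec linked? (adj? G) p

private
  All-∷ʳ : ∀ {A : Set} {P : A → Set} {x} {p : Vec A k} → All P p → P x → All P (p ∷ʳ x)
  All-∷ʳ [] px = px ∷ []
  All-∷ʳ (y ∷ ys) px = y ∷ All-∷ʳ ys px

  All-reverse : ∀ {A : Set} {P : A → Set} {p : Vec A k} → All P p → All P (reverse p)
  All-reverse [] = []
  All-reverse {p = x ∷ p} (y ∷ ys) = subst (All _) (sym (reverse-∷ x p)) (All-∷ʳ (All-reverse ys) y)

  Unique-∷ʳ : ∀ {x} {p : Vec (Fin n) k} → Unique p → All (_≢ x) p → Unique (p ∷ʳ x)
  Unique-∷ʳ [] [] = [] ∷ []
  Unique-∷ʳ (a ∷ as) (b ∷ bs) = All-∷ʳ a b ∷ Unique-∷ʳ as bs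

  Linked-∷ʳ : ∀ (G : Graph n) {x} {p : Vec (Fin n) (suc k)} → Linked (Adj G) p → Adj G (last p) x → Linked (Adj G) (p ∷ʳ x)
  Linked-∷ʳ G [-] e = e ∷ [-]
  Linked-∷ʳ G {x} {p = z ∷ y ∷ p} (e′ ∷ l) e = e′ ∷ Linked-∷ʳ G l e

vertexPath-reverse : ∀ (G : Graph n) {p : Vec (Fin n) k} → IsVertexPath G p → IsVertexPath G (reverse p)
vertexPath-reverse G {[]} v = v
vertexPath-reverse G {x ∷ p} (a ∷ u , l) = subst (IsVertexPath G) (sym (reverse-∷ x p))
  (Unique-∷ʳ (proj₁ ih) (All-reverse (All.map ≢-sym a)) , link p l (proj₂ ih))
  where
  ih = vertexPath-reverse G {p} (u , Linked.tail l)
  link : ∀ {k} (p : Vec (Fin _) k) → Linked (Adj G) (x ∷ p) → Linked (Adj G) (reverse p) → Linked (Adj G) (reverse p ∷ʳ x)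
  link [] _ _ = [-]
  link (y ∷ p) (e ∷ _) l = Linked-∷ʳ G l (subst (λ z → Adj G z x) (sym (last-reverse (y ∷ p))) (symm G e))

last-∈ : (p : Vec (Fin n) (suc k)) → last p V.∈ p
last-∈ (x ∷ []) = VAny.here refl
last-∈ (x ∷ y ∷ p) = VAny.there (last-∈ (y ∷ p))

∉⇒All≢ : ∀ {x : Fin n} (p : Vec (Fin n) k) → x ∉ toList p → All (x ≢_) p
∉⇒All≢ [] _ = []
∉⇒All≢ (y ∷ p) h = (λ e → h (here e)) ∷ ∉⇒All≢ p (h ∘ there)

All≢⇒∉ : ∀ {x : Fin n} {p : Vec (Fin n) k} → All (x ≢_) p → x ∉ toList p
All≢⇒∉ (h ∷ _) (here e) = h e
All≢⇒∉ (_ ∷ hs) (there e) = All≢⇒∉ hs e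

All≢-∈ : ∀ {x y : Fin n} {p : Vec (Fin n) k} → All (x ≢_) p → y V.∈ p → x ≢ y
All≢-∈ (h ∷ _) (VAny.here refl) = h
All≢-∈ (_ ∷ hs) (VAny.there e) = All≢-∈ hs e

-- With at least two vertices the ends of a path differ, so exactly one of `p` and `reverse p`
-- passes the test that the head is at most the last vertex; summing over `p` and over `reverse p`
-- therefore meets every vertex path once.
∑ⱽ-unoriented : ∀ (G : Graph n) {k} (χ : Vec (Fin n) (suc (suc k)) → ℕ) → (∀ p → χ (reverse p) ≡ χ p) →
                2 * ∑ⱽ _ (λ p → χ p when isPath? G p) ≡ ∑ⱽ _ (λ p → χ p when isVertexPath? G p)
∑ⱽ-unoriented G {k} χ χ-rev = begin
  2 * S ≡⟨ cong (S ℕ.+_) (ℕ.+-identityʳ S) ⟩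
  S + S ≡⟨ cong (S ℕ.+_) (∑ⱽ-reverse (suc (suc k)) w) ⟨
  S + ∑ⱽ _ (λ p → χ (reverse p) when isPath? G (reverse p)) ≡⟨ ∑ⱽ-+ (suc (suc k)) w (w ∘ reverse) ⟨
  ∑ⱽ _ (λ p → χ p when isPath? G p + χ (reverse p) when isPath? G (reverse p))
                                                   ≡⟨ ∑ⱽ-cong _ (λ p → both p (isVertexPath? G p)) ⟩
  ∑ⱽ _ (λ p → χ p when isVertexPath? G p) ∎
  where
  open ≡-Reasoning
  w : Vec (Fin _) (suc (suc k)) → ℕ
  w p = χ p when isPath? G p
  S = ∑ⱽ _ w
  unreverse : ∀ p → IsVertexPath G (reverse p) → IsVertexPath G p
  unreverse p v = subst (IsVertexPath G) (reverse-involutive p) (vertexPath-reverse G v)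
  head-reverse : ∀ (p : Vec (Fin _) (suc (suc k))) → head (reverse p) ≡ last p
  head-reverse p = trans (sym (last-reverse (reverse p))) (cong last (reverse-involutive p))
  both : ∀ p → Dec (IsVertexPath G p) →
         χ p when isPath? G p + χ (reverse p) when isPath? G (reverse p) ≡ χ p when isVertexPath? G p
  both p (no ¬v) = trans (cong₂ _+_ (when-no (isPath? G p) (¬v ∘ proj₁)) (when-no (isPath? G (reverse p)) (¬v ∘ unreverse p ∘ proj₁)))
                         (sym (when-no (isVertexPath? G p) ¬v))
  both p@(x ∷ y ∷ q) (yes v@(a ∷ _ , _)) = begin
    χ p when isPath? G p + χ (reverse p) when isPath? G (reverse p) ≡⟨ cong (λ c → χ p when isPath? G p + c when isPath? G (reverse p)) (χ-rev p) ⟩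
    χ p when isPath? G p + χ p when isPath? G (reverse p) ≡⟨ when-compl (χ p) (isPath? G p) (isPath? G (reverse p)) excl exh ⟩
    χ p ≡⟨ when-yes (isVertexPath? G p) v ⟨
    χ p when isVertexPath? G p ∎
    where
    head≢last : head p ≢ last p
    head≢last = All≢-∈ a (last-∈ (y ∷ q))
    excl : IsPath G p → ¬ IsPath G (reverse p)
    excl (_ , h≤l) (_ , l≤h) = head≢last (Fin.≤-antisym h≤l
      (subst₂ Fin._≤_ (head-reverse p) (last-reverse p) l≤h))
    exh : ¬ IsPath G p → IsPath G (reverse p)
    exh ¬h = vertexPath-reverse G v , subst₂ Fin._≤_ (sym (head-reverse p)) (sym (last-reverse p))
      (case Fin.≤-total (last p) (head p) of λ { (inj₁ l≤h) → l≤h ; (inj₂ h≤l) → ⊥-elim (¬h (v , h≤l)) })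

∑ⱽ-E : ∀ (G : Graph n) i (w : Weight n) →
       ∑ⱽ (suc i) (λ p → w (head p) (toList (tail p)) when isVertexPath? G p) ≡ ∑ λ x → E G i w x []
∑ⱽ-E G zero w = ∑-cong λ x → when-yes (isVertexPath? G (x ∷ [])) ([] ∷ [] , [-])
∑ⱽ-E {n} G (suc i) w = begin
  ∑ (λ x → ∑ⱽ (suc i) (λ p → w x (toList p) when isVertexPath? G (x ∷ p))) ≡⟨ ∑ⱽ-∑ {n} (suc i) (λ x p → w x (toList p) when isVertexPath? G (x ∷ p)) ⟨
  ∑ⱽ (suc i) (λ p → ∑ λ x → w x (toList p) when isVertexPath? G (x ∷ p)) ≡⟨ ∑ⱽ-cong (suc i) prepend ⟩
  ∑ⱽ (suc i) (λ p → step G w (head p) (toList (tail p)) when isVertexPath? G p) ≡⟨ ∑ⱽ-E G i (step G w) ⟩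
  ∑ (λ x → E G i (step G w) x []) ∎
  where
  open ≡-Reasoning
  prepend : ∀ p → ∑ (λ x → w x (toList p) when isVertexPath? G (x ∷ p)) ≡
                  step G w (head p) (toList (tail p)) when isVertexPath? G p
  prepend p@(y ∷ q) = trans (∑-cong λ x → go x (isVertexPath? G p) (fresh? x (toList p)) (adj? G x y)) (∑-when _ (isVertexPath? G p))
    where
    go : ∀ x → Dec (IsVertexPath G p) → Dec (x ∉ toList p) → Dec (Adj G x y) → w x (toList p) when isVertexPath? G (x ∷ p) ≡
               w x (toList p) when fresh? x (toList p) when adj? G x y when isVertexPath? G p
    go x (no ¬v) _ _ = trans (when-no (isVertexPath? G (x ∷ p)) λ { (_ ∷ u , l) → ¬v (u , Linked.tail l) })
                         (sym (when-no (isVertexPath? G p) ¬v))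
    go x (yes v) (no ¬f) _ = trans (when-no (isVertexPath? G (x ∷ p)) λ { (a ∷ _ , _) → ¬f (All≢⇒∉ a) })
                         (sym (trans (when-yes (isVertexPath? G p) v)
                              (trans (cong (_when adj? G x y) (when-no (fresh? x (toList p)) ¬f)) (when-0 (adj? G x y)))))
    go x (yes v) (yes f) (no ¬e) = trans (when-no (isVertexPath? G (x ∷ p)) λ { (_ , e ∷ _) → ¬e e })
                         (sym (trans (when-yes (isVertexPath? G p) v) (when-no (adj? G x y) ¬e)))
    go x (yes v) (yes f) (yes e) = trans (when-yes (isVertexPath? G (x ∷ p)) (∉⇒All≢ p f ∷ proj₁ v , e ∷ proj₂ v))
                         (sym (trans (when-yes (isVertexPath? G p) v) (trans (when-yes (adj? G x y) e) (when-yes (fresh? x (toList p)) f))))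

length-paths : ∀ (G : Graph n) i → length (paths G i) ≡ ∑ⱽ (suc i) (λ p → 1 when isPath? G p)
length-paths {n} G i = trans (length-filter (isPath? G) (allVecs n (suc i))) (sum-allVecs (suc i) (λ p → 1 when isPath? G p))

paths-zero : ∀ (G : Graph n) → length (paths G 0) ≡ n
paths-zero {n} G = trans (length-paths G 0) (trans
  (∑-cong λ x → when-yes (isPath? G (x ∷ [])) (([] ∷ [] , [-]) , Fin.≤-refl))
  (trans (∑-const n 1) (ℕ.*-identityʳ n)))

paths-suc : ∀ (G : Graph n) i → 2 * length (paths G (suc i)) ≡ oriented G (suc i)
paths-suc G i = trans (cong (2 *_) (length-paths G (suc i)))
  (trans (∑ⱽ-unoriented G {i} (λ _ → 1) (λ _ → refl)) (∑ⱽ-E G (suc i) one))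

module _ {n : ℕ} where
  open VDec (_≟_ {n}) using () renaming (_∈?_ to _∈ⱽ?_)

  filter-filter : ∀ {A : Set} {P Q : A → Set} (P? : ∀ x → Dec (P x)) (Q? : ∀ x → Dec (Q x)) xs →
                  length (filter P? (filter Q? xs)) ≡ sumˡ (List.map (λ x → 1 when P? x when Q? x) xs)
  filter-filter P? Q? [] = refl
  filter-filter P? Q? (x ∷ xs) with Q? x
  ... | no ¬q = trans (filter-filter P? Q? xs) (sym (cong (ℕ._+ _) (when-no (no ¬q) ¬q)))
  ... | yes q with P? x
  ... | yes p = cong₂ _+_ (sym (trans (when-yes (yes q) q) (when-yes (yes p) p))) (filter-filter P? Q? xs)
  ... | no ¬p = trans (filter-filter P? Q? xs) (sym (cong (ℕ._+ _) (trans (when-yes (yes q) q) (when-no (no ¬p) ¬p))))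

  length-pathsThrough : ∀ (G : Graph n) v i → length (pathsThrough G v i) ≡
                        ∑ⱽ (suc i) (λ p → 1 when (v ∈ⱽ? p) when isPath? G p)
  length-pathsThrough G v i = trans (filter-filter (v ∈ⱽ?_) (isPath? G) (allVecs n (suc i))) (sum-allVecs (suc i) (λ p → 1 when (v ∈ⱽ? p) when isPath? G p))

  ∈-∷ʳ⁻ : ∀ {v x : Fin n} (p : Vec (Fin n) k) → v V.∈ (p ∷ʳ x) → v V.∈ (x ∷ p)
  ∈-∷ʳ⁻ [] (VAny.here e) = VAny.here e
  ∈-∷ʳ⁻ (y ∷ p) (VAny.here e) = VAny.there (VAny.here e)
  ∈-∷ʳ⁻ (y ∷ p) (VAny.there h) with ∈-∷ʳ⁻ p h
  ... | VAny.here e = VAny.here e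
  ... | VAny.there h = VAny.there (VAny.there h)

  ∈-reverse⁻ : ∀ {v : Fin n} (p : Vec (Fin n) k) → v V.∈ reverse p → v V.∈ p
  ∈-reverse⁻ [] h = h
  ∈-reverse⁻ (x ∷ p) h with ∈-∷ʳ⁻ (reverse p) (subst (_ V.∈_) (reverse-∷ x p) h)
  ... | VAny.here e = VAny.here e
  ... | VAny.there h = VAny.there (∈-reverse⁻ p h)

  ∈-reverse⁺ : ∀ {v : Fin n} (p : Vec (Fin n) k) → v V.∈ p → v V.∈ reverse p
  ∈-reverse⁺ p h = ∈-reverse⁻ (reverse p) (subst (_ V.∈_) (sym (reverse-involutive p)) h)

  pathsThrough-zero : ∀ (G : Graph n) v → length (pathsThrough G v 0) ≡ 1
  pathsThrough-zero G v = trans (length-pathsThrough G v 0) (trans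
    (∑-cong λ x → trans (when-yes (isPath? G (x ∷ [])) (([] ∷ [] , [-]) , Fin.≤-refl))
                        (when-⇔ (v ∈ⱽ? (x ∷ [])) (x ≟ v) (λ { (VAny.here e) → sym e }) (λ e → VAny.here (sym e))))
    (∑-δ v (λ _ → 1)))

  pathsThrough-suc : ∀ (G : Graph n) v i → 2 * length (pathsThrough G v (suc i)) ≡ orientedAt G v (suc i)
  pathsThrough-suc G v i = begin
    2 * length (pathsThrough G v (suc i)) ≡⟨ cong (2 *_) (length-pathsThrough G v (suc i)) ⟩
    2 * ∑ⱽ (suc (suc i)) (λ p → 1 when (v ∈ⱽ? p) when isPath? G p) ≡⟨ ∑ⱽ-unoriented G {i} (λ p → 1 when (v ∈ⱽ? p))
                                                                            (λ p → when-⇔ (v ∈ⱽ? reverse p) (v ∈ⱽ? p) (∈-reverse⁻ p) (∈-reverse⁺ p)) ⟩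
    ∑ⱽ (suc (suc i)) (λ p → 1 when (v ∈ⱽ? p) when isVertexPath? G p) ≡⟨ ∑ⱽ-cong (suc (suc i)) (λ p → cong (_when isVertexPath? G p) (to-list p)) ⟩
    ∑ⱽ (suc (suc i)) (λ p → 1 when (v ∈? (head p ∷ toList (tail p))) when isVertexPath? G p)
                                                                         ≡⟨ ∑ⱽ-E G (suc i) (λ x vis → 1 when (v ∈? (x ∷ vis))) ⟩
    orientedAt G v (suc i) ∎
    where
    open ≡-Reasoning
    to-list : ∀ (p : Vec (Fin n) (suc k)) → 1 when (v ∈ⱽ? p) ≡ 1 when (v ∈? (head p ∷ toList (tail p)))
    to-list (x ∷ p) = when-⇔ (v ∈ⱽ? (x ∷ p)) (v ∈? (x ∷ toList p)) ∈-toList⁺ ∈-toList⁻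

-- Quotients and averages

toℚᵘ-quotient : ∀ a b → ℚ.toℚᵘ (quotient a (suc b)) ℚᵘ.≃ ℚᵘ.mkℚᵘ (ℤ.+ a) b
toℚᵘ-quotient a b = ℚ.toℚᵘ-fromℚᵘ (ℚᵘ.mkℚᵘ (ℤ.+ a) b)

private
  cross-≤ : ∀ {a d c b} → a * d ≤ c * b → ℤ.+ a ℤ.* ℤ.+ d ℤ.≤ ℤ.+ c ℤ.* ℤ.+ b
  cross-≤ {a} {d} {c} {b} h = subst₂ ℤ._≤_ (ℤ.pos-* a d) (ℤ.pos-* c b) (ℤ.+≤+ h)

  cross-< : ∀ {a d c b} → a * d < c * b → ℤ.+ a ℤ.* ℤ.+ d ℤ.< ℤ.+ c ℤ.* ℤ.+ b
  cross-< {a} {d} {c} {b} h = subst₂ ℤ._<_ (ℤ.pos-* a d) (ℤ.pos-* c b) (ℤ.+<+ h)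

quotient-≤ : ∀ {b d a c} → 0 < b → 0 < d → a * d ≤ c * b → quotient a b ℚ.≤ quotient c d
quotient-≤ {suc b} {suc d} {a} {c} _ _ h = ℚ.toℚᵘ-cancel-≤
  (ℚᵘ.≤-respʳ-≃ (ℚᵘ.≃-sym (toℚᵘ-quotient c d)) (ℚᵘ.≤-respˡ-≃ (ℚᵘ.≃-sym (toℚᵘ-quotient a b))
    (ℚᵘ.*≤* (cross-≤ {a} {suc d} {c} {suc b} h))))

quotient-< : ∀ {b d a c} → 0 < b → 0 < d → a * d < c * b → quotient a b ℚ.< quotient c d
quotient-< {suc b} {suc d} {a} {c} _ _ h = ℚ.toℚᵘ-cancel-<
  (ℚᵘ.<-respʳ-≃ (ℚᵘ.≃-sym (toℚᵘ-quotient c d)) (ℚᵘ.<-respˡ-≃ (ℚᵘ.≃-sym (toℚᵘ-quotient a b))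
    (ℚᵘ.*<* (cross-< {a} {suc d} {c} {suc b} h))))

quotient-≡ : ∀ {b d a c} → 0 < b → 0 < d → a * d ≡ c * b → quotient a b ≡ quotient c d
quotient-≡ {b} {d} {a} {c} 0<b 0<d h = ℚ.≤-antisym (quotient-≤ 0<b 0<d (ℕ.≤-reflexive h)) (quotient-≤ 0<d 0<b (ℕ.≤-reflexive (sym h)))

quotient-<⁻¹ : ∀ {b d a c} → 0 < b → 0 < d → quotient a b ℚ.< quotient c d → a * d < c * b
quotient-<⁻¹ {b} {d} {a} {c} 0<b 0<d h with a * d ℕ.<? c * b
... | yes p = p
... | no ¬p = ⊥-elim (ℚ.<-irrefl refl (ℚ.<-≤-trans h (quotient-≤ 0<d 0<b (ℕ.≮⇒≥ ¬p))))

quotient-cancel : ∀ k a b → quotient (suc k * a) (suc k * b) ≡ quotient a b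
quotient-cancel k a zero = cong (quotient (suc k * a)) (ℕ.*-zeroʳ k)
quotient-cancel k a (suc b) = quotient-≡ {suc k * suc b} {suc b} {suc k * a} {a} z<s z<s (eq (suc k) a (suc b))
  where
  eq : ∀ k a b → k * a * b ≡ a * (k * b)
  eq = solve-∀

quotient-nonZero : ∀ {a b} → 0 < a → 0 < b → ℚ.NonZero (quotient a b)
quotient-nonZero {a} {b} 0<a 0<b = ℚ.>-nonZero (quotient-< {1} {b} {0} {a} z<s 0<b (ℕ.≤-trans 0<a (ℕ.≤-reflexive (sym (ℕ.*-identityʳ a)))))

quotient-* : ∀ {b d a c} → 0 < b → 0 < d → quotient a b ℚ.* quotient c d ≡ quotient (a * c) (b * d)
quotient-* {suc b} {suc d} {a} {c} _ _ = ℚ.toℚᵘ-injective (ℚᵘ.≃-trans (ℚ.toℚᵘ-homo-* (quotient a (suc b)) (quotient c (suc d)))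
  (ℚᵘ.≃-trans (ℚᵘ.*-cong (toℚᵘ-quotient a b) (toℚᵘ-quotient c d))
  (ℚᵘ.≃-trans (ℚᵘ.≃-reflexive (cong (λ z → ℚᵘ.mkℚᵘ z (d + b * suc d)) (sym (ℤ.pos-* a c))))
              (ℚᵘ.≃-sym (toℚᵘ-quotient (a * c) (d + b * suc d))))))

quotient-÷ : ∀ {b c d a} → 0 < b → 0 < c → 0 < d → .{{_ : ℚ.NonZero (quotient c d)}} →
             quotient a b ℚ.÷ quotient c d ≡ quotient (a * d) (b * c)
quotient-÷ {b} {c} {d} {a} 0<b 0<c 0<d = begin
  X ℚ.* ℚ.1/ Y ≡⟨ cong (ℚ._* ℚ.1/ Y) Z*Y≡X ⟨
  Z ℚ.* Y ℚ.* ℚ.1/ Y ≡⟨ ℚ.*-assoc Z Y (ℚ.1/ Y) ⟩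
  Z ℚ.* (Y ℚ.* ℚ.1/ Y) ≡⟨ cong (Z ℚ.*_) (ℚ.*-inverseʳ Y) ⟩
  Z ℚ.* ℚ.1ℚ ≡⟨ ℚ.*-identityʳ Z ⟩
  Z ∎
  where
  open ≡-Reasoning
  X = quotient a b
  Y = quotient c d
  Z = quotient (a * d) (b * c)
  0<bc : 0 < b * c
  0<bc = ℕ.*-mono-≤ 0<b 0<c
  eq : ∀ a b c d → a * d * c * b ≡ a * (b * c * d)
  eq = solve-∀
  Z*Y≡X : Z ℚ.* Y ≡ X
  Z*Y≡X = trans (quotient-* 0<bc 0<d) (quotient-≡ (ℕ.*-mono-≤ 0<bc 0<d) 0<b (eq a b c d))

nonNegative-quotient : ∀ p → 0ℚ ℚ.≤ p → ∃[ a ] ∃[ b ] (0 < b × p ≡ quotient a b)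
nonNegative-quotient (ℚ.mkℚ (ℤ.+ a) b-1 c) _ = a , suc b-1 , z<s , sym (ℚ.fromℚᵘ-toℚᵘ (ℚ.mkℚ (ℤ.+ a) b-1 c))
nonNegative-quotient (ℚ.mkℚ (ℤ.-[1+ a ]) b-1 c) (ℚ.*≤* ())

pathCount : Graph n → ℕ
pathCount {n} G = ∑ℕ n (oriented G)

lengthSum : Graph n → ℕ
lengthSum {n} G = ∑ℕ n (λ i → i * oriented G i)

private
  double-lengths : ∀ n (p o : ℕ → ℕ) → (∀ i → 2 * p (suc i) ≡ o (suc i)) →
                   2 * ∑ℕ n (λ i → i * p i) ≡ ∑ℕ n (λ i → i * o i)
  double-lengths n p o h = trans (sym (∑-*ˡ {n} 2 _)) (∑-cong {n} λ x → eq (toℕ x))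
    where
    swap : ∀ a b → 2 * (a * b) ≡ a * (2 * b)
    swap = solve-∀
    eq : ∀ i → 2 * (i * p i) ≡ i * o i
    eq zero = refl
    eq (suc i) = trans (swap (suc i) (p (suc i))) (cong (suc i *_) (h i))

  double-counts : ∀ n c (p o : ℕ → ℕ) → p 0 ≡ c → o 0 ≡ c → (∀ i → 2 * p (suc i) ≡ o (suc i)) →
                  2 * ∑ℕ (suc n) p ≡ c + ∑ℕ (suc n) o
  double-counts n c p o p0 o0 h = begin
    2 * ∑ℕ (suc n) p ≡⟨ cong (2 *_) (∑ℕ-suc n p) ⟩
    2 * (p 0 + ∑ℕ n (p ∘ suc)) ≡⟨ eq (p 0) _ ⟩
    p 0 + (p 0 + 2 * ∑ℕ n (p ∘ suc)) ≡⟨ cong₂ (λ a b → a + (b + 2 * ∑ℕ n (p ∘ suc))) p0 (trans p0 (sym o0)) ⟩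
    c + (o 0 + 2 * ∑ℕ n (p ∘ suc)) ≡⟨ cong (λ s → c + (o 0 + s)) (trans (sym (∑-*ˡ {n} 2 _)) (∑-cong {n} λ x → h (toℕ x))) ⟩
    c + (o 0 + ∑ℕ n (o ∘ suc)) ≡⟨ cong (c ℕ.+_) (∑ℕ-suc n o) ⟨
    c + ∑ℕ (suc n) o ∎
    where
    open ≡-Reasoning
    eq : ∀ a s → 2 * (a + s) ≡ a + (a + 2 * s)
    eq = solve-∀

-- Numerator and denominator are doubled. Paths of positive length then count once per orientation,
-- while the `c` paths of length 0 have one orientation only and leave `c` over; in the sum of
-- lengths they weigh nothing.
averageLength-oriented : ∀ n c (p o : ℕ → ℕ) → p 0 ≡ c → o 0 ≡ c → (∀ i → 2 * p (suc i) ≡ o (suc i)) →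
                         averageLength (suc n) p ≡ quotient (∑ℕ (suc n) (λ i → i * o i)) (c + ∑ℕ (suc n) o)
averageLength-oriented n c p o p0 o0 h = begin
  quotient (∑< (suc n) (λ i → i * p i)) (∑< (suc n) p) ≡⟨ cong₂ quotient (∑<-sum (suc n) (λ i → i * p i)) (∑<-sum (suc n) p) ⟩
  quotient (∑ℕ (suc n) (λ i → i * p i)) (∑ℕ (suc n) p) ≡⟨ quotient-cancel 1 _ (∑ℕ (suc n) p) ⟨
  quotient (2 * ∑ℕ (suc n) (λ i → i * p i)) (2 * ∑ℕ (suc n) p) ≡⟨ cong₂ quotient (double-lengths (suc n) p o h) (double-counts n c p o p0 o0 h) ⟩
  quotient (∑ℕ (suc n) (λ i → i * o i)) (c + ∑ℕ (suc n) o) ∎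
  where open ≡-Reasoning

avp-quotient : (G : Graph n) → 0 < n → avp G ≡ quotient (lengthSum G) (n + pathCount G)
avp-quotient {suc n} G _ = averageLength-oriented n (suc n) (λ i → length (paths G i)) (oriented G) (paths-zero G) (oriented-zero G) (paths-suc G)

orientedAt-zero : (G : Graph n) (v : Fin n) → orientedAt G v 0 ≡ 1
orientedAt-zero G v = trans
  (∑-cong λ x → when-⇔ (v ∈? (x ∷ [])) (x ≟ v) (λ { (here e) → sym e }) (λ e → here (sym e)))
  (∑-δ v (λ _ → 1))

avpAt-quotient : (G : Graph n) (v : Fin n) →
                 avpAt G v ≡ quotient (∑ℕ n (λ i → i * orientedAt G v i)) (1 + ∑ℕ n (orientedAt G v))
avpAt-quotient {suc n} G v = averageLength-oriented n 1 (λ i → length (pathsThrough G v i)) (orientedAt G v) (pathsThrough-zero G v) (orientedAt-zero G v) (pathsThrough-suc G v)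

-- Cutting, reversing and prolonging paths

Ext-suffix : Ext G y [] i x vis → ∀ {a} → a ∈ (x ∷ vis) →
             ∃[ j ] ∃[ vis′ ] (Ext G y [] j a vis′ × j ≤ i × (∀ {b} → b ∈ (a ∷ vis′) → b ∈ (x ∷ vis)))
Ext-suffix p (here refl) = _ , _ , p , ℕ.≤-refl , id
Ext-suffix (grow e f p) (there h) with Ext-suffix p h
... | j , vis′ , q , j≤i , sub = j , vis′ , q , ℕ.m≤n⇒m≤1+n j≤i , there ∘ sub

Ext-snoc : Ext G y [] i x vis → Adj G y z → z ∉ (x ∷ vis) → Ext G z [] (suc i) x (vis ++ (z ∷ []))
Ext-snoc base e f = grow e (λ { (here r) → f (here (sym r)) }) base
Ext-snoc {z = z} (grow {x = x} {z = u} {vis = vis} e′ f′ p) e f =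
  grow e′ f″ (Ext-snoc p e (f ∘ there))
  where
  f″ : u ∉ (x ∷ vis ++ (z ∷ []))
  f″ h with ∈-++⁻ (x ∷ vis) h
  ... | inj₁ h′ = f′ h′
  ... | inj₂ (here refl) = f (here refl)

Ext-reverse : Ext G y [] i x vis →
              ∃[ vis′ ] (Ext G x [] i y vis′ × (∀ {a} → a ∈ (y ∷ vis′) → a ∈ (x ∷ vis)))
Ext-reverse base = [] , base , id
Ext-reverse {G = G} {y = y} (grow {x = x} {z = z} {vis = vis} e f p) with Ext-reverse p
... | vis′ , q , sub = vis′ ++ (z ∷ []) , Ext-snoc q (symm G e) (f ∘ sub) , sub′
  where
  sub′ : ∀ {a} → a ∈ (y ∷ vis′ ++ (z ∷ [])) → a ∈ (z ∷ x ∷ vis)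
  sub′ h with ∈-++⁻ (y ∷ vis′) h
  ... | inj₁ h′ = there (sub h′)
  ... | inj₂ (here refl) = here refl

Ext-end : Ext G y [] i x vis → y ∈ (x ∷ vis)
Ext-end base = here refl
Ext-end (grow _ _ p) = there (Ext-end p)

-- If `z` already lies on the path, the path is cut back to `z`. This is how walks are turned into
-- paths.
Ext-cons : Adj G z x → Ext G y [] i x vis →
           ∃[ j ] ∃[ vis′ ] (Ext G y [] j z vis′ × (∀ {b} → b ∈ (z ∷ vis′) → b ∈ (z ∷ x ∷ vis)))
Ext-cons {z = z} {x = x} {vis = vis} e p with z ∈? (x ∷ vis)
... | no f = _ , _ , grow e f p , id
... | yes h with Ext-suffix p h
... | j , vis′ , q , _ , sub = j , vis′ , q , there ∘ sub

Star⇒Ext : Star (Adj G) x y → ∃[ i ] ∃[ vis ] Ext G y [] i x vis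
Star⇒Ext ε = _ , _ , base
Star⇒Ext (e ◅ s) with Star⇒Ext s
... | _ , _ , p with Ext-cons e p
... | _ , _ , q , _ = _ , _ , q

Ext⇒Star : Ext G y [] i x vis → Star (Adj G) x y
Ext⇒Star base = ε
Ext⇒Star (grow e _ p) = e ◅ Ext⇒Star p

vertexPath⇒Ext : ∀ (G : Graph n) (p : Vec (Fin n) (suc k)) → IsVertexPath G p →
                 Ext G (last p) [] k (head p) (toList (tail p))
vertexPath⇒Ext G (x ∷ []) _ = base
vertexPath⇒Ext G (x ∷ y ∷ p) (a ∷ u , e ∷ l) = grow e (All≢⇒∉ a) (vertexPath⇒Ext G (y ∷ p) (u , l))

-- Trees through their distance functions

-- d x y is the distance of x from y, each target y making the tree rooted at y.
record TreeMetric (G : Graph n) (d : Fin n → Fin n → ℕ) : Set where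
  field
    d-refl : ∀ x → d x x ≡ 0
    d-zero : ∀ x y → d x y ≡ 0 → x ≡ y
    parent : ∀ x y k → d x y ≡ suc k → ∃[ z ] (Adj G x z × d z y ≡ k)
    edge : ∀ x z y → Adj G x z → d x y ≡ suc (d z y) ⊎ d z y ≡ suc (d x y)
    parents-≡ : ∀ x z z′ y → Adj G x z → Adj G x z′ → d x y ≡ suc (d z y) → d x y ≡ suc (d z′ y) → z ≡ z′

module _ {G : Graph n} {d : Fin n → Fin n → ℕ} (M : TreeMetric G d) where
  open TreeMetric M

  private
    -- A path ending at y never turns back towards y, so each of its steps moves away from y.
    descending : Ext G y [] i x vis →
                 d x y ≡ i × (∀ {u vis′} → vis ≡ u ∷ vis′ → Adj G x u × d x y ≡ suc (d u y))
    descending base = d-refl _ , λ ()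
    descending {y = y} (grow {x = x} {z = z} {vis = vis} e f p) with descending p | edge z x y e
    ... | h , t | inj₁ h′ = trans h′ (cong suc h) , λ { refl → e , h′ }
    descending {y = y} (grow {x = x} {z = z} {vis = []} e f base) | h , t | inj₂ h′ =
      contradiction (trans (sym h′) (d-refl y)) λ ()
    descending {y = y} (grow {x = x} {z = z} {vis = u ∷ vis} e f p) | h , t | inj₂ h′ =
      ⊥-elim (f (there (here (parents-≡ x z u y (symm G e) (proj₁ (t refl)) h′ (proj₂ (t refl))))))

  geodesic : Ext G y [] i x vis → d x y ≡ i
  geodesic p = proj₁ (descending p)

  on-path-≤ : Ext G y [] i x vis → z ∈ (x ∷ vis) → d z y ≤ i
  on-path-≤ p h with Ext-suffix p h
  ... | j , _ , q , j≤i , _ = subst (_≤ _) (sym (geodesic q)) j≤i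

  connecting : ∀ k x y → d x y ≡ k → ∃[ vis ] Ext G y [] k x vis
  connecting zero x y e = [] , subst (λ z → Ext G y [] 0 z []) (sym (d-zero x y e)) base
  connecting (suc k) x y e with parent x y k e
  ... | z , xz , e′ with connecting k z y e′
  ... | vis , p = z ∷ vis , grow xz (λ h → ℕ.<⇒≱ (ℕ.n<1+n k) (subst (_≤ k) e (on-path-≤ p h))) p

  -- Symmetry is not among the axioms: the connecting path, reversed, is measured again from its
  -- other end.
  d-sym : ∀ x y → d x y ≡ d y x
  d-sym x y with connecting (d x y) x y refl
  ... | vis , p with Ext-reverse p
  ... | vis′ , q , _ = sym (geodesic q)

  d-< : ∀ x y → d x y < n
  d-< x y with connecting (d x y) x y refl
  ... | vis , p = subst (λ l → suc l ≤ n) (trans (Ext-length p) (ℕ.+-identityʳ _)) (distinct-≤ (Ext-distinct (single y) p))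

  metric⇒IsTree : 0 < n → IsTree G
  metric⇒IsTree 0<n = (0<n , λ x y → Ext⇒Star (proj₂ (connecting (d x y) x y refl))) , acyclic
    where
    acyclic : Acyclic G
    -- The closing edge would put the ends at distance 1, although the path between them has length
    -- at least 2.
    acyclic {k} c v e with edge (head c) (last c) (last c) (symm G e)
    ... | inj₁ h = contradiction (trans (sym (geodesic (vertexPath⇒Ext G c v))) (trans h (cong suc (d-refl (last c))))) λ ()
    ... | inj₂ h = contradiction (trans (sym (d-refl (last c))) h) λ ()

  -- A neighbour of the head is fresh exactly when it lies one step further from `y`, so the history
  -- can be forgotten; and a vertex at distance `suc i` is reached through its only parent, hence
  -- once.
  E-head : ∀ i (φ : Fin n → ℕ) y → E G i (λ x _ → φ x) y [] ≡ ∑ λ x → φ x when (d x y ℕ.≟ i)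
  E-head zero φ y = sym (trans
    (∑-cong λ x → when-⇔ (d x y ℕ.≟ 0) (x ≟ y) (d-zero x y) (λ { refl → d-refl x }))
    (∑-δ y φ))
  E-head (suc i) φ y = begin
    E G i (step G (λ x _ → φ x)) y [] ≡⟨ E-cong G i forget ⟩
    E G i (λ x _ → ∑ λ z → φ z when (d z y ℕ.≟ suc i) when adj? G z x) y [] ≡⟨ E-head i (λ x → ∑ λ z → φ z when (d z y ℕ.≟ suc i) when adj? G z x) y ⟩
    ∑ (λ x → (∑ λ z → φ z when (d z y ℕ.≟ suc i) when adj? G z x) when (d x y ℕ.≟ i))
                                                                             ≡⟨ ∑-cong (λ x → sym (∑-when _ (d x y ℕ.≟ i))) ⟩
    ∑ (λ x → ∑ λ z → φ z when (d z y ℕ.≟ suc i) when adj? G z x when (d x y ℕ.≟ i))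
                                                                             ≡⟨ ∑-comm (λ x z → φ z when (d z y ℕ.≟ suc i) when adj? G z x when (d x y ℕ.≟ i)) ⟩
    ∑ (λ z → ∑ λ x → φ z when (d z y ℕ.≟ suc i) when adj? G z x when (d x y ℕ.≟ i))
                                                                             ≡⟨ ∑-cong (λ z → one-parent z (d z y ℕ.≟ suc i)) ⟩
    ∑ (λ z → φ z when (d z y ℕ.≟ suc i)) ∎
    where
    open ≡-Reasoning
    forget : ∀ {x vis} → Ext G y [] i x vis →
             step G (λ x _ → φ x) x vis ≡ ∑ λ z → φ z when (d z y ℕ.≟ suc i) when adj? G z x
    forget {x} {vis} p = ∑-cong λ z → when-cong (adj? G z x) λ e →
      when-⇔ (fresh? z (x ∷ vis)) (d z y ℕ.≟ suc i) (λ f → geodesic (grow e f p))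
             (λ h m → ℕ.<⇒≱ (ℕ.n<1+n i) (subst (_≤ i) h (on-path-≤ p m)))
    one-parent : ∀ z (D : Dec (d z y ≡ suc i)) →
                 ∑ (λ x → φ z when D when adj? G z x when (d x y ℕ.≟ i)) ≡ φ z when D
    one-parent z (no ¬h) = trans (∑-zero λ x → vanish x (adj? G z x) (d x y ℕ.≟ i)) (sym (when-no (no ¬h) ¬h))
      where
      vanish : ∀ x (a : Dec (Adj G z x)) (b : Dec (d x y ≡ i)) → φ z when no ¬h when a when b ≡ 0
      vanish x a b = trans (cong (_when b) (trans (cong (_when a) (when-no (no ¬h) ¬h)) (when-0 a))) (when-0 b)
    one-parent z D@(yes h) with parent z y i h
    ... | u , zu , hu = trans
      (∑-unique u _ λ x x≢u → others x x≢u (adj? G z x) (d x y ℕ.≟ i))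
      (trans (when-yes (d u y ℕ.≟ i) hu) (when-yes (adj? G z u) zu))
      where
      others : ∀ x → x ≢ u → (a : Dec (Adj G z x)) (b : Dec (d x y ≡ i)) → φ z when D when a when b ≡ 0
      others x x≢u a (no ¬b) = when-no (no ¬b) ¬b
      others x x≢u (no ¬a) b@(yes hx) = trans (cong (_when b) (when-no (no ¬a) ¬a)) (when-0 b)
      others x x≢u (yes zx) (yes hx) = contradiction
        (parents-≡ z x u y zx zu (trans h (cong suc (sym hx))) (trans h (cong suc (sym hu)))) x≢u

  oriented-metric : ∀ i → oriented G i ≡ ∑ λ y → ∑ λ x → 1 when (d x y ℕ.≟ i)
  oriented-metric i = ∑-cong λ y → E-head i (λ _ → 1) y

  ∑-oriented-metric : ∀ (c : ℕ → ℕ) → ∑ℕ n (λ i → c i * oriented G i) ≡ ∑ λ y → ∑ λ x → c (d x y)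
  ∑-oriented-metric c = begin
    ∑ℕ n (λ i → c i * oriented G i) ≡⟨ ∑-cong (λ i → spread (toℕ i)) ⟩
    ∑ {n} (λ i → ∑ λ y → ∑ λ x → c (toℕ i) when (d x y ℕ.≟ toℕ i)) ≡⟨ ∑-comm {n} (λ i y → ∑ λ x → c (toℕ i) when (d x y ℕ.≟ toℕ i)) ⟩
    ∑ (λ y → ∑ {n} λ i → ∑ λ x → c (toℕ i) when (d x y ℕ.≟ toℕ i)) ≡⟨ ∑-cong (λ y → ∑-comm {n} (λ i x → c (toℕ i) when (d x y ℕ.≟ toℕ i))) ⟩
    ∑ (λ y → ∑ λ x → ∑ {n} λ i → c (toℕ i) when (d x y ℕ.≟ toℕ i)) ≡⟨ ∑-cong (λ y → ∑-cong λ x → ∑-δℕ n c (d x y) (d-< x y)) ⟩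
    ∑ (λ y → ∑ λ x → c (d x y)) ∎
    where
    open ≡-Reasoning
    spread : ∀ i → c i * oriented G i ≡ ∑ λ y → ∑ λ x → c i when (d x y ℕ.≟ i)
    spread i = trans (cong (c i *_) (oriented-metric i)) (trans (sym (∑-*ˡ (c i) _))
      (∑-cong λ y → trans (sym (∑-*ˡ (c i) _)) (∑-cong λ x →
        trans (when-* (c i) 1 (d x y ℕ.≟ i)) (cong (_when (d x y ℕ.≟ i)) (ℕ.*-identityʳ (c i))))))

  pathCount-metric : pathCount G ≡ n * n
  pathCount-metric = trans (∑-cong λ i → sym (ℕ.*-identityˡ (oriented G (toℕ i))))
    (trans (∑-oriented-metric (λ _ → 1)) (trans (∑-cong λ y → trans (∑-const n 1) (ℕ.*-identityʳ n)) (∑-const n n)))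

  lengthSum-metric : lengthSum G ≡ ∑ λ y → ∑ λ x → d x y
  lengthSum-metric = ∑-oriented-metric id

-- The distance function of a tree

Ext⇒vertexPath : Ext G y [] i x vis → ∃[ p ] (IsVertexPath G (x ∷ p) × last (x ∷ p) ≡ y × toList {n = i} p ≡ vis)
Ext⇒vertexPath base = [] , ([] ∷ [] , [-]) , refl , refl
Ext⇒vertexPath {x = z} (grow {x = x} e f p) with Ext⇒vertexPath p
... | q , (u , l) , h , refl = x ∷ q , (∉⇒All≢ (x ∷ q) f ∷ u , e ∷ l) , h , refl

-- The first path is put in front of the reverse of the second, vertex by vertex, each repetition
-- being cut out by `Ext-cons`.
Ext-join : Ext G y [] i x vis → Ext G y [] j z vis′ →
           ∃[ k ] ∃[ vis″ ] (Ext G z [] k x vis″ × (∀ {b} → b ∈ (x ∷ vis″) → b ∈ (x ∷ vis) ⊎ b ∈ (z ∷ vis′)))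
Ext-join base q with Ext-reverse q
... | _ , r , sub = _ , _ , r , inj₂ ∘ sub
Ext-join (grow {x = x} {z = u} {vis = vis} e f p) q with Ext-join p q
... | _ , _ , r , sub with Ext-cons e r
... | _ , _ , s , sub′ = _ , _ , s , λ h → case sub′ h of λ
  { (here refl) → inj₁ (here refl)
  ; (there h′) → case sub h′ of λ { (inj₁ h″) → inj₁ (there h″) ; (inj₂ h″) → inj₂ h″ } }

module _ (T : Graph n) (tree : IsTree T) where
  private
    acyclic : Acyclic T
    acyclic = proj₂ tree

    no-cycle : Adj T x z → Adj T x y → z ≢ y → Ext T y [] i z vis → x ∉ (z ∷ vis) → ⊥
    no-cycle xz xy z≢y base _ = z≢y refl
    no-cycle {x = x} {y = y} {i = suc i} xz xy z≢y p@(grow _ _ _) f with Ext⇒vertexPath (grow xz f p)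
    ... | c , v , h , _ = acyclic (x ∷ c) v (subst (λ a → Adj T a x) (sym h) (symm T xy))

  -- Where two paths from `x` to `y` part, their remainders join to a path between two neighbours of
  -- `x` that avoids `x`, and `x` closes it to a cycle.
  path-unique : Ext T y [] i x vis → Ext T y [] j x vis′ → i ≡ j × vis ≡ vis′
  path-unique base base = refl , refl
  path-unique base (grow _ f q) = ⊥-elim (f (Ext-end q))
  path-unique (grow _ f p) base = ⊥-elim (f (Ext-end p))
  path-unique (grow {x = z} e f p) (grow {x = z′} e′ f′ q) with z ≟ z′
  ... | yes refl with path-unique p q
  ... | refl , refl = refl , refl
  path-unique (grow {x = z} e f p) (grow {x = z′} e′ f′ q) | no z≢z′ with Ext-join p q
  ... | _ , _ , r , sub = ⊥-elim (no-cycle e e′ z≢z′ r λ h → case sub h of λ { (inj₁ h′) → f h′ ; (inj₂ h′) → f′ h′ })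

  private
    the-path : ∀ x y → ∃[ i ] ∃[ vis ] Ext T y [] i x vis
    the-path x y = Star⇒Ext (proj₂ (proj₁ tree) x y)

  dist : Fin n → Fin n → ℕ
  dist x y = proj₁ (the-path x y)

  dist-≡ : Ext T y [] i x vis → dist x y ≡ i
  dist-≡ {y = y} {x = x} p = proj₁ (path-unique (proj₂ (proj₂ (the-path x y))) p)

  private
    dist-edge : ∀ x z y → Adj T x z →
                (∃[ vis ] Ext T y [] (suc (dist z y)) x (z ∷ vis)) × dist x y ≡ suc (dist z y)
                ⊎ dist z y ≡ suc (dist x y)
    dist-edge x z y e with the-path z y in eq
    ... | i , vis , p with x ∈? (z ∷ vis)
    ... | no f = inj₁ ((vis , grow e f p) , dist-≡ (grow e f p))
    ... | yes (here refl) = ⊥-elim (irrefl T refl e)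
    dist-edge x z y e | i , vis , base | yes (there ())
    dist-edge x z y e | i , vis , p@(grow _ f′ p′) | yes (there h) with Ext-suffix p′ h
    -- The path from `z` meets `x`: its part from `x` on, with `z` put directly in front, must by
    -- uniqueness be the whole path.
    ... | j , vis″ , q , _ , sub = inj₂ (trans (proj₁ (path-unique p (grow (symm T e) (f′ ∘ sub) q))) (cong suc (sym (dist-≡ q))))

  dist-metric : TreeMetric T dist
  dist-metric = record
    { d-refl = λ x → dist-≡ base
    ; d-zero = zero⇒
    ; parent = par
    ; edge = λ x z y e → case dist-edge x z y e of λ { (inj₁ (_ , h)) → inj₁ h ; (inj₂ h) → inj₂ h }
    ; parents-≡ = par-≡
    }
    where
    zero⇒ : ∀ x y → dist x y ≡ 0 → x ≡ y
    zero⇒ x y h with the-path x y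
    zero⇒ x y refl | _ , _ , base = refl
    par : ∀ x y k → dist x y ≡ suc k → ∃[ z ] (Adj T x z × dist z y ≡ k)
    par x y k h with the-path x y
    par x y k refl | _ , _ , grow e f p = _ , e , dist-≡ p
    par-≡ : ∀ x z z′ y → Adj T x z → Adj T x z′ → dist x y ≡ suc (dist z y) → dist x y ≡ suc (dist z′ y) → z ≡ z′
    par-≡ x z z′ y e e′ h h′ with dist-edge x z y e | dist-edge x z′ y e′
    ... | inj₂ g | _ = ⊥-elim (ℕ.<-irrefl (trans h (cong suc g)) (ℕ.≤-trans (ℕ.n<1+n _) (ℕ.n≤1+n _)))
    ... | inj₁ _ | inj₂ g = ⊥-elim (ℕ.<-irrefl (trans h′ (cong suc g)) (ℕ.≤-trans (ℕ.n<1+n _) (ℕ.n≤1+n _)))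
    ... | inj₁ ((_ , p) , _) | inj₁ ((_ , q) , _) with path-unique p q
    ... | _ , refl = refl

-- Growing a connected graph vertex by vertex

data Grown {n : ℕ} (G : Graph n) : List (Fin n) → Set where
  seed : ∀ x → Grown G (x ∷ [])
  add : ∀ {x y L} → Grown G L → x ∉ L → y ∈ L → Adj G x y → Grown G (x ∷ L)

Grown-distinct : Grown G L → Distinct L
Grown-distinct (seed x) = single x
Grown-distinct (add g f _ _) = f ∷ Grown-distinct g

private
  crossing : ∀ (G : Graph n) {L x y} → Star (Adj G) x y → x ∈ L → y ∉ L → ∃[ u ] ∃[ v ] (u ∈ L × v ∉ L × Adj G u v)
  crossing G ε h f = contradiction h f
  crossing G {L} (_◅_ {j = v} e s) h f with v ∈? L
  ... | yes h′ = crossing G s h′ f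
  ... | no f′ = _ , v , h , f′ , e

  Grown-member : Grown G L → ∃[ x ] x ∈ L
  Grown-member (seed x) = x , here refl
  Grown-member (add {x} _ _ _ _) = x , here refl

  -- `k` bounds the number of missing vertices and makes the recursion structural; at 0 a further
  -- vertex would exceed the order.
  spanning-from : (G : Graph n) → Connected G → ∀ k → ∃[ L ] (Grown G L × n ≤ k + length L) →
                  ∃[ L ] (Grown G L × (∀ x → x ∈ L))
  spanning-from {n} G c k (L , g , h) with any? (λ x → fresh? x L)
  ... | no ¬∃ = L , g , λ x → case x ∈? L of λ { (yes p) → p ; (no f) → ⊥-elim (¬∃ (x , f)) }
  ... | yes (x , f) with Grown-member g
  ... | y , y∈L with crossing G (proj₂ c y x) y∈L f
  ... | u , v , u∈L , v∉L , e with k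
  ... | zero = ⊥-elim (ℕ.<⇒≱ (distinct-≤ (v∉L ∷ Grown-distinct g)) h)
  ... | suc k = spanning-from G c k (v ∷ L , add g v∉L u∈L (symm G e) , ℕ.≤-trans h (ℕ.≤-reflexive (sym (ℕ.+-suc k (length L)))))

Connected⇒Grown : (G : Graph n) → Connected G → ∃[ L ] (Grown G L × (∀ x → x ∈ L))
Connected⇒Grown {suc n} G c = spanning-from G c n (_ , seed zero , ℕ.≤-reflexive (ℕ.+-comm 1 n))

∑∈ : List (Fin n) → (Fin n → ℕ) → ℕ
∑∈ L f = ∑ λ x → f x when (x ∈? L)

∑∈-+ : ∀ (L : List (Fin n)) f g → ∑∈ L (λ x → f x + g x) ≡ ∑∈ L f + ∑∈ L g
∑∈-+ L f g = trans (∑-cong λ x → when-+ (f x) (g x) (x ∈? L)) (∑-+ _ _)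

∑∈-cong : ∀ (L : List (Fin n)) {f g} → (∀ x → x ∈ L → f x ≡ g x) → ∑∈ L f ≡ ∑∈ L g
∑∈-cong L h = ∑-cong λ x → when-cong (x ∈? L) (h x)

∑∈-mono : ∀ (L : List (Fin n)) {f g} → (∀ x → x ∈ L → f x ≤ g x) → ∑∈ L f ≤ ∑∈ L g
∑∈-mono L h = ∑-mono λ x → when-mono (x ∈? L) (h x)

∑∈-≥ : ∀ {L : List (Fin n)} f {x} → x ∈ L → f x ≤ ∑∈ L f
∑∈-≥ {L = L} f {x} h = ℕ.≤-trans (ℕ.≤-reflexive (sym (when-yes (x ∈? L) h))) (∑-≥ _ x)

∑∈-all : ∀ (L : List (Fin n)) f → (∀ x → x ∈ L) → ∑∈ L f ≡ ∑ f
∑∈-all L f h = ∑-cong λ x → when-yes (x ∈? L) (h x)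

∑∈-one : {L : List (Fin n)} → Distinct L → ∑∈ L (λ _ → 1) ≡ length L
∑∈-one = count-∈

∑∈² : List (Fin n) → (Fin n → Fin n → ℕ) → ℕ
∑∈² L f = ∑∈ L λ x → ∑∈ L (f x)

∑∈²-∷ : x ∉ L → (f : Fin n → Fin n → ℕ) →
        ∑∈² (x ∷ L) f ≡ (f x x + ∑∈ L (f x)) + (∑∈ L (λ y → f y x) + ∑∈² L f)
∑∈²-∷ {x = x} {L = L} x∉L f = trans (∑-∈-∷ x∉L _) (cong₂ _+_ (∑-∈-∷ x∉L (f x))
  (trans (∑∈-cong L (λ y _ → ∑-∈-∷ x∉L (f y))) (∑∈-+ L (λ y → f y x) (λ y → ∑∈ L (f y)))))

∑∈²-all : ∀ (L : List (Fin n)) f → (∀ x → x ∈ L) → ∑∈² L f ≡ ∑ λ x → ∑ (f x)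
∑∈²-all L f h = trans (∑∈-all L _ h) (∑-cong λ x → ∑∈-all L (f x) h)

-- Every vertex added brings an edge to the older ones, counted in both directions; the seed brings
-- none, which accounts for the 2.
edges-≥ : (G : Graph n) → Grown G L → 2 * length L ≤ 2 + ∑∈² L (λ x y → 1 when adj? G x y)
edges-≥ G (seed x) = s≤s (s≤s z≤n)
edges-≥ {L = x ∷ L} G (add {x} {y} g x∉L y∈L e) = begin
  2 * suc (length L) ≡⟨ ℕ.*-suc 2 (length L) ⟩
  2 + 2 * length L ≤⟨ ℕ.+-monoʳ-≤ 2 (edges-≥ G g) ⟩
  2 + (2 + ∑∈² L f) ≤⟨ ℕ.+-monoʳ-≤ 2 (ℕ.+-mono-≤ {1} {f x x + ∑∈ L (f x)}
                                           (ℕ.≤-trans (out f (when-yes (adj? G x y) e)) (ℕ.m≤n+m _ _))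
                                           (ℕ.+-monoˡ-≤ (∑∈² L f) (out (λ y x → f x y) (when-yes (adj? G y x) (symm G e))))) ⟩
  2 + ((f x x + ∑∈ L (f x)) + (∑∈ L (λ y → f y x) + ∑∈² L f)) ≡⟨ cong (2 ℕ.+_) (∑∈²-∷ x∉L f) ⟨
  2 + ∑∈² (x ∷ L) f ∎
  where
  open ℕ.≤-Reasoning
  f : Fin _ → Fin _ → ℕ
  f x y = 1 when adj? G x y
  out : ∀ (h : Fin _ → Fin _ → ℕ) → h x y ≡ 1 → 1 ≤ ∑∈ L (h x)
  out h hxy = ℕ.≤-trans (ℕ.≤-reflexive (sym hxy)) (∑∈-≥ (h x) y∈L)

triangular : ℕ → ℕ
triangular zero = 0
triangular (suc k) = suc k + triangular k

-- The index is shifted: `tetrahedral n` is the binomial coefficient n + 1 over 3, the sum of the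
-- distances over the unordered pairs of vertices of the path of order `n`.
tetrahedral : ℕ → ℕ
tetrahedral zero = 0
tetrahedral (suc k) = triangular k + tetrahedral k

module _ {G : Graph n} {d : Fin n → Fin n → ℕ} (M : TreeMetric G d) where
  open TreeMetric M

  private
    ≤-neighbour : ∀ {x y} z → Adj G x y → d z x ≤ suc (d z y)
    ≤-neighbour {x} {y} z e = subst₂ (λ a b → a ≤ suc b) (d-sym M x z) (d-sym M y z) (case edge x y z e of λ
      { (inj₁ h) → ℕ.≤-reflexive h ; (inj₂ h) → ℕ.≤-trans (ℕ.n≤1+n _) (ℕ.≤-trans (ℕ.≤-reflexive (sym h)) (ℕ.n≤1+n _)) })

    -- Let `u` be the newest vertex. If `y` is `u`, all distances grow by at most 1 on passing from
    -- `u` to `x`. If `y` is older, the sum gains just the distance of `u`; the pointwise bound is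
    -- carried along to control it.
    distances-≤ : Grown G L → ∀ {x y} → y ∈ L → Adj G x y →
                  ∑∈ L (λ z → d z x) ≤ triangular (length L) × (∀ {z} → z ∈ L → d z x ≤ length L)
    distances-≤ (seed u) {x} (here refl) e = ℕ.≤-trans (ℕ.≤-reflexive (trans (∑-cong λ z → when-⇔ (z ∈? (u ∷ [])) (z ≟ u) (λ { (here h) → h }) here) (∑-δ u _))) near , λ { (here refl) → near }
      where
      near : d u x ≤ 1
      near = subst (λ a → d u x ≤ suc a) (d-refl u) (≤-neighbour u e)
    distances-≤ (add {u} {v} {L} g u∉L v∈L uv) {x} {y} y∈uL xy =
      ℕ.≤-trans (ℕ.≤-reflexive (∑-∈-∷ u∉L _)) (proj₁ (both y∈uL)) , λ { (here refl) → proj₁ (proj₂ (both y∈uL)) ; (there h) → proj₂ (proj₂ (both y∈uL)) h }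
      where
      both : y ∈ (u ∷ L) → d u x + ∑∈ L (λ z → d z x) ≤ triangular (suc (length L)) × d u x ≤ suc (length L) × (∀ {z} → z ∈ L → d z x ≤ suc (length L))
      both (here refl) with distances-≤ g v∈L uv
      ... | sum≤ , all≤ = (begin
          d u x + ∑∈ L (λ z → d z x) ≤⟨ ℕ.+-mono-≤ du (∑∈-mono L λ z _ → ≤-neighbour z xy) ⟩
          1 + ∑∈ L (λ z → 1 + d z u) ≡⟨ cong suc (∑∈-+ L (λ _ → 1) (λ z → d z u)) ⟩
          1 + (∑∈ L (λ _ → 1) + ∑∈ L (λ z → d z u)) ≡⟨ cong (λ a → 1 + (a + ∑∈ L (λ z → d z u))) (∑∈-one (Grown-distinct g)) ⟩
          1 + (length L + ∑∈ L (λ z → d z u)) ≤⟨ s≤s (ℕ.+-monoʳ-≤ (length L) sum≤) ⟩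
          1 + (length L + triangular (length L)) ∎)
        , ℕ.≤-trans du (s≤s z≤n)
        , λ {z} h → ℕ.≤-trans (≤-neighbour z xy) (s≤s (all≤ h))
        where
        open ℕ.≤-Reasoning
        du : d u x ≤ 1
        du = subst (λ a → d u x ≤ suc a) (d-refl u) (≤-neighbour u xy)
      both (there y∈L) with distances-≤ g y∈L xy
      ... | sum≤ , all≤ = ℕ.+-mono-≤ du sum≤ , du , λ h → ℕ.m≤n⇒m≤1+n (all≤ h)
        where
        du : d u x ≤ suc (length L)
        du = subst₂ (λ a b → a ≤ suc b) (d-sym M x u) refl (ℕ.≤-trans (≤-neighbour x uv) (s≤s (ℕ.≤-trans (ℕ.≤-reflexive (d-sym M x v)) (all≤ v∈L))))

    grown-≤ : Grown G L → ∑∈² L d ≤ 2 * tetrahedral (length L)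
    grown-≤ (seed x) = ℕ.≤-reflexive (trans (∑∈²-∷ {L = []} (λ ()) d) (trans
      (cong₂ _+_ (cong₂ _+_ (d-refl x) (empty (d x))) (cong₂ _+_ (empty (λ y → d y x)) (empty _))) refl))
      where
      empty : ∀ f → ∑∈ [] f ≡ 0
      empty f = ∑-zero λ z → when-no (z ∈? []) λ ()
    grown-≤ (add {x} {y} {L} g x∉L y∈L e) = begin
      ∑∈² (x ∷ L) d ≡⟨ ∑∈²-∷ x∉L d ⟩
      (d x x + ∑∈ L (d x)) + (∑∈ L (λ y → d y x) + ∑∈² L d) ≡⟨ cong₂ (λ a b → (a + b) + (∑∈ L (λ y → d y x) + ∑∈² L d)) (d-refl x) (∑∈-cong L λ y _ → d-sym M x y) ⟩
      ∑∈ L (λ y → d y x) + (∑∈ L (λ y → d y x) + ∑∈² L d) ≤⟨ ℕ.+-mono-≤ near (ℕ.+-mono-≤ near (grown-≤ g)) ⟩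
      t + (t + 2 * tetrahedral (length L)) ≡⟨ eq t (tetrahedral (length L)) ⟩
      2 * (t + tetrahedral (length L)) ∎
      where
      open ℕ.≤-Reasoning
      t = triangular (length L)
      near = proj₁ (distances-≤ g y∈L e)
      eq : ∀ t s → t + (t + 2 * s) ≡ 2 * (t + s)
      eq = solve-∀

  lengthSum-tetrahedral : 0 < n → lengthSum G ≤ 2 * tetrahedral n
  lengthSum-tetrahedral 0<n with Connected⇒Grown G (proj₁ (metric⇒IsTree M 0<n))
  ... | L , g , all = begin
    lengthSum G ≡⟨ lengthSum-metric M ⟩
    ∑ (λ y → ∑ λ x → d x y) ≡⟨ ∑-comm (λ y x → d x y) ⟩
    ∑ (λ x → ∑ λ y → d x y) ≡⟨ ∑∈²-all L d all ⟨
    ∑∈² L d ≤⟨ grown-≤ g ⟩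
    2 * tetrahedral (length L) ≡⟨ cong (λ l → 2 * tetrahedral l) full ⟩
    2 * tetrahedral n ∎
    where
    open ℕ.≤-Reasoning
    full : length L ≡ n
    full = trans (sym (∑∈-one (Grown-distinct g))) (trans (∑∈-all L _ all) (trans (∑-const n 1) (ℕ.*-identityʳ n)))

-- The complete graph maximises the average path length

private
  fresh-count : ∀ (G : Graph n) y i {x vis} → Ext G y [] i x vis → ∑ (λ z → 1 when fresh? z (x ∷ vis)) ≡ n ∸ suc i
  fresh-count {n} G y i {x} {vis} p = sym (begin
    n ∸ suc i ≡⟨ cong (_∸ suc i) (count-fresh (Ext-distinct (single y) p)) ⟨
    (∑ (λ z → 1 when fresh? z (x ∷ vis)) + suc (length vis)) ∸ suc i ≡⟨ cong (λ l → (∑ (λ z → 1 when fresh? z (x ∷ vis)) + suc l) ∸ suc i) (trans (Ext-length p) (ℕ.+-identityʳ i)) ⟩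
    (∑ (λ z → 1 when fresh? z (x ∷ vis)) + suc i) ∸ suc i ≡⟨ ℕ.m+n∸n≡m _ (suc i) ⟩
    ∑ (λ z → 1 when fresh? z (x ∷ vis)) ∎)
    where open ≡-Reasoning

E-scale : ∀ (G : Graph n) i c y → E G i (λ _ _ → c) y [] ≡ c * E G i one y []
E-scale G i c y = trans (E-cong G i λ _ → sym (ℕ.*-identityʳ c)) (E-* G i c one y [])

oriented-suc-≤ : ∀ (G : Graph n) i → oriented G (suc i) ≤ (n ∸ suc i) * oriented G i
oriented-suc-≤ {n} G i = begin
  ∑ (λ y → E G i (step G one) y []) ≤⟨ ∑-mono (λ y → E-mono G i λ {x} {vis} p →
                                                     ℕ.≤-trans (∑-mono λ z → when-≤ _ (adj? G z x)) (ℕ.≤-reflexive (fresh-count G y i p))) ⟩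
  ∑ (λ y → E G i (λ _ _ → n ∸ suc i) y []) ≡⟨ ∑-cong (λ y → E-scale G i (n ∸ suc i) y) ⟩
  ∑ (λ y → (n ∸ suc i) * E G i one y []) ≡⟨ ∑-*ˡ (n ∸ suc i) _ ⟩
  (n ∸ suc i) * oriented G i ∎
  where open ℕ.≤-Reasoning

oriented-complete : ∀ n i → oriented (complete n) (suc i) ≡ (n ∸ suc i) * oriented (complete n) i
oriented-complete n i = begin
  ∑ (λ y → E K i (step K one) y []) ≡⟨ ∑-cong (λ y → E-cong K i λ {x} {vis} p →
                                                     trans (∑-cong λ z → all-adjacent z x vis) (fresh-count K y i p)) ⟩
  ∑ (λ y → E K i (λ _ _ → n ∸ suc i) y []) ≡⟨ ∑-cong (λ y → E-scale K i (n ∸ suc i) y) ⟩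
  ∑ (λ y → (n ∸ suc i) * E K i one y []) ≡⟨ ∑-*ˡ (n ∸ suc i) _ ⟩
  (n ∸ suc i) * oriented K i ∎
  where
  open ≡-Reasoning
  K = complete n
  all-adjacent : ∀ z x vis → 1 when fresh? z (x ∷ vis) when adj? K z x ≡ 1 when fresh? z (x ∷ vis)
  all-adjacent z x vis = go (fresh? z (x ∷ vis))
    where
    go : (d : Dec (z ∉ (x ∷ vis))) → 1 when d when adj? K z x ≡ 1 when d
    go (yes f) = when-yes (adj? K z x) (λ e → f (here e))
    go (no ¬f) = trans (cong (_when adj? K z x) (when-no (no ¬f) ¬f)) (trans (when-0 (adj? K z x)) (sym (when-no (no ¬f) ¬f)))

-- A Chebyshev-type inequality for decreasing a / b, obtained by symmetrising the double sum over i and j.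
mean-≤ : ∀ n (a b : ℕ → ℕ) → (∀ i j → j ≤ i → a i * b j ≤ b i * a j) →
         ∑ℕ n (λ i → i * a i) * ∑ℕ n b ≤ ∑ℕ n (λ i → i * b i) * ∑ℕ n a
mean-≤ n a b cross = ℕ.*-cancelˡ-≤ 2 (begin
  2 * (∑ℕ n (λ i → i * a i) * ∑ℕ n b) ≡⟨ expand a b ⟩
  ∑ (λ (x : Fin n) → ∑ λ (y : Fin n) → F a b (toℕ x) (toℕ y)) ≤⟨ ∑-mono (λ x → ∑-mono λ y → pairwise (toℕ x) (toℕ y)) ⟩
  ∑ (λ (x : Fin n) → ∑ λ (y : Fin n) → F b a (toℕ x) (toℕ y)) ≡⟨ expand b a ⟨
  2 * (∑ℕ n (λ i → i * b i) * ∑ℕ n a) ∎)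
  where
  open ℕ.≤-Reasoning
  F : (a b : ℕ → ℕ) → ℕ → ℕ → ℕ
  F a b i j = i * a i * b j + j * a j * b i
  expand : ∀ a b → 2 * (∑ℕ n (λ i → i * a i) * ∑ℕ n b) ≡ ∑ (λ (x : Fin n) → ∑ λ (y : Fin n) → F a b (toℕ x) (toℕ y))
  expand a b = begin-equality
    2 * S ≡⟨ cong (S ℕ.+_) (ℕ.+-identityʳ S) ⟩
    S + S ≡⟨ cong₂ _+_ rows (trans rows (∑-comm {n} {n} λ x y → f (toℕ x) (toℕ y))) ⟩
    ∑ (λ (x : Fin n) → ∑ λ (y : Fin n) → f (toℕ x) (toℕ y)) + ∑ (λ (y : Fin n) → ∑ λ (x : Fin n) → f (toℕ x) (toℕ y)) ≡⟨ ∑-+ {n} _ _ ⟨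
    ∑ (λ (x : Fin n) → ∑ (λ (y : Fin n) → f (toℕ x) (toℕ y)) + ∑ (λ (y : Fin n) → f (toℕ y) (toℕ x))) ≡⟨ ∑-cong {n} (λ x → sym (∑-+ {n} _ _)) ⟩
    ∑ (λ (x : Fin n) → ∑ λ (y : Fin n) → F a b (toℕ x) (toℕ y)) ∎
    where
    f : ℕ → ℕ → ℕ
    f i j = i * a i * b j
    S = ∑ℕ n (λ i → i * a i) * ∑ℕ n b
    rows : S ≡ ∑ (λ (x : Fin n) → ∑ λ (y : Fin n) → f (toℕ x) (toℕ y))
    rows = trans (sym (∑-*ʳ {n} (∑ℕ n b) _)) (∑-cong {n} λ x → sym (∑-*ˡ {n} (toℕ x * a (toℕ x)) _))
  ordered : ∀ i j → j ≤ i → F a b i j ≤ F b a i j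
  ordered i j j≤i = subst (λ i → F a b i j ≤ F b a i j) (ℕ.m+[n∸m]≡n j≤i) (begin
    F a b (j + e) j ≡⟨ eq j e (a (j + e)) (b j) (a j) (b (j + e)) ⟩
    j * (a (j + e) * b j) + j * (b (j + e) * a j) + e * (a (j + e) * b j) ≤⟨ ℕ.+-monoʳ-≤ _ (ℕ.*-monoʳ-≤ e (cross (j + e) j (ℕ.m≤m+n j e))) ⟩
    j * (a (j + e) * b j) + j * (b (j + e) * a j) + e * (b (j + e) * a j) ≡⟨ eq′ j e (a (j + e)) (b j) (a j) (b (j + e)) ⟩
    F b a (j + e) j ∎)
    where
    e = i ∸ j
    eq : ∀ j e p q r s → (j + e) * p * q + j * r * s ≡ j * (p * q) + j * (s * r) + e * (p * q)
    eq = solve-∀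
    eq′ : ∀ j e p q r s → j * (p * q) + j * (s * r) + e * (s * r) ≡ (j + e) * s * r + j * q * p
    eq′ = solve-∀
  pairwise : ∀ i j → F a b i j ≤ F b a i j
  pairwise i j with ℕ.≤-total j i
  ... | inj₁ j≤i = ordered i j j≤i
  ... | inj₂ i≤j = subst₂ _≤_ (ℕ.+-comm (j * a j * b i) _) (ℕ.+-comm (j * b j * a i) _) (ordered j i i≤j)

avp≤complete : (G : Graph n) → 0 < n → avp G ℚ.≤ avp (complete n)
avp≤complete {n} G 0<n = subst₂ ℚ._≤_ (sym (avp-quotient G 0<n)) (sym (avp-quotient K 0<n))
  (quotient-≤ {n + pathCount G} {n + pathCount K} (ℕ.≤-trans 0<n (ℕ.m≤m+n n _)) (ℕ.≤-trans 0<n (ℕ.m≤m+n n _)) (begin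
    lengthSum G * (n + pathCount K) ≡⟨ ℕ.*-distribˡ-+ (lengthSum G) n _ ⟩
    -- The summand `n` of the denominators only needs the termwise comparison `fewer`; the products
    -- with the path counts need `mean-≤`.
    lengthSum G * n + lengthSum G * pathCount K ≤⟨ ℕ.+-mono-≤ (ℕ.*-monoˡ-≤ n (∑-mono {n} λ x → ℕ.*-monoʳ-≤ (toℕ x) (fewer (toℕ x)))) (mean-≤ n a b cross) ⟩
    lengthSum K * n + lengthSum K * pathCount G ≡⟨ ℕ.*-distribˡ-+ (lengthSum K) n _ ⟨
    lengthSum K * (n + pathCount G) ∎))
  where
  open ℕ.≤-Reasoning
  K = complete n
  a = oriented G
  b = oriented K
  fewer : ∀ i → a i ≤ b i
  fewer zero = ℕ.≤-reflexive (trans (oriented-zero G) (sym (oriented-zero K)))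
  fewer (suc i) = ℕ.≤-trans (oriented-suc-≤ G i) (ℕ.≤-trans (ℕ.*-monoʳ-≤ (n ∸ suc i) (fewer i)) (ℕ.≤-reflexive (sym (oriented-complete n i))))
  -- A further step multiplies `b` by `n ∸ suc i` exactly and `a` by at most that, so the quotient a
  -- / b can only decrease.
  later : ∀ k j → a (k + j) * b j ≤ b (k + j) * a j
  later zero j = ℕ.≤-reflexive (ℕ.*-comm (a j) (b j))
  later (suc k) j = begin
    a (suc k + j) * b j ≤⟨ ℕ.*-monoˡ-≤ (b j) (oriented-suc-≤ G (k + j)) ⟩
    (n ∸ suc (k + j)) * a (k + j) * b j ≡⟨ ℕ.*-assoc (n ∸ suc (k + j)) _ _ ⟩
    (n ∸ suc (k + j)) * (a (k + j) * b j) ≤⟨ ℕ.*-monoʳ-≤ (n ∸ suc (k + j)) (later k j) ⟩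
    (n ∸ suc (k + j)) * (b (k + j) * a j) ≡⟨ ℕ.*-assoc (n ∸ suc (k + j)) _ _ ⟨
    (n ∸ suc (k + j)) * b (k + j) * a j ≡⟨ cong (_* a j) (oriented-complete n (k + j)) ⟨
    b (suc k + j) * a j ∎
  cross : ∀ i j → j ≤ i → a i * b j ≤ b i * a j
  cross i j j≤i = subst (λ i → a i * b j ≤ b i * a j) (ℕ.m∸n+n≡m j≤i) (later (i ∸ j) j)

-- The star minimises the average path length

-- For the first step the freshness test is implied by the absence of loops.
E-first : ∀ (G : Graph n) i y → E G (suc i) one y [] ≡ ∑ λ x → E G i one x (y ∷ []) when adj? G x y
E-first G i y = trans (cong (λ w → w y []) (E-step G i one)) (∑-cong λ x → when-cong (adj? G x y) λ e →
  when-yes (fresh? x (y ∷ [])) λ { (here refl) → irrefl G refl e })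

Ext-append : ∀ {G : Graph n} {b} → Ext G y [] i x vis → b ∉ (x ∷ vis) → Ext G y (b ∷ []) i x (vis ++ (b ∷ []))
Ext-append base f = base
Ext-append {b = b} (grow {x = x} {z = u} {vis = vis} e f′ p) f = grow e f″ (Ext-append p (f ∘ there))
  where
  f″ : u ∉ (x ∷ vis ++ (b ∷ []))
  f″ h with ∈-++⁻ (x ∷ vis) h
  ... | inj₁ h′ = f′ h′
  ... | inj₂ (here refl) = f (here refl)

module _ {m : ℕ} (G : Graph (suc (suc m))) (c : Connected G) where
  private
    V = Fin (suc (suc m))

    -- Among the paths that end with the edge a b, κ counts those from z and K all of length at least 2.
    κ : V → V → V → ℕ
    κ a b z = ∑ℕ m λ i → E G (suc i) (λ x _ → 1 when (x ≟ z)) a (b ∷ [])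

    κ-≥ : ∀ {a b z i vis} → a ≢ b → z ≢ a → Ext G a (b ∷ []) i z vis → 1 ≤ κ a b z
    κ-≥ a≢b z≢a base = ⊥-elim (z≢a refl)
    κ-≥ {a} {b} {z} {suc i} a≢b z≢a p@(grow _ _ _) = begin
      1 ≡⟨ when-yes (z ≟ z) refl ⟨
      1 when (z ≟ z) ≤⟨ E-≥ G (λ x _ → 1 when (x ≟ z)) p ⟩
      f i ≡⟨ cong f (Fin.toℕ-fromℕ< i<m) ⟨
      f (toℕ (fromℕ< i<m)) ≤⟨ ∑-≥ {m} (λ x → f (toℕ x)) (fromℕ< i<m) ⟩
      κ a b z ∎
      where
      open ℕ.≤-Reasoning
      f : ℕ → ℕ
      f i = E G (suc i) (λ x _ → 1 when (x ≟ z)) a (b ∷ [])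
      i<m : i < m
      -- The path and `b` are `i + 3` distinct vertices among `m + 2`.
      i<m = ℕ.≤-pred (ℕ.≤-pred (ℕ.≤-trans (ℕ.≤-reflexive (cong suc (sym (trans (Ext-length p) (ℕ.+-comm (suc i) 1)))))
              (distinct-≤ (Ext-distinct ((λ { (here e) → a≢b e }) ∷ single b) p))))

    -- A path between `a` and `z` is examined. If it meets `b`, its part between `b` and `z` avoids
    -- `a`; otherwise the whole path avoids `b`.
    either : ∀ a b z → a ≢ b → z ∉ (a ∷ b ∷ []) → 1 ≤ κ a b z + κ b a z
    either a b z a≢b f with Star⇒Ext (proj₂ c a z)
    ... | _ , _ , base = ⊥-elim (f (here refl))
    ... | _ , _ , p@(grow {x = x} {vis = vis} e f′ p′) with b ∈? (x ∷ vis)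
    ... | yes h with Ext-suffix p′ h
    ... | _ , _ , q , _ , sub with Ext-reverse q
    ... | _ , r , sub′ = ℕ.≤-trans (κ-≥ (≢-sym a≢b) (λ { refl → f (there (here refl)) }) (Ext-append r (f′ ∘ sub ∘ sub′))) (ℕ.m≤n+m _ (κ a b z))
    either a b z a≢b f | _ , _ , p@(grow {x = x} {vis = vis} e f′ p′) | no b∉ with Ext-reverse p
    ... | _ , r , sub′ = ℕ.≤-trans (κ-≥ a≢b (λ { refl → f (here refl) }) (Ext-append r
          λ h → case sub′ h of λ { (here e) → a≢b (sym e) ; (there h′) → b∉ h′ })) (ℕ.m≤m+n _ _)

    K : V → V → ℕ
    K a b = ∑ℕ m λ i → E G (suc i) one a (b ∷ [])

    K-κ : ∀ a b → K a b ≡ ∑ (κ a b)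
    K-κ a b = trans (∑-cong {m} λ i → trans (E-cong G (suc (toℕ i)) λ {x} _ → sym (trans (∑-cong λ z → when-⇔ (x ≟ z) (z ≟ x) sym sym) (∑-δ x (λ _ → 1))))
                                       (E-∑ G (suc (toℕ i)) (λ z x _ → 1 when (x ≟ z)) a (b ∷ [])))
                    (∑-comm {m} λ i z → E G (suc (toℕ i)) (λ x _ → 1 when (x ≟ z)) a (b ∷ []))

    K-≥ : ∀ a b → a ≢ b → m ≤ K a b + K b a
    K-≥ a b a≢b = ℕ.+-cancelʳ-≤ 2 _ _ (begin
      m + 2 ≡⟨ ℕ.+-comm m 2 ⟩
      suc (suc m) ≡⟨ count-fresh ((λ { (here e) → a≢b e }) ∷ single b) ⟨
      ∑ (λ z → 1 when fresh? z (a ∷ b ∷ [])) + 2 ≤⟨ ℕ.+-monoˡ-≤ 2 (∑-mono λ z → bound z (fresh? z (a ∷ b ∷ []))) ⟩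
      ∑ (λ z → κ a b z + κ b a z) + 2 ≡⟨ cong (ℕ._+ 2) (trans (∑-+ (κ a b) (κ b a)) (sym (cong₂ _+_ (K-κ a b) (K-κ b a)))) ⟩
      K a b + K b a + 2 ∎)
      where
      open ℕ.≤-Reasoning
      bound : ∀ z (d : Dec (z ∉ (a ∷ b ∷ []))) → 1 when d ≤ κ a b z + κ b a z
      bound z (yes f) = ℕ.≤-trans (ℕ.≤-reflexive (when-yes (yes f) f)) (either a b z a≢b f)
      bound z (no ¬f) = ℕ.≤-trans (ℕ.≤-reflexive (when-no (no ¬f) ¬f)) z≤n

  longer : ℕ
  longer = ∑ℕ m λ i → oriented G (2 + i)

  private
    longer-K : longer ≡ ∑ λ b → ∑ λ a → K a b when adj? G a b
    longer-K = trans (∑-cong {m} λ i → ∑-cong λ b → E-first G (suc (toℕ i)) b)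
      (trans (∑-comm {m} λ i b → ∑ λ a → E G (suc (toℕ i)) one a (b ∷ []) when adj? G a b)
      (∑-cong λ b → trans (∑-comm {m} λ i a → E G (suc (toℕ i)) one a (b ∷ []) when adj? G a b)
        (∑-cong λ a → ∑-when {m} _ (adj? G a b))))

    edges : oriented G 1 ≡ ∑ λ b → ∑ λ a → 1 when adj? G a b
    edges = ∑-cong λ b → E-first G 0 b

  -- For every edge a b and every other z, a path from z reaches a before b or b before a; prolong it by the edge.
  longer-≥ : oriented G 1 * m ≤ 2 * longer
  longer-≥ = begin
    oriented G 1 * m ≡⟨ cong (_* m) edges ⟩
    (∑ λ b → ∑ λ a → 1 when adj? G a b) * m ≡⟨ trans (sym (∑-*ʳ m _)) (∑-cong λ b → sym (∑-*ʳ m _)) ⟩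
    ∑ (λ b → ∑ λ a → (1 when adj? G a b) * m) ≤⟨ ∑-mono (λ b → ∑-mono λ a → bound a b) ⟩
    ∑ (λ b → ∑ λ a → K a b when adj? G a b + K b a when adj? G b a) ≡⟨ trans (∑-cong λ b → ∑-+ _ _) (∑-+ _ _) ⟩
    ∑ (λ b → ∑ λ a → K a b when adj? G a b) + ∑ (λ b → ∑ λ a → K b a when adj? G b a)
                                                            ≡⟨ cong₂ _+_ (sym longer-K) (trans (∑-comm λ b a → K b a when adj? G b a) (sym longer-K)) ⟩
    longer + longer ≡⟨ cong (longer ℕ.+_) (ℕ.+-identityʳ longer) ⟨
    2 * longer ∎
    where
    open ℕ.≤-Reasoning
    bound : ∀ a b → (1 when adj? G a b) * m ≤ K a b when adj? G a b + K b a when adj? G b a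
    bound a b = go (adj? G a b)
      where
      go : (d : Dec (Adj G a b)) → (1 when d) * m ≤ K a b when d + K b a when adj? G b a
      go (no ¬e) = ℕ.≤-trans (ℕ.≤-reflexive (cong (_* m) (when-no (no ¬e) ¬e))) z≤n
      go (yes e) = begin
        (1 when yes e) * m ≡⟨ cong (_* m) (when-yes (yes e) e) ⟩
        1 * m ≡⟨ ℕ.*-identityˡ m ⟩
        m ≤⟨ K-≥ a b (λ { refl → irrefl G refl e }) ⟩
        K a b + K b a ≡⟨ cong₂ _+_ (when-yes (yes e) e) (when-yes (adj? G b a) (symm G e)) ⟨
        K a b when yes e + K b a when adj? G b a ∎

  oriented-1-≥ : 2 * suc m ≤ oriented G 1
  oriented-1-≥ with Connected⇒Grown G c
  ... | L , g , all = ℕ.+-cancelˡ-≤ 2 _ _ (begin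
    2 + 2 * suc m ≡⟨ ℕ.*-suc 2 (suc m) ⟨
    2 * suc (suc m) ≡⟨ cong (2 *_) (trans (sym (ℕ.*-identityʳ _)) (trans (sym (∑-const _ 1)) (trans (sym (∑∈-all L _ all)) (∑∈-one (Grown-distinct g))))) ⟩
    2 * length L ≤⟨ edges-≥ G g ⟩
    2 + ∑∈² L (λ x y → 1 when adj? G x y) ≡⟨ cong (2 ℕ.+_) (∑∈²-all L _ all) ⟩
    2 + ∑ (λ x → ∑ λ y → 1 when adj? G x y) ≡⟨ cong (2 ℕ.+_) (trans (∑-comm λ x y → 1 when adj? G x y) (sym edges)) ⟩
    2 + oriented G 1 ∎)
    where open ℕ.≤-Reasoning

  private
    counts : pathCount G ≡ suc (suc m) + (oriented G 1 + longer)
    counts = trans (∑ℕ-suc (suc m) (oriented G)) (cong₂ _+_ (oriented-zero G) (∑ℕ-suc m (λ i → oriented G (suc i))))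

    lengths : oriented G 1 + 2 * longer ≤ lengthSum G
    lengths = begin
      oriented G 1 + 2 * longer ≡⟨ cong₂ _+_ (sym (ℕ.*-identityˡ (oriented G 1))) (sym (∑-*ˡ {m} 2 _)) ⟩
      1 * oriented G 1 + ∑ℕ m (λ i → 2 * oriented G (2 + i)) ≤⟨ ℕ.+-monoʳ-≤ (1 * oriented G 1) (∑-mono {m} λ i → ℕ.*-monoˡ-≤ (oriented G (2 + toℕ i)) (ℕ.m≤m+n 2 (toℕ i))) ⟩
      1 * oriented G 1 + ∑ℕ m (λ i → (2 + i) * oriented G (2 + i)) ≡⟨ ∑ℕ-suc m (λ i → suc i * oriented G (suc i)) ⟨
      ∑ℕ (suc m) (λ i → suc i * oriented G (suc i)) ≡⟨ ∑ℕ-suc (suc m) (λ i → i * oriented G i) ⟨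
      lengthSum G ∎
      where open ℕ.≤-Reasoning

  avp-≥ : quotient (2 * (suc m * suc m)) (suc (suc m) + suc (suc m) * suc (suc m)) ℚ.≤ avp G
  avp-≥ = subst (quotient (2 * (suc m * suc m)) (N + N * N) ℚ.≤_) (sym (avp-quotient G z<s)) (quotient-≤ {N + N * N} {N + pathCount G} {2 * (suc m * suc m)} {lengthSum G} z<s z<s
    (ℕ.*-cancelˡ-≤ 2 (begin
      2 * (2 * (suc m * suc m) * (N + pathCount G)) ≡⟨ cong (λ p → 2 * (2 * (suc m * suc m) * (N + p))) counts ⟩
      2 * (2 * (suc m * suc m) * (N + (N + (o + R)))) ≡⟨ eq₁ m o R ⟩
      2 * (suc m * suc m) * (4 * N + 2 * o + 2 * R) ≤⟨ core ⟩
      2 * ((o + 2 * R) * (N + N * N)) ≤⟨ ℕ.*-monoʳ-≤ 2 (ℕ.*-monoˡ-≤ (N + N * N) lengths) ⟩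
      2 * (lengthSum G * (N + N * N)) ∎)))
    where
    open ℕ.≤-Reasoning
    N = suc (suc m)
    o = oriented G 1
    R = longer
    eq₁ : ∀ m o R → 2 * (2 * (suc m * suc m) * (suc (suc m) + (suc (suc m) + (o + R)))) ≡ 2 * (suc m * suc m) * (4 * suc (suc m) + 2 * o + 2 * R)
    eq₁ = solve-∀
    -- With the slacks `e` and `f` of the two bounds substituted, the inequality becomes a
    -- polynomial identity with a surplus whose coefficients are nonnegative. Everything is doubled
    -- because `longer-≥` bounds `2 * R`.
    e = 2 * R ∸ o * m
    f = o ∸ 2 * suc m
    2R≡ : 2 * R ≡ o * m + e
    2R≡ = sym (ℕ.m+[n∸m]≡n longer-≥)
    o≡ : o ≡ 2 * suc m + f
    o≡ = sym (ℕ.m+[n∸m]≡n oriented-1-≥)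
    core : 2 * (suc m * suc m) * (4 * N + 2 * o + 2 * R) ≤ 2 * ((o + 2 * R) * (N + N * N))
    core = subst (λ r → 2 * (suc m * suc m) * (4 * N + 2 * o + r) ≤ 2 * ((o + r) * (N + N * N))) (sym 2R≡)
      (subst (λ o → 2 * (suc m * suc m) * (4 * N + 2 * o + (o * m + e)) ≤ 2 * ((o + (o * m + e)) * (N + N * N))) (sym o≡)
        (ℕ.≤-trans (ℕ.m≤m+n _ (2 * (f * (2 + m) * (1 + m) * 2 + e * (5 + 3 * m)))) (ℕ.≤-reflexive (eq₂ m f e))))
      where
      eq₂ : ∀ m f e → 2 * (suc m * suc m) * (4 * suc (suc m) + 2 * (2 * suc m + f) + ((2 * suc m + f) * m + e)) + 2 * (f * (2 + m) * (1 + m) * 2 + e * (5 + 3 * m))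
            ≡ 2 * ((2 * suc m + f + ((2 * suc m + f) * m + e)) * (suc (suc m) + suc (suc m) * suc (suc m)))
      eq₂ = solve-∀

private
  opaque
    apart : Fin n → Fin n → ℕ
    apart x y = 2 when ¬? (x ≟ y)

    apart-when : ∀ (x y : Fin n) → apart x y ≡ 2 when ¬? (x ≟ y)
    apart-when x y = refl

    star-d-≡ : ∀ (x : Fin n) → apart x x ≡ 0
    star-d-≡ x = when-no (¬? (x ≟ x)) λ f → f refl

    star-d-≢ : ∀ {x y : Fin n} → x ≢ y → apart x y ≡ 2
    star-d-≢ {x = x} {y} f = when-yes (¬? (x ≟ y)) f

  star-d : Fin n → Fin n → ℕ
  star-d zero zero = 0
  star-d zero (suc y) = 1
  star-d (suc x) zero = 1
  star-d (suc x) (suc y) = apart x y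

star-metric : ∀ n → TreeMetric (star n) star-d
star-metric n = record
  { d-refl = λ { zero → refl ; (suc x) → star-d-≡ x }
  ; d-zero = d-zero
  ; parent = parent
  ; edge = edge
  ; parents-≡ = parents-≡
  }
  where
  d-zero : ∀ {n} (x y : Fin n) → star-d x y ≡ 0 → x ≡ y
  d-zero zero zero _ = refl
  d-zero (suc x) (suc y) h with x ≟ y
  ... | yes e = cong suc e
  ... | no f = contradiction (trans (sym (star-d-≢ f)) (trans h refl)) λ ()
  parent : ∀ {n} (x y : Fin n) k → star-d x y ≡ suc k → ∃[ z ] (Adj (star n) x z × star-d z y ≡ k)
  parent zero (suc y) k h = suc y , ((λ ()) , inj₁ refl) , trans (star-d-≡ y) (ℕ.suc-injective h)
  parent (suc x) zero k h = zero , ((λ ()) , inj₂ refl) , ℕ.suc-injective h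
  parent (suc x) (suc y) k h with x ≟ y
  ... | yes refl = contradiction (trans (sym h) (star-d-≡ x)) λ ()
  ... | no f = zero , ((λ ()) , inj₂ refl) , ℕ.suc-injective (trans (sym (star-d-≢ f)) h)
  edge : ∀ {n} (x z y : Fin n) → Adj (star n) x z → star-d x y ≡ suc (star-d z y) ⊎ star-d z y ≡ suc (star-d x y)
  edge zero zero y (f , _) = contradiction refl f
  edge zero (suc z) zero _ = inj₂ refl
  edge zero (suc z) (suc y) _ with z ≟ y
  ... | yes refl = inj₁ (cong suc (sym (star-d-≡ z)))
  ... | no f = inj₂ (star-d-≢ f)
  edge (suc x) zero zero _ = inj₁ refl
  edge (suc x) zero (suc y) _ with x ≟ y
  ... | yes refl = inj₂ (cong suc (sym (star-d-≡ x)))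
  ... | no f = inj₁ (star-d-≢ f)
  edge (suc x) (suc z) y (_ , inj₁ ())
  edge (suc x) (suc z) y (_ , inj₂ ())
  parents-≡ : ∀ {n} (x z z′ y : Fin n) → Adj (star n) x z → Adj (star n) x z′ →
              star-d x y ≡ suc (star-d z y) → star-d x y ≡ suc (star-d z′ y) → z ≡ z′
  parents-≡ zero z z′ zero e e′ () h′
  parents-≡ zero z z′ (suc y) e e′ h h′ = trans (d-zero z (suc y) (sym (ℕ.suc-injective h))) (sym (d-zero z′ (suc y) (sym (ℕ.suc-injective h′))))
  parents-≡ (suc x) zero zero y e e′ h h′ = refl
  parents-≡ (suc x) (suc z) z′ y (_ , inj₁ ()) e′ h h′
  parents-≡ (suc x) (suc z) z′ y (_ , inj₂ ()) e′ h h′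
  parents-≡ (suc x) zero (suc z′) y e (_ , inj₁ ()) h h′
  parents-≡ (suc x) zero (suc z′) y e (_ , inj₂ ()) h h′

lengthSum-star : ∀ n → lengthSum (star (suc n)) ≡ 2 * (n * n)
lengthSum-star n = begin
  lengthSum (star (suc n)) ≡⟨ lengthSum-metric (star-metric (suc n)) ⟩
  ∑ (λ (y : Fin (suc n)) → ∑ λ x → star-d x y) ≡⟨ ∑-suc _ ⟩
  ∑ (λ x → star-d x zero) + ∑ (λ (y : Fin n) → ∑ λ x → star-d x (suc y)) ≡⟨ cong₂ _+_ (∑-suc {n} λ x → star-d x zero) (∑-cong λ y → trans (∑-suc λ x → star-d x (suc y)) (cong suc (∑-cong λ x → apart-when x y))) ⟩
  ∑ {n} (λ _ → 1) + ∑ (λ (y : Fin n) → 1 + ∑ (λ x → 2 when ¬? (x ≟ y))) ≡⟨ cong (ℕ._+ ∑ (λ (y : Fin n) → 1 + ∑ (λ x → 2 when ¬? (x ≟ y)))) (trans (∑-const n 1) (ℕ.*-identityʳ n)) ⟩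
  n + ∑ (λ (y : Fin n) → 1 + ∑ (λ x → 2 when ¬? (x ≟ y))) ≡⟨ cong (n ℕ.+_) (trans (∑-cong row) (∑-const n r)) ⟩
  n + n * r ≡⟨ finish n ⟩
  2 * (n * n) ∎
  where
  open ≡-Reasoning
  -- From a leaf, the centre is at distance 1 and the other `n - 1` leaves at distance 2. The
  -- truncation at `n = 0` is harmless, as there is no leaf then.
  r = 1 + n * 2 ∸ 2
  row : ∀ (y : Fin n) → 1 + ∑ (λ x → 2 when ¬? (x ≟ y)) ≡ r
  row y = begin
    1 + s ≡⟨ ℕ.m+n∸n≡m (1 + s) 2 ⟨
    1 + s + 2 ∸ 2 ≡⟨ cong (λ t → 1 + t ∸ 2) (trans (cong (s ℕ.+_) (sym (∑-δ y (λ _ → 2)))) (sym (∑-+ (λ x → 2 when ¬? (x ≟ y)) _))) ⟩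
    1 + ∑ (λ x → 2 when ¬? (x ≟ y) + 2 when (x ≟ y)) ∸ 2 ≡⟨ cong (λ t → 1 + t ∸ 2) (trans (∑-cong λ x → trans (ℕ.+-comm (2 when ¬? (x ≟ y)) _) (when-compl 2 (x ≟ y) (¬? (x ≟ y)) (λ p f → f p) id)) (∑-const n 2)) ⟩
    r ∎
    where
    s = ∑ (λ (x : Fin n) → 2 when ¬? (x ≟ y))
  finish : ∀ n → n + n * (1 + n * 2 ∸ 2) ≡ 2 * (n * n)
  finish zero = refl
  finish (suc n) = eq n
    where
    eq : ∀ n → suc n + suc n * (1 + n * 2) ≡ 2 * (suc n * suc n)
    eq = solve-∀

avp-star≤ : (G : Graph n) → Connected G → avp (star n) ℚ.≤ avp G
avp-star≤ {suc zero} G c = subst₂ ℚ._≤_ (sym (avp-quotient (star 1) z<s)) (sym (avp-quotient G z<s))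
  (quotient-≤ {1 + pathCount (star 1)} {1 + pathCount G} {lengthSum (star 1)} {lengthSum G} z<s z<s (ℕ.≤-trans (ℕ.≤-reflexive (cong (_* (1 + pathCount G)) (lengthSum-star 0))) z≤n))
avp-star≤ {suc (suc m)} G c = subst (ℚ._≤ avp G) (sym (trans (avp-quotient (star (suc (suc m))) z<s)
  (cong₂ (λ a b → quotient a (suc (suc m) + b)) (lengthSum-star (suc m)) (pathCount-metric (star-metric (suc (suc m))))))) (avp-≥ G c)
avp-star≤ {zero} G (() , _)

-- Paths with a prescribed end, and the convolution of path counts

from : Graph n → Fin n → ℕ → ℕ
from G r i = E G i one r []

from-long : ∀ (G : Graph n) r i → n ≤ i → from G r i ≡ 0
from-long G r i n≤i = E-long G i one (single r) (ℕ.≤-trans (s≤s n≤i) (ℕ.≤-reflexive (ℕ.+-comm 1 i)))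

at : Fin n → Weight n
at r x _ = 1 when (x ≟ r)

lastOf : Fin n → List (Fin n) → Fin n
lastOf x [] = x
lastOf x (y ∷ vis) = lastOf y vis

private
  Ext-lastOf : Ext G y [] i x vis → lastOf x vis ≡ y
  Ext-lastOf base = refl
  Ext-lastOf (grow _ _ p) = Ext-lastOf p

  last-lastOf : (p : Vec (Fin n) (suc k)) → last p ≡ lastOf (head p) (toList (tail p))
  last-lastOf (x ∷ []) = refl
  last-lastOf (x ∷ y ∷ p) = last-lastOf (y ∷ p)

-- `at r` prescribes the head of a path, `from` its other end; reversal, available for vectors,
-- exchanges the two.
∑-at : ∀ (G : Graph n) r i → ∑ (λ y → E G i (at r) y []) ≡ from G r i
∑-at {n} G r i = begin
  ∑ (λ y → E G i (at r) y []) ≡⟨ ∑ⱽ-E G i (at r) ⟨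
  ∑ⱽ (suc i) f ≡⟨ ∑ⱽ-reverse (suc i) f ⟨
  ∑ⱽ (suc i) (λ p → 1 when (head (reverse p) ≟ r) when isVertexPath? G (reverse p)) ≡⟨ ∑ⱽ-cong (suc i) turn ⟩
  ∑ⱽ (suc i) (λ p → end (head p) (toList (tail p)) when isVertexPath? G p) ≡⟨ ∑ⱽ-E G i end ⟩
  ∑ (λ y → E G i end y []) ≡⟨ ∑-cong (λ y → trans (E-cong G i λ p → cong (λ a → 1 when (a ≟ r)) (Ext-lastOf p))
                                                                          (trans (E-cong G i λ _ → sym (ℕ.*-identityʳ (1 when (y ≟ r))))
                                                                          (trans (E-* G i (1 when (y ≟ r)) one y [])
                                                                            (trans (ℕ.*-comm (1 when (y ≟ r)) _)
                                                                            (trans (when-* (E G i one y []) 1 (y ≟ r)) (cong (_when (y ≟ r)) (ℕ.*-identityʳ _))))))) ⟩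
  ∑ (λ y → E G i one y [] when (y ≟ r)) ≡⟨ ∑-δ r _ ⟩
  from G r i ∎
  where
  open ≡-Reasoning
  f : Vec (Fin n) (suc i) → ℕ
  f p = at r (head p) (toList (tail p)) when isVertexPath? G p
  end : Weight n
  end x vis = 1 when (lastOf x vis ≟ r)
  turn : ∀ p → 1 when (head (reverse p) ≟ r) when isVertexPath? G (reverse p) ≡ end (head p) (toList (tail p)) when isVertexPath? G p
  turn p = trans
    (when-⇔ (isVertexPath? G (reverse p)) (isVertexPath? G p)
      (λ v → subst (IsVertexPath G) (reverse-involutive p) (vertexPath-reverse G v)) (vertexPath-reverse G))
    (cong (λ a → 1 when (a ≟ r) when isVertexPath? G p)
      (trans (sym (last-reverse (reverse p))) (trans (cong last (reverse-involutive p)) (last-lastOf p))))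

from-return : ∀ (G : Graph n) r i → E G (suc i) (at r) r [] ≡ 0
from-return G r i = trans (E-cong G (suc i) away) (E-0 G (suc i) r [])
  where
  away : ∀ {x vis} → Ext G r [] (suc i) x vis → at r x vis ≡ 0
  away {x} (grow _ f p) = when-no (x ≟ r) λ { refl → f (Ext-end p) }

-- bridge i a b = ∑ a j * b k over j + 1 + k = i
bridge : ℕ → (ℕ → ℕ) → (ℕ → ℕ) → ℕ
bridge zero a b = 0
bridge (suc i) a b = a 0 * b i + bridge i (λ j → a (suc j)) b

bridge-cong : ∀ i {a a′ : ℕ → ℕ} b → (∀ j → a j ≡ a′ j) → bridge i a b ≡ bridge i a′ b
bridge-cong zero b h = refl
bridge-cong (suc i) b h = cong₂ _+_ (cong (_* b i) (h 0)) (bridge-cong i b (λ j → h (suc j)))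

bridge-0 : ∀ i {a} b → (∀ j → a j ≡ 0) → bridge i a b ≡ 0
bridge-0 zero b h = refl
bridge-0 (suc i) b h = cong₂ _+_ (cong (_* b i) (h 0)) (bridge-0 i b (λ j → h (suc j)))

bridge-∑ : ∀ i (a : Fin n → ℕ → ℕ) b → bridge i (λ j → ∑ λ x → a x j) b ≡ ∑ λ x → bridge i (a x) b
bridge-∑ {n} zero a b = sym (∑-zero {n} λ _ → refl)
bridge-∑ (suc i) a b = trans (cong₂ _+_ (sym (∑-*ʳ (b i) (λ x → a x 0))) (bridge-∑ i (λ x j → a x (suc j)) b)) (sym (∑-+ _ _))

bridge-when : ∀ {P : Set} i a b (d : Dec P) → bridge i (λ j → a j when d) b ≡ bridge i a b when d
bridge-when i a b d@(yes p) = trans (bridge-cong i b λ j → when-yes d p) (sym (when-yes d p))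
bridge-when i a b d@(no ¬p) = trans (bridge-0 i b λ j → when-no d ¬p) (sym (when-no d ¬p))

Below : ℕ → (ℕ → ℕ) → Set
Below n a = ∀ j → n ≤ j → a j ≡ 0

∑ℕ-0 : ∀ (f : ℕ → ℕ) → ∑ℕ 0 f ≡ 0
∑ℕ-0 f = ∑-zero {0} λ ()

∑ℕ-+ : ∀ n (f g : ℕ → ℕ) → ∑ℕ n (λ i → f i + g i) ≡ ∑ℕ n f + ∑ℕ n g
∑ℕ-+ n f g = ∑-+ {n} _ _

∑ℕ-* : ∀ n c (f : ℕ → ℕ) → ∑ℕ n (λ i → c * f i) ≡ c * ∑ℕ n f
∑ℕ-* n c f = ∑-*ˡ {n} c _

∑ℕ-cong : ∀ n {f g : ℕ → ℕ} → (∀ i → f i ≡ g i) → ∑ℕ n f ≡ ∑ℕ n g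
∑ℕ-cong n h = ∑-cong {n} λ x → h (toℕ x)

moment : ℕ → (ℕ → ℕ) → ℕ
moment n a = ∑ℕ n λ i → i * a i

moment-suc : ∀ n a → moment (suc n) a ≡ ∑ℕ n (λ i → a (suc i)) + moment n (λ i → a (suc i))
moment-suc n a = trans (∑ℕ-suc n (λ i → i * a i)) (∑ℕ-+ n (λ i → a (suc i)) (λ i → i * a (suc i)))

moment-support : ∀ {a} → n ≤ l → Below n a → moment l a ≡ moment n a
moment-support {a = a} n≤N h = ∑-support (λ i → i * a i) n≤N λ j n≤j → trans (cong (j *_) (h j n≤j)) (ℕ.*-zeroʳ j)

∑-bridge : ∀ m {n l} a b → m + n ≤ l → Below m a → Below n b →
           ∑ℕ l (λ i → bridge i a b) ≡ ∑ℕ m a * ∑ℕ n b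
∑-bridge zero {n} {l} a b le ha hb = trans (∑-zero {l} λ x → bridge-0 (toℕ x) b (λ j → ha j z≤n)) (sym (cong (_* ∑ℕ n b) (∑ℕ-0 a)))
∑-bridge (suc m) {n} {suc l} a b (s≤s le) ha hb = begin
  ∑ℕ (suc l) (λ i → bridge i a b) ≡⟨ ∑ℕ-suc l (λ i → bridge i a b) ⟩
  ∑ℕ l (λ i → a 0 * b i + bridge i a′ b) ≡⟨ ∑ℕ-+ l (λ i → a 0 * b i) (λ i → bridge i a′ b) ⟩
  ∑ℕ l (λ i → a 0 * b i) + ∑ℕ l (λ i → bridge i a′ b) ≡⟨ cong₂ _+_ (trans (∑ℕ-* l (a 0) b) (cong (a 0 *_) (∑-support b (ℕ.≤-trans (ℕ.m≤n+m n m) le) hb)))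
                                                                     (∑-bridge m a′ b le (λ j h → ha (suc j) (s≤s h)) hb) ⟩
  a 0 * ∑ℕ n b + ∑ℕ m a′ * ∑ℕ n b ≡⟨ ℕ.*-distribʳ-+ (∑ℕ n b) (a 0) _ ⟨
  (a 0 + ∑ℕ m a′) * ∑ℕ n b ≡⟨ cong (_* ∑ℕ n b) (∑ℕ-suc m a) ⟨
  ∑ℕ (suc m) a * ∑ℕ n b ∎
  where
  open ≡-Reasoning
  a′ : ℕ → ℕ
  a′ j = a (suc j)

-- The generating function of `bridge` is x A(x) B(x), and the moment is its derivative at 1: one
-- summand for each factor, the last one for the edge of the bridge itself.
moment-bridge : ∀ m {n l} a b → m + n ≤ l → Below m a → Below n b →
                moment l (λ i → bridge i a b) ≡ moment m a * ∑ℕ n b + ∑ℕ m a * moment n b + ∑ℕ m a * ∑ℕ n b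
moment-bridge zero {n} {l} a b le ha hb = trans
  (∑-zero {l} λ x → trans (cong (toℕ x *_) (bridge-0 (toℕ x) b (λ j → ha j z≤n))) (ℕ.*-zeroʳ (toℕ x)))
  (sym (cong₂ (λ u v → u * ∑ℕ n b + v * moment n b + v * ∑ℕ n b) (∑ℕ-0 (λ i → i * a i)) (∑ℕ-0 a)))
moment-bridge (suc m) {n} {suc l} a b (s≤s le) ha hb = begin
  moment (suc l) (λ i → bridge i a b) ≡⟨ moment-suc l (λ i → bridge i a b) ⟩
  ∑ℕ l c + moment l c ≡⟨ cong₂ _+_ (∑ℕ-+ l (λ i → a 0 * b i) (λ i → bridge i a′ b)) (trans (∑ℕ-cong l λ i → ℕ.*-distribˡ-+ i (a 0 * b i) (bridge i a′ b)) (∑ℕ-+ l (λ i → i * (a 0 * b i)) (λ i → i * bridge i a′ b))) ⟩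
  (∑ℕ l (λ i → a 0 * b i) + ∑ℕ l (λ i → bridge i a′ b)) + (∑ℕ l (λ i → i * (a 0 * b i)) + moment l (λ i → bridge i a′ b))
                                                               ≡⟨ cong₂ _+_ (cong₂ _+_ (trans (∑ℕ-* l (a 0) b) (cong (a 0 *_) (∑-support b n≤N hb))) (∑-bridge m a′ b le ha′ hb))
                                                                  (cong₂ _+_ (trans (∑ℕ-cong l λ i → swap i (a 0) (b i)) (trans (∑ℕ-* l (a 0) (λ i → i * b i)) (cong (a 0 *_) (moment-support n≤N hb)))) (moment-bridge m a′ b le ha′ hb)) ⟩
  (a 0 * B + A′ * B) + (a 0 * MB + (MA′ * B + A′ * MB + A′ * B)) ≡⟨ eq (a 0) A′ MA′ B MB ⟩
  (A′ + MA′) * B + (a 0 + A′) * MB + (a 0 + A′) * B ≡⟨ cong₂ (λ u v → u * B + v * MB + v * B) (moment-suc m a) (∑ℕ-suc m a) ⟨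
  moment (suc m) a * B + ∑ℕ (suc m) a * MB + ∑ℕ (suc m) a * B ∎
  where
  open ≡-Reasoning
  a′ c : ℕ → ℕ
  a′ j = a (suc j)
  c i = a 0 * b i + bridge i a′ b
  B = ∑ℕ n b
  MB = moment n b
  A′ = ∑ℕ m a′
  MA′ = moment m a′
  n≤N : n ≤ l
  n≤N = ℕ.≤-trans (ℕ.m≤n+m n m) le
  ha′ : Below m a′
  ha′ j h = ha (suc j) (s≤s h)
  swap : ∀ i a b → i * (a * b) ≡ a * (i * b)
  swap = solve-∀
  eq : ∀ a A M B P → (a * B + A * B) + (a * P + (M * B + A * P + A * B)) ≡ (A + M) * B + (a + A) * P + (a + A) * B
  eq = solve-∀

-- Joining two graphs by an edge

-- G consists of disjoint copies of A and B and the edge f r - g s.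
record Bridged {m n l : ℕ} (G : Graph l) (A : Graph m) (r : Fin m) (B : Graph n) (s : Fin n) : Set where
  field
    f : Fin m → Fin l
    g : Fin n → Fin l
    ∑-fg : ∀ h → ∑ h ≡ ∑ (λ x → h (f x)) + ∑ (λ y → h (g y))
    f-inj : ∀ {x y} → f x ≡ f y → x ≡ y
    g-inj : ∀ {x y} → g x ≡ g y → x ≡ y
    f≢g : ∀ {x y} → f x ≢ g y
    cover : ∀ z → (∃[ x ] z ≡ f x) ⊎ (∃[ y ] z ≡ g y)
    ff : ∀ {x y} → Adj G (f x) (f y) ⇔ Adj A x y
    gg : ∀ {x y} → Adj G (g x) (g y) ⇔ Adj B x y
    gf : ∀ {x y} → Adj G (g y) (f x) ⇔ (x ≡ r × y ≡ s)
    fg : ∀ {x y} → Adj G (f x) (g y) ⇔ (x ≡ r × y ≡ s)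

Bridged-flip : ∀ {G : Graph l} {A : Graph m} {r B s} → Bridged {n = n} G A r B s → Bridged G B s A r
Bridged-flip W = record
  { f = g ; g = f ; ∑-fg = λ h → trans (∑-fg h) (ℕ.+-comm (∑ λ x → h (f x)) _)
  ; f-inj = g-inj ; g-inj = f-inj ; f≢g = λ e → f≢g (sym e) ; cover = λ z → Sum.swap (cover z) ; ff = gg ; gg = ff
  ; gf = mk⇔ (λ e → Product.swap (Equivalence.to fg e)) (λ e → Equivalence.from fg (Product.swap e))
  ; fg = mk⇔ (λ e → Product.swap (Equivalence.to gf e)) (λ e → Equivalence.from gf (Product.swap e))
  }
  where
  open Bridged W

module _ {G : Graph l} {A : Graph m} {r : Fin m} {B : Graph n} {s : Fin n} (W : Bridged G A r B s) where
  open Bridged W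
  open Equivalence using (to) renaming (from to from⇐)

  private
    g∉f : ∀ {y p} → g y ∉ List.map f p
    g∉f h with ∈-map⁻ f h
    ... | _ , _ , e = f≢g (sym e)

    ∈-f : ∀ {x p} → f x ∈ List.map f p → x ∈ p
    ∈-f h with ∈-map⁻ f h
    ... | _ , h′ , e = subst (_∈ _) (sym (f-inj e)) h′

    ∈-gf : ∀ {y q p} → g y ∈ (List.map g q ++ List.map f p) → y ∈ q
    ∈-gf {q = q} h with ∈-++⁻ (List.map g q) h
    ... | inj₂ h′ = ⊥-elim (g∉f h′)
    ... | inj₁ h′ with ∈-map⁻ g h′
    ... | _ , h″ , e = subst (_∈ _) (sym (g-inj e)) h″

    when₂ : ∀ {P Q P′ Q′ : Set} {k l} (d : Dec P) (e : Dec Q) (d′ : Dec P′) (e′ : Dec Q′) → k ≡ l →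
            (P → P′) → (P′ → P) → (Q → Q′) → (Q′ → Q) → k when d when e ≡ l when d′ when e′
    when₂ d e d′ e′ refl a b c c′ = trans (cong (_when e) (when-⇔ d d′ a b)) (when-⇔ e e′ c c′)

  -- After the bridge has been crossed, a path stays on its side.
  E-crossed : ∀ i x vis p → r ∈ p → E G i one (g x) (List.map g vis ++ List.map f p) ≡ E B i one x vis
  E-crossed zero x vis p h = refl
  E-crossed (suc i) x vis p h = begin
    E G (suc i) one (g x) K ≡⟨ cong (λ w → w (g x) K) (E-step G i one) ⟩
    step G (E G i one) (g x) K ≡⟨ ∑-fg _ ⟩
    ∑ (λ z → E G i one (f z) (g x ∷ K) when fresh? (f z) (g x ∷ K) when adj? G (f z) (g x)) +
    ∑ (λ z → E G i one (g z) (g x ∷ K) when fresh? (g z) (g x ∷ K) when adj? G (g z) (g x)) ≡⟨ cong₂ _+_ (∑-zero back) (∑-cong stay) ⟩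
    step B (E B i one) x vis ≡⟨ cong (λ w → w x vis) (E-step B i one) ⟨
    E B (suc i) one x vis ∎
    where
    open ≡-Reasoning
    K = List.map g vis ++ List.map f p
    back : ∀ z → E G i one (f z) (g x ∷ K) when fresh? (f z) (g x ∷ K) when adj? G (f z) (g x) ≡ 0
    back z = trans (when-cong (adj? G (f z) (g x)) λ e → when-no (fresh? (f z) (g x ∷ K)) λ φ →
      φ (there (∈-++⁺ʳ (List.map g vis) (∈-map⁺ f (subst (_∈ p) (sym (proj₁ (to fg e))) h))))) (when-0 (adj? G (f z) (g x)))
    stay : ∀ z → E G i one (g z) (g x ∷ K) when fresh? (g z) (g x ∷ K) when adj? G (g z) (g x) ≡
                 E B i one z (x ∷ vis) when fresh? z (x ∷ vis) when adj? B z x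
    stay z = when₂ (fresh? (g z) (g x ∷ K)) (adj? G (g z) (g x)) (fresh? z (x ∷ vis)) (adj? B z x)
      (E-crossed i z (x ∷ vis) p h)
      (λ φ → λ { (here refl) → φ (here refl) ; (there h′) → φ (there (∈-++⁺ˡ (∈-map⁺ g h′))) })
      (λ φ → λ { (here e) → φ (here (g-inj e)) ; (there h′) → φ (there (∈-gf {q = vis} h′)) })
      (to gg) (from⇐ gg)

  -- A path either stays in `A`, or arrives at `r` after some `j` steps, spends one step on the
  -- bridge and continues from `s` inside `B`.
  E-uncrossed : ∀ i x vis → E G i one (f x) (List.map f vis) ≡
                E A i one x vis + bridge i (λ j → E A j (at r) x vis) (from B s)
  E-uncrossed zero x vis = refl
  E-uncrossed (suc i) x vis = begin
    E G (suc i) one (f x) K ≡⟨ cong (λ w → w (f x) K) (E-step G i one) ⟩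
    step G (E G i one) (f x) K ≡⟨ ∑-fg _ ⟩
    ∑ (λ z → E G i one (f z) (f x ∷ K) when fresh? (f z) (f x ∷ K) when adj? G (f z) (f x)) +
    ∑ (λ z → E G i one (g z) (f x ∷ K) when fresh? (g z) (f x ∷ K) when adj? G (g z) (f x)) ≡⟨ cong₂ _+_ (∑-cong stay) across ⟩
    ∑ (λ z → α z + β z) + at r x vis * b i ≡⟨ cong (ℕ._+ at r x vis * b i) (∑-+ α β) ⟩
    (∑ α + ∑ β) + at r x vis * b i ≡⟨ trans (ℕ.+-assoc (∑ α) _ _) (cong (∑ α ℕ.+_) (ℕ.+-comm (∑ β) _)) ⟩
    ∑ α + (at r x vis * b i + ∑ β) ≡⟨ cong₂ (λ u v → u + (at r x vis * b i + v)) (sym (cong (λ w → w x vis) (E-step A i one))) (sym later) ⟩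
    E A (suc i) one x vis + bridge (suc i) (λ j → E A j (at r) x vis) b ∎
    where
    open ≡-Reasoning
    K = List.map f vis
    b = from B s
    α β : Fin m → ℕ
    α z = E A i one z (x ∷ vis) when fresh? z (x ∷ vis) when adj? A z x
    β z = bridge i (λ j → E A j (at r) z (x ∷ vis)) b when fresh? z (x ∷ vis) when adj? A z x
    stay : ∀ z → E G i one (f z) (f x ∷ K) when fresh? (f z) (f x ∷ K) when adj? G (f z) (f x) ≡ α z + β z
    stay z = trans
      (when₂ (fresh? (f z) (f x ∷ K)) (adj? G (f z) (f x)) (fresh? z (x ∷ vis)) (adj? A z x) (E-uncrossed i z (x ∷ vis))
        (λ φ h → φ (∈-map⁺ f h)) (λ φ h → φ (∈-f h)) (to ff) (from⇐ ff))
      (trans (cong (_when adj? A z x) (when-+ (E A i one z (x ∷ vis)) _ (fresh? z (x ∷ vis)))) (when-+ (E A i one z (x ∷ vis) when fresh? z (x ∷ vis)) _ (adj? A z x)))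
    across : ∑ (λ z → E G i one (g z) (f x ∷ K) when fresh? (g z) (f x ∷ K) when adj? G (g z) (f x)) ≡ at r x vis * b i
    across = trans (∑-unique s _ λ z z≢s → when-no (adj? G (g z) (f x)) λ e → z≢s (proj₂ (to gf e)))
      (trans (when-⇔ (adj? G (g s) (f x)) (x ≟ r) (λ e → proj₁ (to gf e)) (λ e → from⇐ gf (e , refl)))
      (trans (when-cong (x ≟ r) λ { refl → trans (when-yes (fresh? (g s) (f x ∷ K)) (g∉f {p = x ∷ vis}))
               (trans (E-crossed i s [] (x ∷ vis) (here refl)) (sym (ℕ.*-identityʳ (b i)))) })
      (trans (sym (when-* (b i) 1 (x ≟ r))) (ℕ.*-comm (b i) _))))
    later : bridge i (λ j → E A (suc j) (at r) x vis) b ≡ ∑ β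
    later = trans (bridge-cong i b λ j → cong (λ w → w x vis) (E-step A j (at r)))
      (trans (bridge-∑ i (λ z j → E A j (at r) z (x ∷ vis) when fresh? z (x ∷ vis) when adj? A z x) b)
        (∑-cong λ z → trans (bridge-when i (λ j → E A j (at r) z (x ∷ vis) when fresh? z (x ∷ vis)) b (adj? A z x))
          (cong (_when adj? A z x) (bridge-when i (λ j → E A j (at r) z (x ∷ vis)) b (fresh? z (x ∷ vis))))))

record HasStats {n : ℕ} (G : Graph n) (r : Fin n) (q s b a : ℕ) : Set where
  field
    from-count : ∑ℕ n (from G r) ≡ q
    from-length : moment n (from G r) ≡ s
    total-count : pathCount G ≡ b
    total-length : lengthSum G ≡ a

module _ {G : Graph (m + n)} {A : Graph m} {r : Fin m} {B : Graph n} {s : Fin n} (W : Bridged G A r B s) where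
  open Bridged W

  private
    -- Only the trivial path leads from `r` back to `r`, so a path from the root that crosses the
    -- bridge does so at once.
    δ : ℕ → ℕ
    δ j = E A j (at r) r []

    δ-below : Below 1 δ
    δ-below (suc j) _ = from-return A r j

    ∑δ : ∑ℕ 1 δ ≡ 1
    ∑δ = trans (∑ℕ-suc 0 δ) (cong₂ _+_ (when-yes (r ≟ r) refl) (∑ℕ-0 (λ j → δ (suc j))))

    moment-δ : moment 1 δ ≡ 0
    moment-δ = trans (∑ℕ-suc 0 (λ j → j * δ j)) (∑ℕ-0 (λ j → suc j * δ (suc j)))

    1≤m : ∀ {m} → Fin m → 1 ≤ m
    1≤m {suc _} _ = s≤s z≤n

    from-bridged : ∀ i → from G (f r) i ≡ from A r i + bridge i δ (from B s)
    from-bridged i = E-uncrossed W i r []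

    oriented-bridged : ∀ i → oriented G i ≡ (oriented A i + bridge i (from A r) (from B s)) + (oriented B i + bridge i (from B s) (from A r))
    oriented-bridged i = trans (∑-fg _) (cong₂ _+_ (half W) (half (Bridged-flip W)))
      where
      half : ∀ {m n} {A : Graph m} {r B} {s : Fin n} (W : Bridged G A r B s) →
             ∑ (λ x → E G i one (Bridged.f W x) []) ≡ oriented A i + bridge i (from A r) (from B s)
      half {A = A} {r} {B} {s} W = trans (∑-cong λ x → E-uncrossed W i x []) (trans (∑-+ _ _)
        (cong (oriented A i ℕ.+_) (trans (sym (bridge-∑ i (λ x j → E A j (at r) x []) (from B s))) (bridge-cong i (from B s) (∑-at A r)))))

  -- A path on both sides is a path to `r`, the bridge, and a path from `s`, so these paths are
  -- `q * q₁` in each direction; their lengths are those of the two parts plus 1 for the bridge.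
  -- From the root only the paths of `B` from `s`, one longer, are added.
  stats-bridged : ∀ {q s′ b a q₁ s₁ b₁ a₁} → HasStats A r q s′ b a → HasStats B s q₁ s₁ b₁ a₁ →
                  HasStats G (f r) (q + q₁) (s′ + (s₁ + q₁)) (b + b₁ + 2 * (q * q₁)) (a + a₁ + 2 * (s′ * q₁ + q * s₁ + q * q₁))
  stats-bridged {q} {s′} {b} {a} {q₁} {s₁} {b₁} {a₁} SA SB = record
    { from-count = begin
        ∑ℕ M (from G (f r)) ≡⟨ ∑ℕ-cong M from-bridged ⟩
        ∑ℕ M (λ i → eA i + bridge i δ eB) ≡⟨ ∑ℕ-+ M eA (λ i → bridge i δ eB) ⟩
        ∑ℕ M eA + ∑ℕ M (λ i → bridge i δ eB) ≡⟨ cong₂ _+_ (∑-support eA (ℕ.m≤m+n m n) (from-long A r)) (∑-bridge 1 δ eB 1+n≤M δ-below (from-long B s)) ⟩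
        ∑ℕ m eA + ∑ℕ 1 δ * ∑ℕ n eB ≡⟨ cong₂ _+_ (from-count SA) (cong₂ _*_ ∑δ (from-count SB)) ⟩
        q + 1 * q₁ ≡⟨ cong (q ℕ.+_) (ℕ.*-identityˡ q₁) ⟩
        q + q₁ ∎
    ; from-length = begin
        moment M (from G (f r)) ≡⟨ ∑ℕ-cong M (λ i → trans (cong (i *_) (from-bridged i)) (ℕ.*-distribˡ-+ i (eA i) _)) ⟩
        ∑ℕ M (λ i → i * eA i + i * bridge i δ eB) ≡⟨ ∑ℕ-+ M (λ i → i * eA i) (λ i → i * bridge i δ eB) ⟩
        moment M eA + moment M (λ i → bridge i δ eB) ≡⟨ cong₂ _+_ (moment-support (ℕ.m≤m+n m n) (from-long A r)) (moment-bridge 1 δ eB 1+n≤M δ-below (from-long B s)) ⟩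
        moment m eA + (moment 1 δ * ∑ℕ n eB + ∑ℕ 1 δ * moment n eB + ∑ℕ 1 δ * ∑ℕ n eB)
                                                              ≡⟨ cong₂ (λ u v → u + v) (from-length SA) (cong₂ (λ u v → u * ∑ℕ n eB + v * moment n eB + v * ∑ℕ n eB) moment-δ ∑δ) ⟩
        s′ + (1 * moment n eB + 1 * ∑ℕ n eB) ≡⟨ cong (s′ ℕ.+_) (cong₂ _+_ (trans (ℕ.*-identityˡ _) (from-length SB)) (trans (ℕ.*-identityˡ _) (from-count SB))) ⟩
        s′ + (s₁ + q₁) ∎
    ; total-count = begin
        ∑ℕ M (oriented G) ≡⟨ ∑ℕ-cong M oriented-bridged ⟩
        ∑ℕ M (λ i → (oA i + β i) + (oB i + γ i)) ≡⟨ trans (∑ℕ-+ M (λ i → oA i + β i) (λ i → oB i + γ i)) (cong₂ _+_ (∑ℕ-+ M oA β) (∑ℕ-+ M oB γ)) ⟩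
        (∑ℕ M oA + ∑ℕ M β) + (∑ℕ M oB + ∑ℕ M γ) ≡⟨ cong₂ _+_ (cong₂ _+_ (∑-support oA (ℕ.m≤m+n m n) (oriented-long A)) (∑-bridge m eA eB ℕ.≤-refl (from-long A r) (from-long B s)))
                                                                           (cong₂ _+_ (∑-support oB (ℕ.m≤n+m n m) (oriented-long B)) (∑-bridge n eB eA n+m≤M (from-long B s) (from-long A r))) ⟩
        (pathCount A + ∑ℕ m eA * ∑ℕ n eB) + (pathCount B + ∑ℕ n eB * ∑ℕ m eA)
                                                              ≡⟨ cong₂ _+_ (cong₂ _+_ (total-count SA) (cong₂ _*_ (from-count SA) (from-count SB))) (cong₂ _+_ (total-count SB) (cong₂ _*_ (from-count SB) (from-count SA))) ⟩
        (b + q * q₁) + (b₁ + q₁ * q) ≡⟨ eq b q q₁ b₁ ⟩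
        b + b₁ + 2 * (q * q₁) ∎
    ; total-length = begin
        moment M (oriented G) ≡⟨ ∑ℕ-cong M (λ i → trans (cong (i *_) (oriented-bridged i)) (eq₂ i (oA i) (β i) (oB i) (γ i))) ⟩
        ∑ℕ M (λ i → (i * oA i + i * β i) + (i * oB i + i * γ i)) ≡⟨ trans (∑ℕ-+ M (λ i → i * oA i + i * β i) (λ i → i * oB i + i * γ i)) (cong₂ _+_ (∑ℕ-+ M (λ i → i * oA i) (λ i → i * β i)) (∑ℕ-+ M (λ i → i * oB i) (λ i → i * γ i))) ⟩
        (moment M oA + moment M β) + (moment M oB + moment M γ) ≡⟨ cong₂ _+_ (cong₂ _+_ (moment-support (ℕ.m≤m+n m n) (oriented-long A)) (moment-bridge m eA eB ℕ.≤-refl (from-long A r) (from-long B s)))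
                                                                           (cong₂ _+_ (moment-support (ℕ.m≤n+m n m) (oriented-long B)) (moment-bridge n eB eA n+m≤M (from-long B s) (from-long A r))) ⟩
        (lengthSum A + (moment m eA * ∑ℕ n eB + ∑ℕ m eA * moment n eB + ∑ℕ m eA * ∑ℕ n eB)) + (lengthSum B + (moment n eB * ∑ℕ m eA + ∑ℕ n eB * moment m eA + ∑ℕ n eB * ∑ℕ m eA))
                                                              ≡⟨ cong₂ _+_ (cong₂ _+_ (total-length SA) (form (from-length SA) (from-count SA) (from-length SB) (from-count SB)))
                                                                           (cong₂ _+_ (total-length SB) (form (from-length SB) (from-count SB) (from-length SA) (from-count SA))) ⟩
        (a + (s′ * q₁ + q * s₁ + q * q₁)) + (a₁ + (s₁ * q + q₁ * s′ + q₁ * q)) ≡⟨ eq₃ a s′ q₁ q s₁ a₁ ⟩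
        a + a₁ + 2 * (s′ * q₁ + q * s₁ + q * q₁) ∎
    }
    where
    open ≡-Reasoning
    open HasStats
    M = m + n
    eA = from A r
    eB = from B s
    oA = oriented A
    oB = oriented B
    β γ : ℕ → ℕ
    β i = bridge i eA eB
    γ i = bridge i eB eA
    1+n≤M : 1 + n ≤ M
    1+n≤M = ℕ.+-monoˡ-≤ n (1≤m r)
    n+m≤M : n + m ≤ M
    n+m≤M = ℕ.≤-reflexive (ℕ.+-comm n m)
    form : ∀ {u u′ v v′ w w′ z z′} → u ≡ u′ → v ≡ v′ → w ≡ w′ → z ≡ z′ → u * z + v * w + v * z ≡ u′ * z′ + v′ * w′ + v′ * z′
    form refl refl refl refl = refl
    eq : ∀ b q p c → (b + q * p) + (c + p * q) ≡ b + c + 2 * (q * p)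
    eq = solve-∀
    eq₂ : ∀ i a b c d → i * ((a + b) + (c + d)) ≡ (i * a + i * b) + (i * c + i * d)
    eq₂ = solve-∀
    eq₃ : ∀ a s p q t c → (a + (s * p + q * t + q * p)) + (c + (t * q + p * s + p * q)) ≡ a + c + 2 * (s * p + q * t + q * p)
    eq₃ = solve-∀

-- The join of two rooted graphs and its distance function

module Junction {m n : ℕ} (A : Graph m) (r : Fin m) (B : Graph n) (s : Fin n) where

  J : Fin m ⊎ Fin n → Fin m ⊎ Fin n → Set
  J (inj₁ x) (inj₁ y) = Adj A x y
  J (inj₁ x) (inj₂ y) = x ≡ r × y ≡ s
  J (inj₂ y) (inj₁ x) = x ≡ r × y ≡ s
  J (inj₂ x) (inj₂ y) = Adj B x y

  J? : ∀ u v → Dec (J u v)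
  J? (inj₁ x) (inj₁ y) = adj? A x y
  J? (inj₁ x) (inj₂ y) = (x ≟ r) ×-dec (y ≟ s)
  J? (inj₂ y) (inj₁ x) = (x ≟ r) ×-dec (y ≟ s)
  J? (inj₂ x) (inj₂ y) = adj? B x y

  J-symm : ∀ u v → J u v → J v u
  J-symm (inj₁ x) (inj₁ y) = symm A
  J-symm (inj₁ x) (inj₂ y) = id
  J-symm (inj₂ y) (inj₁ x) = id
  J-symm (inj₂ x) (inj₂ y) = symm B

  J-irrefl : ∀ u → ¬ J u u
  J-irrefl (inj₁ x) = irrefl A refl
  J-irrefl (inj₂ x) = irrefl B refl

graft : (A : Graph m) (r : Fin m) (B : Graph n) (s : Fin n) → Graph (m + n)
graft {m} A r B s = record
  { Adj = λ x y → J (splitAt m x) (splitAt m y)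
  ; adj? = λ x y → J? (splitAt m x) (splitAt m y)
  ; symm = λ {x} {y} → J-symm (splitAt m x) (splitAt m y)
  ; irrefl = λ { {x} refl → J-irrefl (splitAt m x) }
  }
  where open Junction A r B s

module _ (A : Graph m) (r : Fin m) (B : Graph n) (s : Fin n) where
  open Junction A r B s

  graft-bridged : Bridged (graft A r B s) A r B s
  graft-bridged = record
    { f = _↑ˡ n ; g = m ↑ʳ_ ; ∑-fg = ∑-↑ m
    ; f-inj = ↑ˡ-injective n _ _ ; g-inj = ↑ʳ-injective m _ _
    ; f≢g = λ {x} {y} e → case trans (sym (splitAt-↑ˡ m x n)) (trans (cong (splitAt m) e) (splitAt-↑ʳ m n y)) of λ ()
    ; cover = cover
    ; ff = λ {x} {y} → via (splitAt-↑ˡ m x n) (splitAt-↑ˡ m y n)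
    ; gg = λ {x} {y} → via (splitAt-↑ʳ m n x) (splitAt-↑ʳ m n y)
    ; gf = λ {x} {y} → via (splitAt-↑ʳ m n y) (splitAt-↑ˡ m x n)
    ; fg = λ {x} {y} → via (splitAt-↑ˡ m x n) (splitAt-↑ʳ m n y)
    }
    where
    via : ∀ {x y u v} → splitAt m x ≡ u → splitAt m y ≡ v → J (splitAt m x) (splitAt m y) ⇔ J u v
    via refl refl = mk⇔ id id
    cover : ∀ z → (∃[ x ] z ≡ x ↑ˡ n) ⊎ (∃[ y ] z ≡ m ↑ʳ y)
    cover z with splitAt m z in e
    ... | inj₁ x = inj₁ (x , sym (splitAt⁻¹-↑ˡ e))
    ... | inj₂ y = inj₂ (y , sym (splitAt⁻¹-↑ʳ e))

  stats-graft : ∀ {q s′ b a q₁ s₁ b₁ a₁} → HasStats A r q s′ b a → HasStats B s q₁ s₁ b₁ a₁ →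
                HasStats (graft A r B s) (r ↑ˡ n) (q + q₁) (s′ + (s₁ + q₁)) (b + b₁ + 2 * (q * q₁)) (a + a₁ + 2 * (s′ * q₁ + q * s₁ + q * q₁))
  stats-graft = stats-bridged graft-bridged

private
  module JunctionMetric {m n : ℕ} {A : Graph m} (r : Fin m) {B : Graph n} (s : Fin n)
                        {dA : Fin m → Fin m → ℕ} {dB : Fin n → Fin n → ℕ}
                        (MA : TreeMetric A dA) (MB : TreeMetric B dB) where
    open Junction A r B s public
    private
      module A = TreeMetric MA
      module B = TreeMetric MB

    D : Fin m ⊎ Fin n → Fin m ⊎ Fin n → ℕ
    D (inj₁ x) (inj₁ y) = dA x y
    D (inj₁ x) (inj₂ y) = dA x r + suc (dB s y)
    D (inj₂ x) (inj₁ y) = dB x s + suc (dA r y)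
    D (inj₂ x) (inj₂ y) = dB x y

    D-refl : ∀ u → D u u ≡ 0
    D-refl (inj₁ x) = A.d-refl x
    D-refl (inj₂ x) = B.d-refl x

    D-zero : ∀ u v → D u v ≡ 0 → u ≡ v
    D-zero (inj₁ x) (inj₁ y) h = cong inj₁ (A.d-zero x y h)
    D-zero (inj₂ x) (inj₂ y) h = cong inj₂ (B.d-zero x y h)
    D-zero (inj₁ x) (inj₂ y) h = contradiction (trans (sym (ℕ.+-suc (dA x r) _)) h) λ ()
    D-zero (inj₂ x) (inj₁ y) h = contradiction (trans (sym (ℕ.+-suc (dB x s) _)) h) λ ()

    parent₁ : ∀ x v k → D (inj₁ x) v ≡ suc k → ∃[ w ] (J (inj₁ x) w × D w v ≡ k)
    parent₁ x (inj₁ y) k h with A.parent x y k h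
    ... | z , e , h′ = inj₁ z , e , h′
    parent₁ x (inj₂ y) k h with dA x r in e
    ... | zero = inj₂ s , (A.d-zero x r e , refl) , ℕ.suc-injective h
    ... | suc l with A.parent x r l e
    ... | z , xz , h′ = inj₁ z , xz , trans (cong (ℕ._+ suc (dB s y)) h′) (ℕ.suc-injective h)

    edge₁ : ∀ x w v → J (inj₁ x) w → D (inj₁ x) v ≡ suc (D w v) ⊎ D w v ≡ suc (D (inj₁ x) v)
    edge₁ x (inj₁ z) (inj₁ y) e = A.edge x z y e
    edge₁ x (inj₁ z) (inj₂ y) e with A.edge x z r e
    ... | inj₁ h = inj₁ (cong (ℕ._+ suc (dB s y)) h)
    ... | inj₂ h = inj₂ (cong (ℕ._+ suc (dB s y)) h)
    edge₁ x (inj₂ z) (inj₁ y) (refl , refl) = inj₂ (cong (ℕ._+ suc (dA r y)) (B.d-refl s))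
    edge₁ x (inj₂ z) (inj₂ y) (refl , refl) = inj₁ (cong (ℕ._+ suc (dB s y)) (A.d-refl r))

    -- For a target in `A` crossing the bridge leads away from it, for a target in `B` every vertex
    -- of `A` is at least as far as `r`; so a step inside `A` and the step across are never both
    -- improvements.
    mixed : ∀ z v → D (inj₁ r) v ≡ suc (D (inj₁ z) v) → D (inj₁ r) v ≡ suc (D (inj₂ s) v) → ⊥
    mixed z (inj₁ y) h h′ = ℕ.m≢1+n+m _ {1 + dB s s} (trans h′ (cong suc (ℕ.+-suc (dB s s) (dA r y))))
    mixed z (inj₂ y) h h′ = ℕ.m≢1+n+m _ {dA z r} (trans (cong (ℕ._+ suc (dB s y)) (sym (A.d-refl r))) h)

    parents₁ : ∀ x w w′ v → J (inj₁ x) w → J (inj₁ x) w′ → D (inj₁ x) v ≡ suc (D w v) → D (inj₁ x) v ≡ suc (D w′ v) → w ≡ w′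
    parents₁ x (inj₁ z) (inj₁ z′) (inj₁ y) e e′ h h′ = cong inj₁ (A.parents-≡ x z z′ y e e′ h h′)
    parents₁ x (inj₁ z) (inj₁ z′) (inj₂ y) e e′ h h′ = cong inj₁ (A.parents-≡ x z z′ r e e′
      (ℕ.+-cancelʳ-≡ (suc (dB s y)) _ _ h) (ℕ.+-cancelʳ-≡ (suc (dB s y)) _ _ h′))
    parents₁ x (inj₂ z) (inj₂ z′) v (_ , refl) (_ , refl) h h′ = refl
    parents₁ x (inj₁ z) (inj₂ z′) v e (refl , refl) h h′ = ⊥-elim (mixed z v h h′)
    parents₁ x (inj₂ z) (inj₁ z′) v (refl , refl) e′ h h′ = ⊥-elim (mixed z′ v h′ h)

  module _ {m n : ℕ} {A : Graph m} {r : Fin m} {B : Graph n} {s : Fin n}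
           {dA : Fin m → Fin m → ℕ} {dB : Fin n → Fin n → ℕ} (MA : TreeMetric A dA) (MB : TreeMetric B dB) where
    open JunctionMetric r s MA MB
    -- Claims about a vertex of `B` are those about a vertex of `A` with the two trees exchanged.
    private module Flip = JunctionMetric s r MB MA

    private
      D-swap : ∀ u v → Flip.D (Sum.swap u) (Sum.swap v) ≡ D u v
      D-swap (inj₁ _) (inj₁ _) = refl
      D-swap (inj₁ _) (inj₂ _) = refl
      D-swap (inj₂ _) (inj₁ _) = refl
      D-swap (inj₂ _) (inj₂ _) = refl

      J-swap : ∀ u v → J u v → Flip.J (Sum.swap u) (Sum.swap v)
      J-swap (inj₁ _) (inj₁ _) e = e
      J-swap (inj₁ _) (inj₂ _) (p , q) = q , p
      J-swap (inj₂ _) (inj₁ _) (p , q) = q , p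
      J-swap (inj₂ _) (inj₂ _) e = e

      J-swap⁻¹ : ∀ u v → Flip.J (Sum.swap u) v → J u (Sum.swap v)
      J-swap⁻¹ (inj₁ _) (inj₁ _) (p , q) = q , p
      J-swap⁻¹ (inj₁ _) (inj₂ _) e = e
      J-swap⁻¹ (inj₂ _) (inj₁ _) e = e
      J-swap⁻¹ (inj₂ _) (inj₂ _) (p , q) = q , p

      parent : ∀ u v k → D u v ≡ suc k → ∃[ w ] (J u w × D w v ≡ k)
      parent (inj₁ x) v k h = parent₁ x v k h
      parent (inj₂ x) v k h with Flip.parent₁ x (Sum.swap v) k (trans (D-swap (inj₂ x) v) h)
      ... | w , e , h′ = Sum.swap w , J-swap⁻¹ (inj₂ x) w e , trans (sym (trans (cong (λ w → Flip.D w (Sum.swap v)) (sym (swap-swap w))) (D-swap (Sum.swap w) v))) h′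
        where
        swap-swap : ∀ (w : Fin n ⊎ Fin m) → Sum.swap (Sum.swap w) ≡ w
        swap-swap (inj₁ _) = refl
        swap-swap (inj₂ _) = refl

      edge : ∀ u w v → J u w → D u v ≡ suc (D w v) ⊎ D w v ≡ suc (D u v)
      edge (inj₁ x) w v e = edge₁ x w v e
      edge (inj₂ x) w v e = subst₂ (λ a b → a ≡ suc b ⊎ b ≡ suc a) (D-swap (inj₂ x) v) (D-swap w v) (Flip.edge₁ x (Sum.swap w) (Sum.swap v) (J-swap (inj₂ x) w e))

      parents : ∀ u w w′ v → J u w → J u w′ → D u v ≡ suc (D w v) → D u v ≡ suc (D w′ v) → w ≡ w′
      parents (inj₁ x) w w′ v e e′ h h′ = parents₁ x w w′ v e e′ h h′
      parents (inj₂ x) w w′ v e e′ h h′ = swap-inj w w′ (Flip.parents₁ x (Sum.swap w) (Sum.swap w′) (Sum.swap v) (J-swap (inj₂ x) w e) (J-swap (inj₂ x) w′ e′)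
        (trans (D-swap (inj₂ x) v) (trans h (cong suc (sym (D-swap w v))))) (trans (D-swap (inj₂ x) v) (trans h′ (cong suc (sym (D-swap w′ v))))))
        where
        swap-inj : ∀ (w w′ : Fin m ⊎ Fin n) → Sum.swap w ≡ Sum.swap w′ → w ≡ w′
        swap-inj (inj₁ _) (inj₁ _) refl = refl
        swap-inj (inj₂ _) (inj₂ _) refl = refl

      splitAt-injective : ∀ (x y : Fin (m + n)) → splitAt m x ≡ splitAt m y → x ≡ y
      splitAt-injective x y h with splitAt m x in e | splitAt m y in e′
      splitAt-injective x y refl | inj₁ _ | inj₁ _ = trans (sym (splitAt⁻¹-↑ˡ e)) (splitAt⁻¹-↑ˡ e′)
      splitAt-injective x y refl | inj₂ _ | inj₂ _ = trans (sym (splitAt⁻¹-↑ʳ e)) (splitAt⁻¹-↑ʳ e′)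

      vertex : ∀ (w : Fin m ⊎ Fin n) → ∃[ z ] splitAt m z ≡ w
      vertex (inj₁ x) = x ↑ˡ n , splitAt-↑ˡ m x n
      vertex (inj₂ y) = m ↑ʳ y , splitAt-↑ʳ m n y

    metric-graft : TreeMetric (graft A r B s) (λ x y → D (splitAt m x) (splitAt m y))
    metric-graft = record
      { d-refl = λ x → D-refl (splitAt m x)
      ; d-zero = λ x y h → splitAt-injective x y (D-zero _ _ h)
      ; parent = par
      ; edge = λ x z y → edge (splitAt m x) (splitAt m z) (splitAt m y)
      ; parents-≡ = λ x z z′ y e e′ h h′ → splitAt-injective z z′ (parents (splitAt m x) _ _ (splitAt m y) e e′ h h′)
      }
      where
      par : ∀ x y k → D (splitAt m x) (splitAt m y) ≡ suc k →
            ∃[ z ] (J (splitAt m x) (splitAt m z) × D (splitAt m z) (splitAt m y) ≡ k)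
      par x y k h with parent (splitAt m x) (splitAt m y) k h
      ... | w , e , h′ with vertex w
      ... | z , refl = z , e , h′

-- Acyclicity comes from the distance function of the join, without cutting a cycle at the bridge.
tree-graft : {A : Graph m} {B : Graph n} {r : Fin m} {s : Fin n} → IsTree A → IsTree B → IsTree (graft A r B s)
tree-graft {A = A} {B} tA tB = metric⇒IsTree (metric-graft (dist-metric A tA) (dist-metric B tB))
  (ℕ.≤-trans (proj₁ (proj₁ tA)) (ℕ.m≤m+n _ _))

E-≈ : ∀ {G H : Graph n} → G ≈ H → ∀ i w x vis → E G i w x vis ≡ E H i w x vis
E-≈ eq zero w x vis = refl
E-≈ {G = G} {H} eq (suc i) w x vis = trans (E-≈ eq i (step G w) x vis) (E-cong H i λ {x} {vis} _ →
  ∑-cong λ z → when-⇔ (adj? G z x) (adj? H z x) (Equivalence.to (eq z x)) (Equivalence.from (eq z x)))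

oriented-≈ : ∀ {G H : Graph n} → G ≈ H → ∀ i → oriented G i ≡ oriented H i
oriented-≈ eq i = ∑-cong λ y → E-≈ eq i one y []

avp-≈ : ∀ {G H : Graph n} → G ≈ H → avp G ≡ avp H
avp-≈ {zero} eq = refl
avp-≈ {suc n} {G} {H} eq = trans (avp-quotient G z<s) (trans
  (cong₂ (λ a b → quotient a (suc n + b)) (∑ℕ-cong (suc n) λ i → cong (i *_) (oriented-≈ eq i)) (∑ℕ-cong (suc n) (oriented-≈ eq)))
  (sym (avp-quotient H z<s)))

stats-≈ : ∀ {G H : Graph n} {r q s b a} → G ≈ H → HasStats G r q s b a → HasStats H r q s b a
stats-≈ {n} {r = r} eq S = record
  { from-count = trans (∑ℕ-cong n λ i → sym (E-≈ eq i one r [])) from-count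
  ; from-length = trans (∑ℕ-cong n λ i → cong (i *_) (sym (E-≈ eq i one r []))) from-length
  ; total-count = trans (∑ℕ-cong n λ i → sym (oriented-≈ eq i)) total-count
  ; total-length = trans (∑ℕ-cong n λ i → cong (i *_) (sym (oriented-≈ eq i))) total-length
  }
  where open HasStats S

-- Local averages at vertices with at most one neighbour

Pendant : Graph n → Fin n → Set
Pendant G v = ∀ x y → Adj G v x → Adj G v y → x ≡ y

module _ (G : Graph n) (v : Fin n) (pendant : Pendant G v) where
  private
    -- An inner vertex of a path has two distinct neighbours on it.
    at-end : ∀ {i x y vis} → Ext G y [] i x vis → v ∈ (x ∷ vis) → x ≡ v ⊎ y ≡ v
    at-end p (here refl) = inj₁ refl
    at-end (grow e f p) (there h) with at-end p h
    ... | inj₂ h′ = inj₂ h′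
    at-end (grow e f base) (there h) | inj₁ h′ = inj₂ h′
    at-end (grow {x = x} {z = z} e f (grow {x = u} e′ f′ p)) (there h) | inj₁ refl =
      ⊥-elim (f (there (here (pendant z u (symm G e) e′))))

    ends : ∀ {i x y vis} → Ext G y [] (suc i) x vis → 1 when (v ∈? (x ∷ vis)) ≡ at v x vis + 1 when (y ≟ v)
    ends {i} {x} {y} {vis} p@(grow e f p′) = go (x ≟ v) (y ≟ v) (v ∈? (x ∷ vis))
      where
      go : (a : Dec (x ≡ v)) (b : Dec (y ≡ v)) (c : Dec (v ∈ (x ∷ vis))) → 1 when c ≡ 1 when a + 1 when b
      go a b (no ¬c) = trans (when-no (no ¬c) ¬c) (sym (cong₂ _+_ (when-no a λ { refl → ¬c (here refl) }) (when-no b λ { refl → ¬c (Ext-end p) })))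
      go (yes refl) b (yes c) = trans (when-yes (yes c) c) (sym (cong₂ _+_ (when-yes (yes refl) refl) (when-no b λ { refl → f (Ext-end p′) })))
      go (no ¬a) (yes b) (yes c) = trans (when-yes (yes c) c) (sym (cong₂ _+_ (when-no (no ¬a) ¬a) (when-yes (yes b) b)))
      go (no ¬a) (no ¬b) (yes c) = case at-end p c of λ { (inj₁ a) → ⊥-elim (¬a a) ; (inj₂ b) → ⊥-elim (¬b b) }

    through : ∀ i → 2 * from G v (suc i) ≡ orientedAt G v (suc i)
    through i = sym (begin
      orientedAt G v (suc i) ≡⟨ ∑-cong (λ y → E-cong G (suc i) ends) ⟩
      ∑ (λ y → E G (suc i) (λ x vis → at v x vis + 1 when (y ≟ v)) y []) ≡⟨ ∑-cong (λ y → E-+ G (suc i) (at v) (λ _ _ → 1 when (y ≟ v)) y []) ⟩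
      ∑ (λ y → E G (suc i) (at v) y [] + E G (suc i) (λ _ _ → 1 when (y ≟ v)) y []) ≡⟨ ∑-+ _ _ ⟩
      ∑ (λ y → E G (suc i) (at v) y []) + ∑ (λ y → E G (suc i) (λ _ _ → 1 when (y ≟ v)) y [])
                                                                                    ≡⟨ cong₂ _+_ (∑-at G v (suc i)) (trans (∑-cong started) (∑-δ v _)) ⟩
      from G v (suc i) + from G v (suc i) ≡⟨ cong (from G v (suc i) ℕ.+_) (ℕ.+-identityʳ _) ⟨
      2 * from G v (suc i) ∎)
      where
      open ≡-Reasoning
      started : ∀ y → E G (suc i) (λ _ _ → 1 when (y ≟ v)) y [] ≡ from G y (suc i) when (y ≟ v)
      started y = trans (E-scale G (suc i) (1 when (y ≟ v)) y) (trans (ℕ.*-comm (1 when (y ≟ v)) _)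
        (trans (when-* (from G y (suc i)) 1 (y ≟ v)) (cong (_when (y ≟ v)) (ℕ.*-identityʳ (from G y (suc i))))))

  -- A path of positive length through `v` has `v` as exactly one of its two ends, so the unoriented
  -- paths through `v` correspond to those starting at `v`.
  avpAt-pendant : avpAt G v ≡ quotient (moment n (from G v)) (∑ℕ n (from G v))
  avpAt-pendant = trans (avpAt-quotient G v) (trans (sym (average n G v through)) (cong₂ quotient (∑<-sum n (λ i → i * from G v i)) (∑<-sum n (from G v))))
    where
    average : ∀ n (G : Graph n) v → (∀ i → 2 * from G v (suc i) ≡ orientedAt G v (suc i)) →
              averageLength n (from G v) ≡ quotient (∑ℕ n (λ i → i * orientedAt G v i)) (1 + ∑ℕ n (orientedAt G v))
    average (suc n) G v h = averageLength-oriented n 1 (from G v) (orientedAt G v) refl (orientedAt-zero G v) h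

ratio-pendant : ∀ {G : Graph n} {v q s b a} → Pendant G v → HasStats G v q s b a → 0 < q → 0 < a →
                Σ[ nz ∈ ℚ.NonZero (avp G) ] quotient (s * (n + b)) (q * a) ≡ (avpAt G v ℚ.÷ avp G) {{nz}}
ratio-pendant {n} {G} {v} {q} {s} {b} {a} pendant S 0<q 0<a = subst₂ (λ X Y → Σ[ nz ∈ ℚ.NonZero Y ] quotient (s * (n + b)) (q * a) ≡ (X ℚ.÷ Y) {{nz}})
  (sym at≡) (sym avp≡) (quotient-nonZero 0<a 0<n+b , sym (quotient-÷ {q} {a} {n + b} {s} 0<q 0<a 0<n+b {{quotient-nonZero 0<a 0<n+b}}))
  where
  open HasStats S
  0<n : ∀ {n} → Fin n → 0 < n
  0<n {suc _} _ = z<s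
  0<n+b : 0 < n + b
  0<n+b = ℕ.≤-trans (0<n v) (ℕ.m≤m+n n b)
  at≡ : avpAt G v ≡ quotient s q
  at≡ = trans (avpAt-pendant G v pendant) (cong₂ quotient from-length from-count)
  avp≡ : avp G ≡ quotient a (n + b)
  avp≡ = trans (avp-quotient G (0<n v)) (cong₂ (λ a b → quotient a (n + b)) total-length total-count)

-- Rooted graphs with their statistics

record Rooted (𝒞 : ∀ {n} → Graph n → Set) (n q s b a : ℕ) : Set₁ where
  field
    graph : Graph n
    root : Fin n
    inClass : 𝒞 graph
    stats : HasStats graph root q s b a

avp-rooted : ∀ {𝒞 : ∀ {n} → Graph n → Set} {n q s b a} (R : Rooted 𝒞 n q s b a) → avp (Rooted.graph R) ≡ quotient a (n + b)
avp-rooted {n = zero} R = ⊥-elim (case Rooted.root R of λ ())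
avp-rooted {n = suc n} R = trans (avp-quotient graph z<s)
  (cong₂ (λ a b → quotient a (suc n + b)) (HasStats.total-length stats) (HasStats.total-count stats))
  where open Rooted R

vertex-stats : HasStats (star 1) zero 1 0 1 0
vertex-stats = record
  { from-count = trans (∑ℕ-suc 0 e) (cong suc (∑ℕ-0 λ i → e (suc i)))
  ; from-length = trans (∑ℕ-suc 0 (λ i → i * e i)) (∑ℕ-0 λ i → suc i * e (suc i))
  ; total-count = pathCount-metric (star-metric 1)
  ; total-length = lengthSum-star 0
  }
  where
  e = from (star 1) zero

vertex-tree : IsTree (star 1)
vertex-tree = metric⇒IsTree (star-metric 1) z<s

vertexᵀ : Rooted IsTree 1 1 0 1 0
vertexᵀ = record { graph = star 1 ; root = zero ; inClass = vertex-tree ; stats = vertex-stats }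

connected-graft : {A : Graph m} {B : Graph n} {r : Fin m} {s : Fin n} → Connected A → Connected B → Connected (graft A r B s)
connected-graft {m} {n} {A} {B} {r} {s} (1≤m , cA) (_ , cB) = ℕ.≤-trans 1≤m (ℕ.m≤m+n m n) , λ x y → to-root x ◅◅ Star.reverse (symm (graft A r B s)) (to-root y)
  where
  open Bridged (graft-bridged A r B s)
  to-root : ∀ x → Star (Adj (graft A r B s)) x (f r)
  to-root x with cover x
  ... | inj₁ (u , refl) = gmap f (Equivalence.from ff) (cA u r)
  ... | inj₂ (u , refl) = gmap g (Equivalence.from gg) (cB u s) ◅◅ (Equivalence.from gf (refl , refl) ◅ ε)

module _ {𝒞 : ∀ {n} → Graph n → Set}
         (closed : ∀ {m n} {A : Graph m} {B : Graph n} {r s} → 𝒞 A → 𝒞 B → 𝒞 (graft A r B s)) where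

  graftᴿ : ∀ {n q s b a n₁ q₁ s₁ b₁ a₁} → Rooted 𝒞 n q s b a → Rooted 𝒞 n₁ q₁ s₁ b₁ a₁ →
           Rooted 𝒞 (n + n₁) (q + q₁) (s + (s₁ + q₁)) (b + b₁ + 2 * (q * q₁)) (a + a₁ + 2 * (s * q₁ + q * s₁ + q * q₁))
  graftᴿ T U = record
    { graph = graft T.graph T.root U.graph U.root ; root = T.root ↑ˡ _
    ; inClass = closed T.inClass U.inClass
    ; stats = stats-graft T.graph T.root U.graph U.root T.stats U.stats }
    where
    module T = Rooted T
    module U = Rooted U

infixr 6 _⊳_

-- As the statistics are indices, those of a concrete tree written with `_⊳_` are computed by type
-- checking.
_⊳_ : ∀ {n q s b a n₁ q₁ s₁ b₁ a₁} → Rooted IsTree n q s b a → Rooted IsTree n₁ q₁ s₁ b₁ a₁ →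
      Rooted IsTree (n + n₁) (q + q₁) (s + (s₁ + q₁)) (b + b₁ + 2 * (q * q₁)) (a + a₁ + 2 * (s * q₁ + q * s₁ + q * q₁))
_⊳_ = graftᴿ (λ {m} {n} {A} {B} {r} {s} → tree-graft {A = A} {B} {r} {s})

-- The path as an iterated extension

extend : (G : Graph n) → Fin n → Graph (suc n)
extend G r = graft (star 1) zero G r

path-extend : ∀ n → path (suc (suc n)) ≈ extend (path (suc n)) zero
path-extend n zero zero = mk⇔ (λ { (inj₁ ()) ; (inj₂ ()) }) (λ { (f , _) → ⊥-elim (f refl) })
path-extend n zero (suc y) = mk⇔ (λ { (inj₁ h) → refl , toℕ-injective (ℕ.suc-injective h) ; (inj₂ ()) }) (λ { (_ , refl) → inj₁ refl })
path-extend n (suc x) zero = mk⇔ (λ { (inj₂ h) → refl , toℕ-injective (ℕ.suc-injective h) ; (inj₁ ()) }) (λ { (_ , refl) → inj₂ refl })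
path-extend n (suc x) (suc y) = mk⇔ (λ { (inj₁ h) → inj₁ (ℕ.suc-injective h) ; (inj₂ h) → inj₂ (ℕ.suc-injective h) }) (λ { (inj₁ h) → inj₁ (cong suc h) ; (inj₂ h) → inj₂ (cong suc h) })

≈-sym : {G H : Graph n} → G ≈ H → H ≈ G
≈-sym eq x y = mk⇔ (Equivalence.from (eq x y)) (Equivalence.to (eq x y))

path-stats : ∀ n → HasStats (path (suc n)) zero (suc n) (triangular n) (suc n * suc n) (2 * tetrahedral (suc n))
path-stats zero = stats-≈ {G = star 1} {H = path 1} (λ { zero zero → mk⇔ (λ { (f , _) → ⊥-elim (f refl) }) (λ { (inj₁ ()) ; (inj₂ ()) }) }) vertex-stats
path-stats (suc n) = stats-≈ {G = extend (path (suc n)) zero} {H = path (suc (suc n))} (≈-sym {G = path (suc (suc n))} {H = extend (path (suc n)) zero} (path-extend n)) (subst₂ (λ s p → HasStats (extend (path (suc n)) zero) zero (suc (suc n)) s (proj₁ p) (proj₂ p)) (ℕ.+-comm (triangular n) (suc n))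
  (cong₂ _,_ (square n) (eq n (triangular n) (tetrahedral n))) (stats-graft (star 1) zero (path (suc n)) zero vertex-stats (path-stats n)))
  where
  square : ∀ n → 1 + suc n * suc n + 2 * (1 * suc n) ≡ suc (suc n) * suc (suc n)
  square = solve-∀
  eq : ∀ n t h → 0 + 2 * (t + h) + 2 * (0 * suc n + 1 * t + 1 * suc n) ≡ 2 * (suc n + t + (t + h))
  eq = solve-∀

avp-path : ∀ n → avp (path (suc n)) ≡ quotient (2 * tetrahedral (suc n)) (suc n + suc n * suc n)
avp-path n = trans (avp-quotient (path (suc n)) z<s) (cong₂ (λ a b → quotient a (suc n + b)) (HasStats.total-length S) (HasStats.total-count S))
  where S = path-stats n

avp≤path : (T : Graph n) → IsTree T → avp T ℚ.≤ avp (path n)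
avp≤path {zero} T ((() , _) , _)
avp≤path {suc n} T tree = subst₂ ℚ._≤_
  (sym (trans (avp-quotient T z<s) (cong (λ b → quotient (lengthSum T) (suc n + b)) (pathCount-metric (dist-metric T tree)))))
  (sym (avp-path n))
  (quotient-≤ {suc n + suc n * suc n} {suc n + suc n * suc n} {lengthSum T} {2 * tetrahedral (suc n)} z<s z<s
    (ℕ.*-monoˡ-≤ (suc n + suc n * suc n) (lengthSum-tetrahedral (dist-metric T tree) z<s)))

-- Non-isomorphic trees with equal averages

degree-∑ : (G : Graph n) (v : Fin n) → degree G v ≡ ∑ λ x → 1 when adj? G v x
degree-∑ G v = length-filter-allFin (adj? G v)

degree-≅ : {G : Graph m} {H : Graph n} (φ : G ≅ H) (v : Fin m) → degree G v ≡ degree H (Inverse.to (proj₁ φ) v)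
degree-≅ {G = G} {H} (π , eq) v = begin
  degree G v ≡⟨ degree-∑ G v ⟩
  ∑ (λ x → 1 when adj? G v x) ≡⟨ ∑-cong (λ x → when-⇔ (adj? G v x) (adj? H (f v) (f x)) (Equivalence.to (eq v x)) (Equivalence.from (eq v x))) ⟩
  ∑ (λ x → 1 when adj? H (f v) (f x)) ≡⟨ ∑-permute π (λ y → 1 when adj? H (f v) y) ⟨
  ∑ (λ y → 1 when adj? H (f v) y) ≡⟨ degree-∑ H (f v) ⟨
  degree H (f v) ∎
  where
  open ≡-Reasoning
  f = Inverse.to π

same-avp : ∃[ n ] Σ[ T₁ ∈ Graph n ] Σ[ T₂ ∈ Graph n ] IsTree T₁ × IsTree T₂ × ¬ (T₁ ≅ T₂) × avp T₁ ≡ avp T₂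
same-avp = 7 , T₁.graph , T₂.graph , T₁.inClass , T₂.inClass , non-isomorphic ,
  trans (avp-rooted {𝒞 = IsTree} R₁) (sym (avp-rooted {𝒞 = IsTree} R₂))
  where
  v = vertexᵀ
  R₁ : Rooted IsTree 7 7 18 49 92
  -- The spider with legs of 1, 1, 1 and 3 edges; its centre, the vertex `four`, has degree 4.
  R₁ = v ⊳ (v ⊳ (v ⊳ (((v ⊳ v) ⊳ v) ⊳ v)))
  R₂ : Rooted IsTree 7 7 17 49 92
  -- A path on five vertices with a further leaf at its middle vertex and one at a vertex next to
  -- it, so all degrees are at most 3. In both trees the distances of unordered pairs sum to 46.
  R₂ = v ⊳ (v ⊳ ((v ⊳ v) ⊳ ((v ⊳ v) ⊳ v)))
  module T₁ = Rooted R₁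
  module T₂ = Rooted R₂
  four : Fin 7
  four = suc (suc (suc zero))
  degrees : ∀ x → degree T₂.graph x ≢ 4
  degrees = from-yes (all? λ x → ¬? (degree T₂.graph x ℕ.≟ 4))
  non-isomorphic : ¬ (T₁.graph ≅ T₂.graph)
  non-isomorphic φ = degrees (Inverse.to (proj₁ φ) four) (sym (degree-≅ {G = T₁.graph} {T₂.graph} φ four))

-- Contracting an edge

-- The quotient map sends `zero` to `r` and `suc x` to `x`; the only edge at `zero` becomes a loop
-- and disappears.
contract-extend : (G : Graph (suc n)) (r : Fin (suc n)) (e : Adj (extend G r) zero (suc r)) →
                  contract (extend G r) zero (suc r) e ≈ G
contract-extend G r e x y = mk⇔
  (λ { (x≢y , zero , zero , _ , _ , (f , _)) → ⊥-elim (f refl)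
     ; (x≢y , zero , suc b , refl , refl , (_ , refl)) → ⊥-elim (x≢y refl)
     ; (x≢y , suc a , zero , refl , refl , (_ , refl)) → ⊥-elim (x≢y refl)
     ; (x≢y , suc a , suc b , refl , refl , ab) → ab })
  (λ xy → (λ { refl → irrefl G refl xy }) , suc x , suc y , refl , refl , xy)

pathᵀ : ∀ n → Rooted IsTree (suc n) (suc n) (triangular n) (suc n * suc n) (2 * tetrahedral (suc n))
pathᵀ n = record { graph = path (suc n) ; root = zero ; inClass = path-tree n ; stats = path-stats n }
  where
  path-tree : ∀ n → IsTree (path (suc n))
  path-tree zero = (s≤s z≤n , λ { zero zero → ε }) , λ { {k} (zero ∷ zero ∷ _) ((((f ∷ _) ∷ _)) , _) _ → f refl }
  path-tree (suc n) = tree-≈ {G = extend (path (suc n)) zero} {H = path (suc (suc n))}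
    (≈-sym {G = path (suc (suc n))} {H = extend (path (suc n)) zero} (path-extend n)) (tree-graft {A = star 1} {B = path (suc n)} {r = zero} {s = zero} vertex-tree (path-tree n))
    where
    tree-≈ : ∀ {n} {G H : Graph n} → G ≈ H → IsTree G → IsTree H
    tree-≈ eq ((0<n , c) , a) = (0<n , λ x y → Star.map (Equivalence.to (eq _ _)) (c x y)) ,
      λ p (u , l) e → a p (u , Linked.map (Equivalence.from (eq _ _)) l) (Equivalence.from (eq _ _) e)

avp-< : ∀ {𝒞 𝒟 : ∀ {n} → Graph n → Set} {n q s b a n₁ q₁ s₁ b₁ a₁} (R : Rooted 𝒞 n q s b a) (S : Rooted 𝒟 n₁ q₁ s₁ b₁ a₁) →
        a * (n₁ + b₁) < a₁ * (n + b) → avp (Rooted.graph R) ℚ.< avp (Rooted.graph S)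
avp-< {𝒞} {𝒟} {n = n} {b = b} {a} {n₁} {b₁ = b₁} {a₁} R S h = subst₂ ℚ._<_ (sym (avp-rooted {𝒞 = 𝒞} R)) (sym (avp-rooted {𝒞 = 𝒟} S))
  (quotient-< {a = a} {a₁} (positive (Rooted.root R) b) (positive (Rooted.root S) b₁) h)
  where
  positive : ∀ {n} → Fin n → ∀ b → 0 < n + b
  positive {suc n} _ b = z<s

-- Attaching a leaf to the root of S lowers the average, so contracting the new edge raises it again.
contraction-pendant : ∀ {n q s b a} (S : Rooted IsTree (suc n) q s b a) →
                      (a + 2 * (s + q)) * (suc n + b) < a * (suc (suc n) + suc (b + 2 * q)) →
                      Σ[ T ∈ Graph (suc (suc n)) ] Σ[ x ∈ Fin (suc (suc n)) ] Σ[ y ∈ Fin (suc (suc n)) ]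
                      IsTree T × (Σ[ f ∈ Adj T x y ] avp T ℚ.< avp (contract T x y f))
contraction-pendant {n} {q} {s} {b} {a} S h = extend H r , zero , suc r , Rooted.inClass R , (refl , refl) ,
  subst (avp (extend H r) ℚ.<_) (sym (avp-≈ {G = contract (extend H r) zero (suc r) (refl , refl)} {H = H} (contract-extend H r (refl , refl))))
    (avp-< {𝒞 = IsTree} {IsTree} R S (subst₂ (λ u v → u < a * v) (eq a s q (suc n + b)) (eq′ n b q) h))
  where
  H = Rooted.graph S
  r = Rooted.root S
  R = vertexᵀ ⊳ S
  eq : ∀ a s q n → (a + 2 * (s + q)) * n ≡ (0 + a + 2 * (0 * q + 1 * s + 1 * q)) * n
  eq = solve-∀
  eq′ : ∀ n b q → suc (suc n) + suc (b + 2 * q) ≡ suc (suc n) + (1 + b + 2 * (1 * q))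
  eq′ = solve-∀

contraction-increases : ∃[ n ] Σ[ T ∈ Graph (suc n) ] Σ[ a ∈ Fin (suc n) ] Σ[ b ∈ Fin (suc n) ]
                        IsTree T × (Σ[ f ∈ Adj T a b ] avp T ℚ.< avp (contract T a b f))
-- Paths of 7 and 6 vertices joined at their ends form the path of 13 vertices rooted at its middle.
-- A leaf attached there is close to all vertices: 838 / 210 is less than 728 / 182.
contraction-increases = 13 , contraction-pendant {a = 728} (pathᵀ 6 ⊳ pathᵀ 5) (ℕ.≤ᵇ⇒≤ (suc (838 * 182)) (728 * 210) _)

-- Leading terms

-- α K^(d+1) ≤ f ≤ α K^(d+1) + O(K^d) with K = k + 1; α = 0 stands for f = O(K^d).
record Asym (d α : ℕ) (f : ℕ → ℕ) : Set where
  field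
    const : ℕ
    lower : ∀ k → α * suc k ^ suc d ≤ f k
    upper : ∀ k → f k ≤ α * suc k ^ suc d + const * suc k ^ d

open Asym

asym-const : ∀ c → Asym 0 0 (λ _ → c)
asym-const c = record { const = c ; lower = λ _ → z≤n ; upper = λ _ → ℕ.≤-reflexive (sym (ℕ.*-identityʳ c)) }

asym-K : Asym 0 1 suc
asym-K = record { const = 0 ; lower = λ k → ℕ.≤-reflexive (eq k) ; upper = λ k → ℕ.≤-reflexive (sym (trans (ℕ.+-identityʳ _) (eq k))) }
  where
  eq : ∀ k → 1 * (suc k * 1) ≡ suc k
  eq = solve-∀

asym-+ : ∀ {d α f β g} → Asym d α f → Asym d β g → Asym d (α + β) (λ k → f k + g k)
asym-+ {d} {α} {f} {β} {g} F G = record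
  { const = const F + const G
  ; lower = λ k → ℕ.≤-trans (ℕ.≤-reflexive (ℕ.*-distribʳ-+ (suc k ^ suc d) α β)) (ℕ.+-mono-≤ (lower F k) (lower G k))
  ; upper = λ k → ℕ.≤-trans (ℕ.+-mono-≤ (upper F k) (upper G k)) (ℕ.≤-reflexive (eq α β (const F) (const G) (suc k ^ suc d) (suc k ^ d)))
  }
  where
  eq : ∀ α β c e x y → (α * x + c * y) + (β * x + e * y) ≡ (α + β) * x + (c + e) * y
  eq = solve-∀

private
  1≤^ : ∀ k d → 1 ≤ suc k ^ d
  1≤^ k d = ℕ.>-nonZero⁻¹ (suc k ^ d) {{ℕ.m^n≢0 (suc k) d}}

asym-* : ∀ {d α f e β g} → Asym d α f → Asym e β g → Asym (suc (d + e)) (α * β) (λ k → f k * g k)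
asym-* {d} {α} {f} {e} {β} {g} F G = record
  { const = α * const G + const F * β + const F * const G
  ; lower = λ k → ℕ.≤-trans (ℕ.≤-reflexive (trans (cong (α * β *_) (cong (suc k *_) (cong (suc k *_) (ℕ.^-distribˡ-+-* (suc k) d e))))
                    (eq₁ α β (suc k) (suc k ^ d) (suc k ^ e)))) (ℕ.*-mono-≤ (lower F k) (lower G k))
  ; upper = up
  }
  where
  eq₁ : ∀ α β K x y → α * β * (K * (K * (x * y))) ≡ (α * (K * x)) * (β * (K * y))
  eq₁ = solve-∀
  eq₂ : ∀ α β c e k x y → (α * (suc k * x) + c * x) * (β * (suc k * y) + e * y) + c * e * k * (x * y) ≡
        α * β * (suc k * (suc k * (x * y))) + (α * e + c * β + c * e) * (suc k * (x * y))
  eq₂ = solve-∀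
  up : ∀ k → f k * g k ≤ α * β * suc k ^ suc (suc (d + e)) + (α * const G + const F * β + const F * const G) * suc k ^ suc (d + e)
  up k = begin
    f k * g k ≤⟨ ℕ.*-mono-≤ (upper F k) (upper G k) ⟩
    (α * (suc k * u) + const F * u) * (β * (suc k * v) + const G * v) ≤⟨ ℕ.m≤m+n _ _ ⟩
    -- The product of the two error terms is raised by a factor K to the order of the mixed terms,
    -- which turns the estimate into an identity.
    (α * (suc k * u) + const F * u) * (β * (suc k * v) + const G * v) + const F * const G * k * (u * v)
                                                                       ≡⟨ eq₂ α β (const F) (const G) k u v ⟩
    α * β * (suc k * (suc k * (u * v))) + (α * const G + const F * β + const F * const G) * (suc k * (u * v))
                                                                       ≡⟨ cong (λ z → α * β * (suc k * (suc k * z)) + (α * const G + const F * β + const F * const G) * (suc k * z)) (ℕ.^-distribˡ-+-* (suc k) d e) ⟨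
    α * β * suc k ^ suc (suc (d + e)) + (α * const G + const F * β + const F * const G) * suc k ^ suc (d + e) ∎
    where
    open ℕ.≤-Reasoning
    u = suc k ^ d
    v = suc k ^ e

asym-scale : ∀ {d α f} c → Asym d α f → Asym d (c * α) (λ k → c * f k)
asym-scale {d} {α} {f} c F = record
  { const = c * const F
  ; lower = λ k → ℕ.≤-trans (ℕ.≤-reflexive (ℕ.*-assoc c α _)) (ℕ.*-monoʳ-≤ c (lower F k))
  ; upper = λ k → ℕ.≤-trans (ℕ.*-monoʳ-≤ c (upper F k)) (ℕ.≤-reflexive (eq c α (const F) (suc k ^ suc d) (suc k ^ d)))
  }
  where
  eq : ∀ c α e x y → c * (α * x + e * y) ≡ c * α * x + c * e * y
  eq = solve-∀

asym-O : ∀ {d f} → (c : ℕ) → (∀ k → f k ≤ c * suc k ^ d) → Asym d 0 f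
asym-O c h = record { const = c ; lower = λ _ → z≤n ; upper = h }

-- A function of order K^(d+1) disappears in every error term of at least that order, its leading
-- coefficient becoming part of the constant.
asym-raise : ∀ {d α f} e → Asym d α f → Asym (suc (e + d)) 0 f
asym-raise {d} {α} {f} e F = asym-O (α + const F) λ k → ℕ.≤-trans (upper F k) (ℕ.≤-trans
  (ℕ.+-monoʳ-≤ (α * suc k ^ suc d) (ℕ.*-monoʳ-≤ (const F) (ℕ.m≤m+n (suc k ^ d) _)))
  (ℕ.≤-trans (ℕ.≤-reflexive (sym (ℕ.*-distribʳ-+ (suc k ^ suc d) α (const F))))
    (ℕ.*-monoʳ-≤ (α + const F) (ℕ.≤-trans (ℕ.m≤m*n (suc k ^ suc d) (suc k ^ e) {{ℕ.m^n≢0 (suc k) e}})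
      (ℕ.≤-reflexive (trans (sym (ℕ.^-distribˡ-+-* (suc k) (suc d) e)) (cong (suc k ^_) (cong suc (ℕ.+-comm d e)))))))))

asym-≡ : ∀ {d α β f g} → α ≡ β → (∀ k → f k ≡ g k) → Asym d α f → Asym d β g
asym-≡ refl h F = record { const = const F ; lower = λ k → ℕ.≤-trans (lower F k) (ℕ.≤-reflexive (h k)) ; upper = λ k → ℕ.≤-trans (ℕ.≤-reflexive (sym (h k))) (upper F k) }

asym-+0 : ∀ {d α f g} → Asym d α f → Asym d 0 g → Asym d α (λ k → f k + g k)
asym-+0 {α = α} F G = asym-≡ (ℕ.+-identityʳ α) (λ _ → refl) (asym-+ F G)

asym-0+ : ∀ {d α f g} → Asym d 0 f → Asym d α g → Asym d α (λ k → f k + g k)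
asym-0+ F G = asym-+ F G

-- The leading coefficients differ by at least 1, which outweighs the error of `f` as soon as `k`
-- reaches `P * const F`. The explicit threshold allows one `k` to serve several comparisons.
asym-< : ∀ {d α f β g} P Q (F : Asym d α f) → Asym d β g → P * α < Q * β → ∀ k → P * const F ≤ k → P * f k < Q * g k
asym-< {d} {α} {f} {β} {g} P Q F G h k le = begin-strict
  P * f k ≤⟨ ℕ.*-monoʳ-≤ P (upper F k) ⟩
  P * (α * (K * Z) + const F * Z) ≡⟨ eq₁ P α (const F) K Z ⟩
  P * α * (K * Z) + P * const F * Z ≤⟨ ℕ.+-monoʳ-≤ (P * α * (K * Z)) (ℕ.*-monoˡ-≤ Z le) ⟩
  P * α * (K * Z) + k * Z <⟨ ℕ.+-monoʳ-< (P * α * (K * Z)) (ℕ.m<n+m (k * Z) (1≤^ k d)) ⟩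
  P * α * (K * Z) + K * Z ≡⟨ eq₂ (P * α) (K * Z) ⟩
  suc (P * α) * (K * Z) ≤⟨ ℕ.*-monoˡ-≤ (K * Z) h ⟩
  Q * β * (K * Z) ≡⟨ ℕ.*-assoc Q β _ ⟩
  Q * (β * (K * Z)) ≤⟨ ℕ.*-monoʳ-≤ Q (lower G k) ⟩
  Q * g k ∎
  where
  open ℕ.≤-Reasoning
  K = suc k
  Z = K ^ d
  eq₁ : ∀ P α c K Z → P * (α * (K * Z) + c * Z) ≡ P * α * (K * Z) + P * c * Z
  eq₁ = solve-∀
  eq₂ : ∀ a x → a * x + x ≡ suc a * x
  eq₂ = solve-∀

-- Density by sequences of quotients converging to every rational limit

record Limit (S : ℚ → Set₁) (T U : ℕ) : Set₁ where
  field
    {deg lx ly} : ℕ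
    {X Y} : ℕ → ℕ
    X-asym : Asym deg lx X
    Y-asym : Asym deg ly Y
    limit : lx * U ≡ T * ly
    0<ly : 0 < ly
    values : ∀ k → S (quotient (X k) (Y k))

dense-limits : ∀ (S : ℚ → Set₁) c → 0ℚ ℚ.≤ c → (∀ T U → 0 < U → c ℚ.< quotient T U → Limit S T U) → DenseAbove c S
dense-limits S c 0≤c limits p q c≤p p<q
  with nonNegative-quotient p (ℚ.≤-trans 0≤c c≤p) | nonNegative-quotient q (ℚ.≤-trans (ℚ.≤-trans 0≤c c≤p) (ℚ.<⇒≤ p<q))
... | P , Q , 0<Q , refl | R , V , 0<V , refl = quotient (X k₀) (Y k₀) , values k₀ ,
      quotient-< {Q} {Y k₀} {P} {X k₀} 0<Q 0<Y (ℕ.<-≤-trans (asym-< P Q Y-asym X-asym below k₀ (ℕ.m≤m+n _ _)) (ℕ.≤-reflexive (ℕ.*-comm Q (X k₀)))) ,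
      quotient-< {Y k₀} {V} {X k₀} {R} 0<Y 0<V (ℕ.≤-<-trans (ℕ.≤-reflexive (ℕ.*-comm (X k₀) V)) (asym-< V R X-asym Y-asym above k₀ (ℕ.m≤n+m _ _)))
  where
  PV<RQ : P * V < R * Q
  PV<RQ = quotient-<⁻¹ 0<Q 0<V p<q
  -- T / U is the midpoint of p and q.
  T = P * V + R * Q
  U = 2 * (Q * V)
  0<QV : 0 < Q * V
  0<QV = ℕ.*-mono-≤ 0<Q 0<V
  0<U : 0 < U
  0<U = ℕ.*-mono-≤ {1} {2} (s≤s z≤n) 0<QV
  PU<QT : P * U < Q * T
  PU<QT = begin-strict
    P * (2 * (Q * V)) ≡⟨ eq P Q V ⟩
    Q * (P * V + P * V) <⟨ ℕ.*-monoʳ-< Q {{ℕ.>-nonZero 0<Q}} (ℕ.+-monoʳ-< (P * V) PV<RQ) ⟩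
    Q * (P * V + R * Q) ∎
    where
    open ℕ.≤-Reasoning
    eq : ∀ P Q V → P * (2 * (Q * V)) ≡ Q * (P * V + P * V)
    eq = solve-∀
  VT<RU : V * T < R * U
  VT<RU = begin-strict
    V * (P * V + R * Q) <⟨ ℕ.*-monoʳ-< V {{ℕ.>-nonZero 0<V}} (ℕ.+-monoˡ-< (R * Q) PV<RQ) ⟩
    V * (R * Q + R * Q) ≡⟨ eq R Q V ⟩
    R * (2 * (Q * V)) ∎
    where
    open ℕ.≤-Reasoning
    eq : ∀ R Q V → V * (R * Q + R * Q) ≡ R * (2 * (Q * V))
    eq = solve-∀
  target : Limit S T U
  target = limits T U 0<U (ℚ.≤-<-trans c≤p (quotient-< {Q} {U} {P} {T} 0<Q 0<U (ℕ.<-≤-trans PU<QT (ℕ.≤-reflexive (ℕ.*-comm Q T)))))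
  open Limit target
  -- Beyond the thresholds of both comparisons.
  k₀ = P * const Y-asym + V * const X-asym
  0<Y : 0 < Y k₀
  0<Y = ℕ.≤-trans (ℕ.*-mono-≤ 0<ly (1≤^ k₀ (suc deg))) (lower Y-asym k₀)
  cancel : ∀ {a b} → U * a < U * b → a < b
  cancel {a} {b} = ℕ.*-cancelˡ-< U a b
  below : P * ly < Q * lx
  below = cancel (begin-strict
    U * (P * ly) ≡⟨ eq₁ U P ly ⟩
    P * U * ly <⟨ ℕ.*-monoˡ-< ly {{ℕ.>-nonZero 0<ly}} PU<QT ⟩
    Q * T * ly ≡⟨ ℕ.*-assoc Q T ly ⟩
    Q * (T * ly) ≡⟨ cong (Q *_) limit ⟨
    Q * (lx * U) ≡⟨ eq₂ Q lx U ⟩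
    U * (Q * lx) ∎)
    where
    open ℕ.≤-Reasoning
    eq₁ : ∀ U P ly → U * (P * ly) ≡ P * U * ly
    eq₁ = solve-∀
    eq₂ : ∀ Q lx U → Q * (lx * U) ≡ U * (Q * lx)
    eq₂ = solve-∀
  above : V * lx < R * ly
  above = cancel (begin-strict
    U * (V * lx) ≡⟨ eq₁ U V lx ⟩
    V * (lx * U) ≡⟨ cong (V *_) limit ⟩
    V * (T * ly) ≡⟨ ℕ.*-assoc V T ly ⟨
    V * T * ly <⟨ ℕ.*-monoˡ-< ly {{ℕ.>-nonZero 0<ly}} VT<RU ⟩
    R * U * ly ≡⟨ eq₂ R U ly ⟩
    U * (R * ly) ∎)
    where
    open ℕ.≤-Reasoning
    eq₁ : ∀ U V lx → U * (V * lx) ≡ V * (lx * U)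
    eq₁ = solve-∀
    eq₂ : ∀ R U ly → R * U * ly ≡ U * (R * ly)
    eq₂ = solve-∀

-- Prolonging the root by a pendant path

extS : ℕ → ℕ → ℕ → ℕ
extS zero q s = s
extS (suc j) q s = extS j q s + (j + q)

extA : ℕ → ℕ → ℕ → ℕ → ℕ
extA zero q s a = a
extA (suc j) q s a = extA j q s a + 2 * extS (suc j) q s

extB : ℕ → ℕ → ℕ → ℕ
extB zero q b = b
extB (suc j) q b = extB j q b + (1 + 2 * (j + q))

module _ {𝒞 : ∀ {n} → Graph n → Set} (vertex : 𝒞 (star 1))
         (closed : ∀ {m n} {A : Graph m} {B : Graph n} {r s} → 𝒞 A → 𝒞 B → 𝒞 (graft A r B s)) where

  -- Every path from the old root becomes one longer at the new root: `q` gains the trivial path,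
  -- `s` gains `q`, and the totals gain the new paths in both directions.
  extendᴿ : ∀ {n q s b a} → Rooted 𝒞 n q s b a → Rooted 𝒞 (suc n) (suc q) (s + q) (b + (1 + 2 * q)) (a + 2 * (s + q))
  extendᴿ {q = q} {s} {b} {a} R = record
    { graph = extend R.graph R.root ; root = zero ; inClass = closed vertex R.inClass
    ; stats = subst₂ (λ b a → HasStats (extend R.graph R.root) zero (suc q) (s + q) b a) (eq₁ b q) (eq₂ a s q) (stats-graft (star 1) zero R.graph R.root vertex-stats R.stats) }
    where
    module R = Rooted R
    eq₁ : ∀ b q → 1 + b + 2 * (1 * q) ≡ b + (1 + 2 * q)
    eq₁ = solve-∀
    eq₂ : ∀ a s q → 0 + a + 2 * (0 * q + 1 * s + 1 * q) ≡ a + 2 * (s + q)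
    eq₂ = solve-∀

  extensions : ∀ j {n q s b a} → Rooted 𝒞 n q s b a → Rooted 𝒞 (j + n) (j + q) (extS j q s) (extB j q b) (extA j q s a)
  extensions zero R = R
  extensions (suc j) R = extendᴿ (extensions j R)

  extension-pendant : ∀ j {n q s b a} (R : Rooted 𝒞 n q s b a) → Pendant (Rooted.graph (extensions (suc j) R)) (Rooted.root (extensions (suc j) R))
  extension-pendant j R zero y (f , _) _ = ⊥-elim (f refl)
  extension-pendant j R (suc x) zero _ (f , _) = ⊥-elim (f refl)
  extension-pendant j R (suc x) (suc y) (_ , refl) (_ , refl) = refl

  ratio-extension : ∀ j {n q s b a} → Rooted 𝒞 n q s b a → 0 < n → 0 < q →
                    RatioValue 𝒞 (quotient (extS (suc j) q s * (suc j + n + extB (suc j) q b)) ((suc j + q) * extA (suc j) q s a))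
  ratio-extension j {n} {q} {s} {b} {a} R 0<n 0<q = suc (j + n) , E.graph , E.root , s≤s (ℕ.≤-trans 0<n (ℕ.m≤n+m n j)) , E.inClass ,
    ratio-pendant {G = E.graph} {v = E.root} {q = suc (j + q)} (extension-pendant j R) E.stats z<s
      (ℕ.≤-trans (ℕ.≤-trans 0<q (ℕ.≤-trans (ℕ.m≤n+m q j) (ℕ.m≤n+m (j + q) (extS j q s)))) (ℕ.≤-trans (ℕ.m≤n*m (extS (suc j) q s) 2) (ℕ.m≤n+m _ (extA j q s a))))
    where module E = Rooted (extensions (suc j) R)

module _ {d σ κ : ℕ} {q s : ℕ → ℕ} (Q : Asym d κ q) (S : Asym d σ s) (K : ∀ c → Asym d 0 (λ _ → c)) where

  -- Each of the `j` added vertices lengthens nearly all paths from the root by 1, which contributes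
  -- `κ` to the leading coefficient.
  asym-extS : ∀ j → Asym d (σ + j * κ) (λ k → extS j (q k) (s k))
  asym-extS zero = asym-≡ (sym (ℕ.+-identityʳ σ)) (λ _ → refl) S
  asym-extS (suc j) = asym-≡ (eq σ j κ) (λ _ → refl) (asym-+ (asym-extS j) (asym-0+ (K j) Q))
    where
    eq : ∀ σ j κ → σ + j * κ + κ ≡ σ + (κ + j * κ)
    eq = solve-∀

  -- Each extension adds to the total length a linear expression in `q` and `s`, which are of
  -- smaller order than the leading term of `a`.
  asym-extA : ∀ {e α} {a : ℕ → ℕ} → Asym (suc (e + d)) α a → ∀ j → Asym (suc (e + d)) α (λ k → extA j (q k) (s k) (a k))
  asym-extA A zero = A
  asym-extA {e} A (suc j) = asym-+0 (asym-extA {e} A j) (asym-raise e (asym-scale 2 (asym-extS (suc j))))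

  asym-extB : ∀ {e α} {b : ℕ → ℕ} → Asym (suc (e + d)) α b → ∀ j → Asym (suc (e + d)) α (λ k → extB j (q k) (b k))
  asym-extB B zero = B
  asym-extB {e} B (suc j) = asym-+0 (asym-extB {e} B j) (asym-raise e (asym-+ (K 1) (asym-scale 2 (asym-+ (K j) Q))))

-- Spiders and density for trees

pronic : ℕ → ℕ
pronic zero = 0
pronic (suc j) = pronic j + 2 * j

pronic-suc : ∀ j → pronic (suc j) ≡ suc j * j
pronic-suc zero = refl
pronic-suc (suc j) = trans (cong (ℕ._+ 2 * suc j) (pronic-suc j)) (eq j)
  where
  eq : ∀ j → suc j * j + 2 * suc j ≡ suc (suc j) * suc j
  eq = solve-∀

recast : ∀ {𝒞 : ∀ {n} → Graph n → Set} {n q s b a n₁ q₁ s₁ b₁ a₁} → n ≡ n₁ → q ≡ q₁ → s ≡ s₁ → b ≡ b₁ → a ≡ a₁ →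
         Rooted 𝒞 n q s b a → Rooted 𝒞 n₁ q₁ s₁ b₁ a₁
recast refl refl refl refl refl R = R

-- `j` copies of `U` are hung at a central vertex. There are `pronic j`, that is j (j - 1), ordered
-- pairs of different copies, and each contributes `2 * (s + ℓ) * ℓ` to the sum of the distances.
legs : ∀ {ℓ s a} → Rooted IsTree ℓ ℓ s (ℓ * ℓ) a → ∀ j →
       Rooted IsTree (1 + j * ℓ) (1 + j * ℓ) (j * (s + ℓ)) ((1 + j * ℓ) * (1 + j * ℓ)) (j * (a + 2 * (s + ℓ)) + 2 * (s + ℓ) * ℓ * pronic j)
legs {ℓ} {s} {a} U zero = recast {𝒞 = IsTree} refl refl refl refl (sym (ℕ.*-zeroʳ (2 * (s + ℓ) * ℓ))) vertexᵀ
legs {ℓ} {s} {a} U (suc j) = recast {𝒞 = IsTree} (eq₁ j ℓ) (eq₁ j ℓ) (eq₂ j s ℓ) (eq₃ j ℓ) (eq₄ j a s ℓ (pronic j)) (legs U j ⊳ U)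
  where
  eq₁ : ∀ j ℓ → 1 + j * ℓ + ℓ ≡ 1 + (ℓ + j * ℓ)
  eq₁ = solve-∀
  eq₂ : ∀ j s ℓ → j * (s + ℓ) + (s + ℓ) ≡ s + ℓ + j * (s + ℓ)
  eq₂ = solve-∀
  eq₃ : ∀ j ℓ → (1 + j * ℓ) * (1 + j * ℓ) + ℓ * ℓ + 2 * ((1 + j * ℓ) * ℓ) ≡ (1 + (ℓ + j * ℓ)) * (1 + (ℓ + j * ℓ))
  eq₃ = solve-∀
  eq₄ : ∀ j a s ℓ p → j * (a + 2 * (s + ℓ)) + 2 * (s + ℓ) * ℓ * p + a + 2 * (j * (s + ℓ) * ℓ + (1 + j * ℓ) * s + (1 + j * ℓ) * ℓ) ≡
        a + 2 * (s + ℓ) + j * (a + 2 * (s + ℓ)) + 2 * (s + ℓ) * ℓ * (p + 2 * j)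
  eq₄ = solve-∀

-- The spider with k + 2 legs of ℓ vertices, extended at its centre by a path of j + 1 vertices:
-- for k → ∞ the ratio at the end of that path tends to 1/2 + (j + 1) / (ℓ + 1).
module _ (j u : ℕ) where
  private
    ℓ′ ℓ t a₁ : ℕ
    -- A leg with the odd number `2 * u + 1` of vertices has mean distance `suc u` from the centre,
    -- the denominator of the target; `t` is the sum of these distances.
    ℓ′ = 2 * u
    ℓ = suc ℓ′
    t = triangular ℓ′ + ℓ
    a₁ = 2 * tetrahedral ℓ

    q s b a : ℕ → ℕ
    -- With `2 + k` legs, `pronic (2 + k)` is the product of K + 1 and K for K = k + 1.
    q k = 1 + (2 + k) * ℓ
    s k = (2 + k) * t
    b k = q k * q k
    a k = (2 + k) * (a₁ + 2 * t) + 2 * t * ℓ * pronic (2 + k)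

    linear : ∀ c → Asym 0 c (λ k → (2 + k) * c)
    linear c = asym-≡ (ℕ.*-identityʳ c) (λ k → eq c k) (asym-0+ (asym-const c) (asym-scale c asym-K))
      where
      eq : ∀ c k → c + c * suc k ≡ (2 + k) * c
      eq = solve-∀

    q-asym : Asym 0 ℓ q
    q-asym = asym-0+ (asym-const 1) (linear ℓ)

    s-asym : Asym 0 t s
    s-asym = linear t

    b-asym : Asym 1 (ℓ * ℓ) b
    b-asym = asym-* q-asym q-asym

    a-asym : Asym 1 (2 * t * ℓ * 1) a
    a-asym = asym-0+ (asym-raise 0 (linear (a₁ + 2 * t))) (asym-scale (2 * t * ℓ)
      (asym-≡ refl (λ k → sym (pronic-suc (suc k))) (asym-* (asym-0+ (asym-const 1) asym-K) asym-K)))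

    2triangular : ∀ n → 2 * triangular n ≡ n * suc n
    2triangular zero = refl
    2triangular (suc n) = trans (ℕ.*-distribˡ-+ 2 (suc n) (triangular n)) (trans (cong (2 * suc n ℕ.+_) (2triangular n)) (eq n))
      where
      eq : ∀ n → 2 * suc n + n * suc n ≡ suc n * suc (suc n)
      eq = solve-∀

    t≡ : t ≡ ℓ * suc u
    t≡ = ℕ.*-cancelˡ-≡ t (ℓ * suc u) 2 (trans (cong (2 *_) (ℕ.+-comm (triangular ℓ′) ℓ)) (trans (2triangular ℓ) (eq u)))
      where
      eq : ∀ u → suc (2 * u) * suc (suc (2 * u)) ≡ 2 * (suc (2 * u) * suc u)
      eq = solve-∀

  spider-limit : ∀ T → 2 * T ≡ suc u + suc j → Limit (RatioValue IsTree) T (suc u)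
  spider-limit T h = record
    { X-asym = asym-* (asym-extS q-asym s-asym asym-const (suc j))
                      (asym-0+ (asym-raise 0 (asym-0+ (asym-const (suc j)) q-asym)) (asym-extB q-asym s-asym asym-const {e = 0} b-asym (suc j)))
    ; Y-asym = asym-* (asym-0+ (asym-const (suc j)) q-asym) (asym-extA q-asym s-asym asym-const {e = 0} a-asym (suc j))
    ; limit = lim
    ; 0<ly = subst (λ t → 0 < ℓ * (2 * t * ℓ * 1)) (sym t≡) z<s
    ; values = λ k → ratio-extension {𝒞 = IsTree} vertex-tree (λ {m} {n} {A} {B} {r} {s} → tree-graft {A = A} {B} {r} {s}) j
                       (legs (pathᵀ ℓ′) (2 + k)) z<s z<s
    }
    where
    lim : (t + suc j * ℓ) * (ℓ * ℓ) * suc u ≡ T * (ℓ * (2 * t * ℓ * 1))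
    lim = begin
      (t + suc j * ℓ) * (ℓ * ℓ) * suc u ≡⟨ cong (λ t → (t + suc j * ℓ) * (ℓ * ℓ) * suc u) t≡ ⟩
      (ℓ * suc u + suc j * ℓ) * (ℓ * ℓ) * suc u ≡⟨ eq₁ ℓ u j ⟩
      (suc u + suc j) * (ℓ * ℓ * ℓ * suc u) ≡⟨ cong (_* (ℓ * ℓ * ℓ * suc u)) h ⟨
      2 * T * (ℓ * ℓ * ℓ * suc u) ≡⟨ eq₂ T ℓ u ⟩
      T * (ℓ * (2 * (ℓ * suc u) * ℓ * 1)) ≡⟨ cong (λ t → T * (ℓ * (2 * t * ℓ * 1))) t≡ ⟨
      T * (ℓ * (2 * t * ℓ * 1)) ∎
      where
      open ≡-Reasoning
      eq₁ : ∀ ℓ u j → (ℓ * suc u + suc j * ℓ) * (ℓ * ℓ) * suc u ≡ (suc u + suc j) * (ℓ * ℓ * ℓ * suc u)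
      eq₁ = solve-∀
      eq₂ : ∀ T ℓ u → 2 * T * (ℓ * ℓ * ℓ * suc u) ≡ T * (ℓ * (2 * (ℓ * suc u) * ℓ * 1))
      eq₂ = solve-∀

dense-trees : DenseAbove ½ (RatioValue IsTree)
dense-trees = dense-limits (RatioValue IsTree) ½ (ℚ.<⇒≤ (quotient-< {1} {2} {0} {1} z<s z<s z<s)) λ
  { T zero () _
  -- The special leg gets as many vertices as `2 * T` exceeds `suc u`, which is positive because the
  -- target exceeds 1/2.
  ; T (suc u) 0<U h → case ℕ.m≤n⇒∃[o]m+o≡n (quotient-<⁻¹ {2} {suc u} {1} {T} z<s 0<U h) of λ
      { (j , e) → spider-limit j u T (trans (ℕ.*-comm 2 T) (trans (sym e) (eq u j))) } }
  where
  eq : ∀ u j → suc (1 * suc u) + j ≡ suc u + suc j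
  eq = solve-∀

-- Complete bipartite graphs

module Sides {r m : ℕ} where

  Opposite : Fin r ⊎ Fin m → Fin r ⊎ Fin m → Set
  Opposite (inj₁ _) (inj₁ _) = ⊥
  Opposite (inj₁ _) (inj₂ _) = ⊤
  Opposite (inj₂ _) (inj₁ _) = ⊤
  Opposite (inj₂ _) (inj₂ _) = ⊥

  opposite? : ∀ u v → Dec (Opposite u v)
  opposite? (inj₁ _) (inj₁ _) = no id
  opposite? (inj₁ _) (inj₂ _) = yes tt
  opposite? (inj₂ _) (inj₁ _) = yes tt
  opposite? (inj₂ _) (inj₂ _) = no id

  opposite-symm : ∀ u v → Opposite u v → Opposite v u
  opposite-symm (inj₁ _) (inj₂ _) _ = tt
  opposite-symm (inj₂ _) (inj₁ _) _ = tt

  opposite-irrefl : ∀ u → ¬ Opposite u u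
  opposite-irrefl (inj₁ _) ()
  opposite-irrefl (inj₂ _) ()

  left : Fin r ⊎ Fin m → ℕ
  left (inj₁ _) = 1
  left (inj₂ _) = 0

  -- The induction step of the bound by twice the number `c` of left vertices: arriving on the left
  -- raises both sides by 2, leaving it changes neither. The summand for the head makes this exact.
  alternate : ∀ u v → Opposite u v → ∀ {i c} → i + left v ≤ 2 * c → suc i + left u ≤ 2 * (left u + c)
  alternate (inj₁ _) (inj₂ _) _ {i} {c} h = ℕ.≤-trans (ℕ.≤-reflexive (cong suc (ℕ.+-comm i 1))) (ℕ.≤-trans (s≤s (s≤s (subst (_≤ 2 * c) (ℕ.+-identityʳ i) h))) (ℕ.≤-reflexive (sym (ℕ.*-suc 2 c))))
  alternate (inj₂ _) (inj₁ _) _ {i} {c} h = subst (_≤ 2 * c) (trans (ℕ.+-comm i 1) (sym (cong suc (ℕ.+-identityʳ i)))) h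

biclique : ∀ r m → Graph (r + m)
biclique r m = record
  { Adj = λ x y → Opposite (splitAt r x) (splitAt r y)
  ; adj? = λ x y → opposite? (splitAt r x) (splitAt r y)
  ; symm = λ {x} {y} → opposite-symm (splitAt r x) (splitAt r y)
  ; irrefl = λ { {x} refl → opposite-irrefl (splitAt r x) }
  }
  where open Sides

module _ {r m : ℕ} where
  open Sides {r} {m}

  private
    lefts : List (Fin (r + m)) → ℕ
    lefts [] = 0
    lefts (x ∷ L) = left (splitAt r x) + lefts L

    lefts-∑ : ∀ {L} → Distinct L → lefts L ≡ ∑∈ L (λ x → left (splitAt r x))
    lefts-∑ {[]} [] = sym (∑-zero λ x → when-no (x ∈? []) λ ())
    lefts-∑ {x ∷ L} (f ∷ d) = trans (cong (left (splitAt r x) ℕ.+_) (lefts-∑ d)) (sym (∑-∈-∷ f _))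

    lefts-≤ : ∀ {L} → Distinct L → lefts L ≤ r
    lefts-≤ {L} d = begin
      lefts L ≡⟨ lefts-∑ d ⟩
      ∑∈ L (λ x → left (splitAt r x)) ≤⟨ ∑-mono (λ x → when-≤ _ (x ∈? L)) ⟩
      ∑ (λ x → left (splitAt r x)) ≡⟨ ∑-↑ r _ ⟩
      ∑ (λ x → left (splitAt r (x ↑ˡ m))) + ∑ (λ y → left (splitAt r (r ↑ʳ y)))
                                                      ≡⟨ cong₂ _+_ (∑-cong λ x → cong left (splitAt-↑ˡ r x m)) (∑-zero λ y → cong left (splitAt-↑ʳ r m y)) ⟩
      ∑ {r} (λ _ → 1) + 0 ≡⟨ trans (ℕ.+-identityʳ _) (trans (∑-const r 1) (ℕ.*-identityʳ r)) ⟩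
      r ∎
      where open ℕ.≤-Reasoning

    alternating : ∀ {i x y vis} → Ext (biclique r m) y [] i x vis → i + left (splitAt r x) ≤ 2 * lefts (x ∷ vis)
    alternating {y = y} base = ℕ.≤-trans (ℕ.m≤n*m (left (splitAt r y)) 2) (ℕ.*-monoʳ-≤ 2 (ℕ.m≤m+n (left (splitAt r y)) 0))
    alternating (grow {x = x} {z = z} e f p) = alternate (splitAt r z) (splitAt r x) e (alternating p)

  biclique-short : ∀ i → 2 * r < i → oriented (biclique r m) i ≡ 0
  biclique-short i h = ∑-zero λ y → trans (E-cong (biclique r m) i λ p → ⊥-elim (ℕ.<⇒≱ h (bound p))) (E-0 (biclique r m) i y [])
    where
    bound : ∀ {x y vis} → Ext (biclique r m) y [] i x vis → i ≤ 2 * r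
    bound {y = y} p = ℕ.≤-trans (ℕ.m≤m+n i _) (ℕ.≤-trans (alternating p) (ℕ.*-monoʳ-≤ 2 (lefts-≤ (Ext-distinct (single y) p))))

  private
    splitAt-adj : ∀ {x y u v} → splitAt r x ≡ u → splitAt r y ≡ v → Opposite u v → Adj (biclique r m) x y
    splitAt-adj refl refl o = o

  degree-left : ∀ (x : Fin r) → degree (biclique r m) (x ↑ˡ m) ≡ m
  degree-left x = begin
    degree K (x ↑ˡ m) ≡⟨ degree-∑ K (x ↑ˡ m) ⟩
    ∑ (λ z → 1 when adj? K (x ↑ˡ m) z) ≡⟨ ∑-↑ r _ ⟩
    ∑ (λ z → 1 when adj? K (x ↑ˡ m) (z ↑ˡ m)) + ∑ (λ z → 1 when adj? K (x ↑ˡ m) (r ↑ʳ z))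
                                                      ≡⟨ cong₂ _+_ (∑-zero λ z → when-no (adj? K (x ↑ˡ m) (z ↑ˡ m)) (subst₂ (λ u v → ¬ Opposite u v) (sym (splitAt-↑ˡ r x m)) (sym (splitAt-↑ˡ r z m)) id))
                                                                   (∑-cong λ z → when-yes (adj? K (x ↑ˡ m) (r ↑ʳ z)) (splitAt-adj (splitAt-↑ˡ r x m) (splitAt-↑ʳ r m z) tt)) ⟩
    ∑ {m} (λ _ → 1) ≡⟨ trans (∑-const m 1) (ℕ.*-identityʳ m) ⟩
    m ∎
    where
    open ≡-Reasoning
    K = biclique r m

  degree-right : ∀ (y : Fin m) → degree (biclique r m) (r ↑ʳ y) ≡ r
  degree-right y = begin
    degree K (r ↑ʳ y) ≡⟨ degree-∑ K (r ↑ʳ y) ⟩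
    ∑ (λ z → 1 when adj? K (r ↑ʳ y) z) ≡⟨ ∑-↑ r _ ⟩
    ∑ (λ z → 1 when adj? K (r ↑ʳ y) (z ↑ˡ m)) + ∑ (λ z → 1 when adj? K (r ↑ʳ y) (r ↑ʳ z))
                                                      ≡⟨ cong₂ _+_ (∑-cong λ z → when-yes (adj? K (r ↑ʳ y) (z ↑ˡ m)) (splitAt-adj (splitAt-↑ʳ r m y) (splitAt-↑ˡ r z m) tt))
                                                                   (∑-zero λ z → when-no (adj? K (r ↑ʳ y) (r ↑ʳ z)) (subst₂ (λ u v → ¬ Opposite u v) (sym (splitAt-↑ʳ r m y)) (sym (splitAt-↑ʳ r m z)) id)) ⟩
    ∑ {r} (λ _ → 1) + 0 ≡⟨ trans (ℕ.+-identityʳ _) (trans (∑-const r 1) (ℕ.*-identityʳ r)) ⟩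
    r ∎
    where
    open ≡-Reasoning
    K = biclique r m

  side : ∀ z → (∃[ x ] z ≡ x ↑ˡ m) ⊎ (∃[ y ] z ≡ r ↑ʳ y)
  side z with splitAt r z in e
  ... | inj₁ x = inj₁ (x , sym (splitAt⁻¹-↑ˡ e))
  ... | inj₂ y = inj₂ (y , sym (splitAt⁻¹-↑ʳ e))

  biclique-connected : Fin r → Fin m → Connected (biclique r m)
  biclique-connected x₀ y₀ = ℕ.≤-trans (nonempty x₀) (ℕ.m≤m+n r m) , λ x y → to x ◅◅ Star.reverse (λ {x} {y} → symm (biclique r m) {x} {y}) (to y)
    where
    nonempty : ∀ {n} → Fin n → 1 ≤ n
    nonempty {suc _} _ = s≤s z≤n
    to : ∀ z → Star (Adj (biclique r m)) z (r ↑ʳ y₀)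
    to z with side z
    ... | inj₁ (x , refl) = splitAt-adj (splitAt-↑ˡ r x m) (splitAt-↑ʳ r m y₀) tt ◅ ε
    ... | inj₂ (y , refl) = splitAt-adj {y = x₀ ↑ˡ m} (splitAt-↑ʳ r m y) (splitAt-↑ˡ r x₀ m) tt ◅ (splitAt-adj (splitAt-↑ˡ r x₀ m) (splitAt-↑ʳ r m y₀) tt ◅ ε)

lengthSum-≤ : ∀ (G : Graph n) c → (∀ i → c < i → oriented G i ≡ 0) → lengthSum G ≤ c * pathCount G
lengthSum-≤ {n} G c h = ℕ.≤-trans (∑-mono {n} λ i → bound (toℕ i)) (ℕ.≤-reflexive (∑ℕ-* n c (oriented G)))
  where
  bound : ∀ i → i * oriented G i ≤ c * oriented G i
  bound i with i ℕ.≤? c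
  ... | yes le = ℕ.*-monoˡ-≤ (oriented G i) le
  ... | no ¬le = ℕ.≤-reflexive (trans (cong (i *_) e) (trans (ℕ.*-zeroʳ i) (sym (trans (cong (c *_) e) (ℕ.*-zeroʳ c)))))
    where e = h i (ℕ.≰⇒> ¬le)

avp-≤ : ∀ (G : Graph n) c → 0 < n → (∀ i → c < i → oriented G i ≡ 0) → avp G ℚ.≤ quotient c 1
avp-≤ {n} G c 0<n h = subst (ℚ._≤ quotient c 1) (sym (avp-quotient G 0<n))
  (quotient-≤ {n + pathCount G} {1} {lengthSum G} {c} (ℕ.≤-trans 0<n (ℕ.m≤m+n n _)) z<s (begin
    lengthSum G * 1 ≡⟨ ℕ.*-identityʳ (lengthSum G) ⟩
    lengthSum G ≤⟨ lengthSum-≤ G c h ⟩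
    c * pathCount G ≤⟨ ℕ.*-monoʳ-≤ c (ℕ.m≤n+m _ n) ⟩
    c * (n + pathCount G) ∎))
  where open ℕ.≤-Reasoning

-- `m = r + N` gives the left vertices degree at least `r` and the graph order at least `N`. The
-- bound `2 * r` on the path lengths suffices, since the logarithm of an order of at least 2 is at
-- least 1.
small-avp : ∀ r → 3 ≤ r → ∃[ C ] ∀ N → ∃[ n ] Σ[ G ∈ Graph n ]
            N ≤ n × Connected G × (∀ v → r ≤ degree G v) × avp G ℚ.≤ ℤ.+ (C * ⌊log₂ n ⌋) ℚ./ 1
small-avp (suc r′) 3≤r = 2 * r , λ N → let m = r + N in r + m , biclique r m ,
  ℕ.≤-trans (ℕ.m≤n+m N r) (ℕ.m≤n+m m r) , biclique-connected zero zero , degrees N ,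
  ℚ.≤-trans (avp-≤ (biclique r m) (2 * r) z<s (biclique-short {r} {m}))
    (quotient-≤ {1} {1} {2 * r} {2 * r * ⌊log₂ (r + m) ⌋} z<s z<s (ℕ.*-monoˡ-≤ 1 (ℕ.≤-trans (ℕ.≤-reflexive (sym (ℕ.*-identityʳ (2 * r))))
      (ℕ.*-monoʳ-≤ (2 * r) (⌊log₂⌋-mono-≤ {2} {r + m} (ℕ.≤-trans (ℕ.≤-trans (s≤s (s≤s z≤n)) 3≤r) (ℕ.m≤m+n r m)))))))
  where
  r = suc r′
  degrees : ∀ N v → r ≤ degree (biclique r (r + N)) v
  degrees N v with side {r} {r + N} v
  ... | inj₁ (x , refl) = ℕ.≤-trans (ℕ.m≤m+n r N) (ℕ.≤-reflexive (sym (degree-left {r} {r + N} x)))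
  ... | inj₂ (y , refl) = ℕ.≤-reflexive (sym (degree-right {r} {r + N} y))

-- Path counts in K₂,g

module TwoHubs (g′ : ℕ) where
  private
    g : ℕ
    g = suc g′

    Θ : Graph (2 + g)
    Θ = biclique 2 g

    V = Fin (2 + g)

    o : V
    o = zero

    p : V
    p = suc zero

    μ : Fin g → V
    μ j = suc (suc j)

    split : ∀ (f : V → ℕ) → ∑ f ≡ f o + (f p + ∑ λ j → f (μ j))
    split f = trans (∑-suc f) (cong (f o ℕ.+_) (∑-suc λ x → f (suc x)))

    first : ∀ i x vis → E Θ (suc i) one x vis ≡
            (E Θ i one o (x ∷ vis) when fresh? o (x ∷ vis) when adj? Θ o x) +
            ((E Θ i one p (x ∷ vis) when fresh? p (x ∷ vis) when adj? Θ p x) +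
             ∑ λ j → E Θ i one (μ j) (x ∷ vis) when fresh? (μ j) (x ∷ vis) when adj? Θ (μ j) x)
    first i x vis = trans (cong (λ w → w x vis) (E-step Θ i one)) (split _)

    from-o : ∀ i vis → E Θ (suc i) one o vis ≡ ∑ λ j → E Θ i one (μ j) (o ∷ vis) when fresh? (μ j) (o ∷ vis)
    from-o i vis = trans (first i o vis) (cong₂ _+_ (when-no (adj? Θ o o) id) (cong₂ _+_ (when-no (adj? Θ p o) id) (∑-cong λ j → when-yes (adj? Θ (μ j) o) _)))

    from-p : ∀ i vis → E Θ (suc i) one p vis ≡ ∑ λ j → E Θ i one (μ j) (p ∷ vis) when fresh? (μ j) (p ∷ vis)
    from-p i vis = trans (first i p vis) (cong₂ _+_ (when-no (adj? Θ o p) id) (cong₂ _+_ (when-no (adj? Θ p p) id) (∑-cong λ j → when-yes (adj? Θ (μ j) p) _)))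

    from-μ : ∀ i j vis → E Θ (suc i) one (μ j) vis ≡ (E Θ i one o (μ j ∷ vis) when fresh? o (μ j ∷ vis)) + (E Θ i one p (μ j ∷ vis) when fresh? p (μ j ∷ vis))
    from-μ i j vis = trans (first i (μ j) vis) (cong₂ _+_ (when-yes (adj? Θ o (μ j)) _)
      (trans (cong₂ _+_ (when-yes (adj? Θ p (μ j)) _) (∑-zero λ l → when-no (adj? Θ (μ l) (μ j)) id)) (ℕ.+-identityʳ _)))

    -- Numbers of walks of length i from a hub and from a middle vertex. Dropping the freshness test
    -- gives upper bounds, and for the totals the order of magnitude suffices.
    hubs mids : ℕ → ℕ
    hubs zero = 1
    hubs (suc i) = g * mids i
    mids zero = 1
    mids (suc i) = hubs i + hubs i

    o-≤ : ∀ i vis → E Θ i one o vis ≤ hubs i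
    p-≤ : ∀ i vis → E Θ i one p vis ≤ hubs i
    μ-≤ : ∀ i j vis → E Θ i one (μ j) vis ≤ mids i
    o-≤ zero vis = ℕ.≤-refl
    o-≤ (suc i) vis = ℕ.≤-trans (ℕ.≤-reflexive (from-o i vis)) (ℕ.≤-trans (∑-mono λ j → ℕ.≤-trans (when-≤ _ (fresh? (μ j) (o ∷ vis))) (μ-≤ i j (o ∷ vis))) (ℕ.≤-reflexive (∑-const g (mids i))))
    p-≤ zero vis = ℕ.≤-refl
    p-≤ (suc i) vis = ℕ.≤-trans (ℕ.≤-reflexive (from-p i vis)) (ℕ.≤-trans (∑-mono λ j → ℕ.≤-trans (when-≤ _ (fresh? (μ j) (p ∷ vis))) (μ-≤ i j (p ∷ vis))) (ℕ.≤-reflexive (∑-const g (mids i))))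
    μ-≤ zero j vis = ℕ.≤-refl
    μ-≤ (suc i) j vis = ℕ.≤-trans (ℕ.≤-reflexive (from-μ i j vis)) (ℕ.+-mono-≤
      (ℕ.≤-trans (when-≤ _ (fresh? o (μ j ∷ vis))) (o-≤ i (μ j ∷ vis))) (ℕ.≤-trans (when-≤ _ (fresh? p (μ j ∷ vis))) (p-≤ i (μ j ∷ vis))))

    oriented-≤ : ∀ i → oriented Θ i ≤ hubs i + (hubs i + g * mids i)
    oriented-≤ i = ℕ.≤-trans (ℕ.≤-reflexive (split _)) (ℕ.+-mono-≤ (o-≤ i []) (ℕ.+-mono-≤ (p-≤ i [])
      (ℕ.≤-trans (∑-mono λ j → μ-≤ i j []) (ℕ.≤-reflexive (∑-const g (mids i))))))

    ∑ℕ-5 : ∀ f → ∑ℕ 5 f ≡ f 0 + (f 1 + (f 2 + (f 3 + (f 4 + 0))))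
    ∑ℕ-5 f = begin
      ∑ℕ 5 f ≡⟨ ∑ℕ-suc 4 f ⟩
      f 0 + ∑ℕ 4 (λ i → f (1 + i)) ≡⟨ cong (f 0 ℕ.+_) (∑ℕ-suc 3 (λ i → f (1 + i))) ⟩
      f 0 + (f 1 + ∑ℕ 3 (λ i → f (2 + i))) ≡⟨ cong (λ s → f 0 + (f 1 + s)) (∑ℕ-suc 2 (λ i → f (2 + i))) ⟩
      f 0 + (f 1 + (f 2 + ∑ℕ 2 (λ i → f (3 + i)))) ≡⟨ cong (λ s → f 0 + (f 1 + (f 2 + s))) (∑ℕ-suc 1 (λ i → f (3 + i))) ⟩
      f 0 + (f 1 + (f 2 + (f 3 + ∑ℕ 1 (λ i → f (4 + i))))) ≡⟨ cong (λ s → f 0 + (f 1 + (f 2 + (f 3 + s)))) (trans (∑ℕ-suc 0 (λ i → f (4 + i))) (cong (f 4 ℕ.+_) (∑ℕ-0 (λ i → f (5 + i))))) ⟩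
      f 0 + (f 1 + (f 2 + (f 3 + (f 4 + 0)))) ∎
      where open ≡-Reasoning

    -- The sums are compared over the longer range `2 + g + 5`, because either of `2 + g` and 5 can
    -- be the larger.
    truncate : ∀ f → Below 5 f → Below (2 + g) f → ∑ℕ (2 + g) f ≡ ∑ℕ 5 f
    truncate f h₅ h = trans (sym (∑-support f (ℕ.m≤m+n (2 + g) 5) h)) (∑-support f (ℕ.m≤n+m 5 (2 + g)) h₅)

  total-≤ : pathCount Θ ≤ 33 * (g * (g * g))
  total-≤ = begin
    ∑ℕ (2 + g) (oriented Θ) ≡⟨ truncate (oriented Θ) (λ i h → biclique-short {2} {g} i h) (oriented-long Θ) ⟩
    ∑ℕ 5 (oriented Θ) ≤⟨ ∑-mono {5} (λ i → oriented-≤ (toℕ i)) ⟩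
    ∑ℕ 5 F ≡⟨ ∑ℕ-5 F ⟩
    -- The sum is 2 + 9 g + 18 g² + 4 g³, and 33 is the sum of its coefficients; the added
    -- polynomial in `g′` is the difference from 33 g³.
    F 0 + (F 1 + (F 2 + (F 3 + (F 4 + 0)))) ≤⟨ ℕ.m≤m+n _ (42 * g′ + 69 * (g′ * g′) + 29 * (g′ * (g′ * g′))) ⟩
    F 0 + (F 1 + (F 2 + (F 3 + (F 4 + 0)))) + (42 * g′ + 69 * (g′ * g′) + 29 * (g′ * (g′ * g′))) ≡⟨ eq g′ ⟩
    33 * (g * (g * g)) ∎
    where
    open ℕ.≤-Reasoning
    F : ℕ → ℕ
    F i = hubs i + (hubs i + g * mids i)
    eq : ∀ g′ → 1 + (1 + suc g′ * 1) + (suc g′ * 1 + (suc g′ * 1 + suc g′ * (1 + 1)) + (suc g′ * (1 + 1) + (suc g′ * (1 + 1) + suc g′ * (suc g′ * 1 + suc g′ * 1)) +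
         (suc g′ * (suc g′ * 1 + suc g′ * 1) + (suc g′ * (suc g′ * 1 + suc g′ * 1) + suc g′ * (suc g′ * (1 + 1) + suc g′ * (1 + 1))) +
         (suc g′ * (suc g′ * (1 + 1) + suc g′ * (1 + 1)) + (suc g′ * (suc g′ * (1 + 1) + suc g′ * (1 + 1)) + suc g′ * (suc g′ * (suc g′ * 1 + suc g′ * 1) + suc g′ * (suc g′ * 1 + suc g′ * 1))) + 0))))
         + (42 * g′ + 69 * (g′ * g′) + 29 * (g′ * (g′ * g′))) ≡ 33 * (suc g′ * (suc g′ * suc g′))
    eq = solve-∀

  private
    e : ℕ → ℕ
    e = from Θ o

    other : Fin g → List V
    other j = p ∷ μ j ∷ o ∷ []

    μ-fresh : ∀ j → μ j ∉ (o ∷ [])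
    μ-fresh j (here ())

    p-fresh : ∀ j → p ∉ (μ j ∷ o ∷ [])
    p-fresh j (here ())
    p-fresh j (there (here ()))

    e-1 : ∀ i → e (suc i) ≡ ∑ λ j → E Θ i one (μ j) (o ∷ [])
    e-1 i = trans (from-o i []) (∑-cong λ j → when-yes (fresh? (μ j) (o ∷ [])) (μ-fresh j))

    e-2 : ∀ i → e (suc (suc i)) ≡ ∑ λ j → E Θ i one p (μ j ∷ o ∷ [])
    e-2 i = trans (e-1 (suc i)) (∑-cong λ j → trans (from-μ i j (o ∷ [])) (cong₂ _+_
      (when-no (fresh? o (μ j ∷ o ∷ [])) (λ f → f (there (here refl)))) (when-yes (fresh? p (μ j ∷ o ∷ [])) (p-fresh j))))

    e-3 : ∀ i → e (suc (suc (suc i))) ≡ ∑ λ j → ∑ λ l → E Θ i one (μ l) (other j) when fresh? (μ l) (other j)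
    e-3 i = trans (e-2 (suc i)) (∑-cong λ j → from-p i (μ j ∷ o ∷ []))

    -- A path of length 3 from `o` visits a middle vertex, `p` and another middle vertex; both hubs
    -- are then used up and it cannot continue.
    e-4 : ∀ i → e (4 + i) ≡ 0
    e-4 i = trans (e-3 (suc i)) (∑-zero λ j → ∑-zero λ l → trans (cong (_when fresh? (μ l) (other j)) (trans (from-μ i l (other j)) (cong₂ _+_
      (when-no (fresh? o (μ l ∷ other j)) λ f → f (there (there (there (here refl))))) (when-no (fresh? p (μ l ∷ other j)) λ f → f (there (here refl))))))
      (when-0 (fresh? (μ l) (other j))))

    remaining : ∀ j → ∑ (λ l → 1 when fresh? (μ l) (other j)) ≡ g′
    remaining j = ℕ.+-cancelʳ-≡ 3 _ g′ (begin
      ∑ (λ l → 1 when fresh? (μ l) (other j)) + 3 ≡⟨ cong (ℕ._+ 3) (trans (split _) (cong₂ _+_ (when-no (fresh? o (other j)) λ f → f (there (there (here refl))))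
                                                                            (cong (ℕ._+ ∑ (λ l → 1 when fresh? (μ l) (other j))) (when-no (fresh? p (other j)) λ f → f (here refl))))) ⟨
      ∑ (λ z → 1 when fresh? z (other j)) + 3 ≡⟨ count-fresh (p-fresh j ∷ (μ-fresh j ∷ single o)) ⟩
      3 + g′ ≡⟨ ℕ.+-comm 3 g′ ⟩
      g′ + 3 ∎)
      where open ≡-Reasoning

    e₁ : e 1 ≡ g
    e₁ = trans (e-1 0) (trans (∑-const g 1) (ℕ.*-identityʳ g))

    e₂ : e 2 ≡ g
    e₂ = trans (e-2 0) (trans (∑-const g 1) (ℕ.*-identityʳ g))

    e₃ : e 3 ≡ g * g′
    e₃ = trans (e-3 0) (trans (∑-cong remaining) (∑-const g g′))

    e-below : Below 5 e
    e-below (suc (suc (suc (suc (suc i))))) (s≤s (s≤s (s≤s (s≤s (s≤s _))))) = e-4 (suc i)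

  from-count : ∑ℕ (2 + g) e ≡ 1 + g + g * g
  from-count = begin
    ∑ℕ (2 + g) e ≡⟨ truncate e e-below (from-long Θ o) ⟩
    ∑ℕ 5 e ≡⟨ ∑ℕ-5 e ⟩
    1 + (e 1 + (e 2 + (e 3 + (e 4 + 0)))) ≡⟨ cong suc (cong₂ _+_ e₁ (cong₂ _+_ e₂ (cong₂ _+_ e₃ (cong (ℕ._+ 0) (e-4 0))))) ⟩
    1 + (g + (g + (g * g′ + 0))) ≡⟨ eq g′ ⟩
    1 + g + g * g ∎
    where
    open ≡-Reasoning
    eq : ∀ g′ → 1 + (suc g′ + (suc g′ + (suc g′ * g′ + 0))) ≡ 1 + suc g′ + suc g′ * suc g′
    eq = solve-∀

  from-length : moment (2 + g) e ≡ 3 * (g * g)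
  from-length = begin
    moment (2 + g) e ≡⟨ truncate (λ i → i * e i) (λ i h → trans (cong (i *_) (e-below i h)) (ℕ.*-zeroʳ i)) (λ i h → trans (cong (i *_) (from-long Θ o i h)) (ℕ.*-zeroʳ i)) ⟩
    moment 5 e ≡⟨ ∑ℕ-5 (λ i → i * e i) ⟩
    0 + (1 * e 1 + (2 * e 2 + (3 * e 3 + (4 * e 4 + 0)))) ≡⟨ cong₂ _+_ (cong (1 *_) e₁) (cong₂ _+_ (cong (2 *_) e₂) (cong₂ _+_ (cong (3 *_) e₃) (cong (λ a → 4 * a + 0) (e-4 0)))) ⟩
    1 * g + (2 * g + (3 * (g * g′) + 0)) ≡⟨ eq g′ ⟩
    3 * (g * g) ∎
    where
    open ≡-Reasoning
    eq : ∀ g′ → 1 * suc g′ + (2 * suc g′ + (3 * (suc g′ * g′) + 0)) ≡ 3 * (suc g′ * suc g′)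
    eq = solve-∀

  -- The statistics at the root enter the leading terms and are exact; the totals stay unevaluated,
  -- since only their cubic bounds are used.
  hubᴿ : Rooted Connected (2 + g) (1 + g + g * g) (3 * (g * g)) (pathCount Θ) (lengthSum Θ)
  hubᴿ = record { graph = Θ ; root = o ; inClass = biclique-connected {2} {g} zero zero
                ; stats = record { from-count = from-count ; from-length = from-length ; total-count = refl ; total-length = refl } }

  length-≤ : lengthSum Θ ≤ 4 * (33 * (g * (g * g)))
  length-≤ = ℕ.≤-trans (lengthSum-≤ Θ 4 (λ i h → biclique-short {2} {g} i h)) (ℕ.*-monoʳ-≤ 4 total-≤)

-- Density for connected graphs

private
  asym-dominated : ∀ {d} {f h : ℕ → ℕ} → (∀ k → f k ≤ h k) → Asym d 0 h → Asym d 0 f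
  asym-dominated h G = asym-O (Asym.const G) λ k → ℕ.≤-trans (h k) (Asym.upper G k)

Rooted-map : ∀ {n q s b a} → Rooted IsTree n q s b a → Rooted Connected n q s b a
Rooted-map R = record { graph = Rooted.graph R ; root = Rooted.root R ; inClass = proj₁ (Rooted.inClass R) ; stats = Rooted.stats R }

-- K₂,g with g = K², and at one hub h a path of l + 1 edges to the centre of a star with K³ leaves, and a path
-- of j + 1 edges to v. Most paths from v end in K₂,g at distance 3 from h, and most paths of the graph join
-- such an end to a leaf: for K → ∞ the ratio at v tends to (j + 4) / (l + 5).
module _ (j l : ℕ) where
  private
    g N : ℕ → ℕ
    -- The orders satisfy g ≪ N ≪ g². By N ≪ g² most paths from the end vertex finish in K₂,g; the
    -- g² N paths joining it to the star outnumber the O(g³) paths inside K₂,g because g ≪ N, and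
    -- the O(N²) paths of the star because N ≪ g².
    g k = suc k * suc k
    N k = suc k * (suc k * suc k)

    -- The argument is the predecessor of `g k`, by computation.
    module Θ (k : ℕ) = TwoHubs (k + k * suc k)

    qθ sθ bθ aθ q₀ s₀ b₀ a₀ q₁ s₁ b₁ a₁ ν q s b a : ℕ → ℕ
    qθ k = 1 + g k + g k * g k
    sθ k = 3 * (g k * g k)
    bθ k = pathCount (biclique 2 (g k))
    aθ k = lengthSum (biclique 2 (g k))
    q₀ k = 1 + N k * 1
    s₀ k = N k * 1
    b₀ k = q₀ k * q₀ k
    a₀ k = N k * 2 + 2 * pronic (N k)
    q₁ k = l + q₀ k
    s₁ k = extS l (q₀ k) (s₀ k)
    b₁ k = extB l (q₀ k) (b₀ k)
    a₁ k = extA l (q₀ k) (s₀ k) (a₀ k)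
    ν k = 2 + g k + q₁ k
    q k = qθ k + q₁ k
    s k = sθ k + (s₁ k + q₁ k)
    b k = bθ k + b₁ k + 2 * (qθ k * q₁ k)
    a k = aθ k + a₁ k + 2 * (sθ k * q₁ k + qθ k * s₁ k + qθ k * q₁ k)

    closed : ∀ {m n} {A : Graph m} {B : Graph n} {r s} → Connected A → Connected B → Connected (graft A r B s)
    closed {A = A} {B} {r} {s} = connected-graft {A = A} {B} {r} {s}

    family : ∀ k → Rooted Connected (ν k) (q k) (s k) (b k) (a k)
    family k = graftᴿ {𝒞 = Connected} closed (Θ.hubᴿ k)
      (extensions {𝒞 = Connected} (proj₁ vertex-tree) closed l (Rooted-map (legs vertexᵀ (N k))))

    K1 : ∀ c → Asym 0 0 (λ _ → c)
    K1 = asym-const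

    K3 : ∀ c → Asym 2 0 (λ _ → c)
    K3 c = asym-raise 1 (K1 c)

    K4 : ∀ c → Asym 3 0 (λ _ → c)
    K4 c = asym-raise 2 (K1 c)

    g-asym : Asym 1 1 g
    g-asym = asym-* asym-K asym-K

    N-asym : Asym 2 1 N
    N-asym = asym-* asym-K g-asym

    gg-asym : Asym 3 1 (λ k → g k * g k)
    gg-asym = asym-* g-asym g-asym

    ggg-asym : Asym 6 0 (λ k → g k * (g k * g k))
    ggg-asym = asym-raise 0 (asym-* g-asym gg-asym)

    qθ-asym : Asym 3 1 qθ
    qθ-asym = asym-0+ (asym-0+ (K4 1) (asym-raise 1 g-asym)) gg-asym

    sθ-asym : Asym 3 3 sθ
    sθ-asym = asym-scale 3 gg-asym

    bθ-asym : Asym 6 0 bθ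
    bθ-asym = asym-dominated (λ k → Θ.total-≤ k) (asym-scale 33 ggg-asym)

    aθ-asym : Asym 6 0 aθ
    aθ-asym = asym-dominated (λ k → Θ.length-≤ k) (asym-scale 4 (asym-scale 33 ggg-asym))

    s₀-asym : Asym 2 1 s₀
    s₀-asym = asym-≡ refl (λ k → sym (ℕ.*-identityʳ (N k))) N-asym

    q₀-asym : Asym 2 1 q₀
    q₀-asym = asym-0+ (K3 1) s₀-asym

    b₀-asym : Asym 6 0 b₀
    b₀-asym = asym-raise 0 (asym-* q₀-asym q₀-asym)

    pronic-≤ : ∀ j → pronic j ≤ j * j
    pronic-≤ zero = z≤n
    pronic-≤ (suc j) = ℕ.≤-trans (ℕ.≤-reflexive (pronic-suc j)) (ℕ.*-monoʳ-≤ (suc j) (ℕ.n≤1+n j))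

    a₀-asym : Asym 6 0 a₀
    a₀-asym = asym-0+ (asym-≡ refl (λ k → ℕ.*-comm 2 (N k)) (asym-raise 3 (asym-scale 2 N-asym)))
      (asym-dominated (λ k → ℕ.*-monoʳ-≤ 2 (pronic-≤ (N k))) (asym-raise 0 (asym-scale 2 (asym-* N-asym N-asym))))

    q₁-asym : Asym 2 1 q₁
    q₁-asym = asym-0+ (K3 l) q₀-asym

    s₁-asym : Asym 2 (1 + l * 1) s₁
    s₁-asym = asym-extS q₀-asym s₀-asym K3 l

    q-asym : Asym 3 1 q
    q-asym = asym-+0 qθ-asym (asym-raise 0 q₁-asym)

    s-asym : Asym 3 3 s
    s-asym = asym-+0 sθ-asym (asym-raise 0 (asym-+ s₁-asym q₁-asym))

    b-asym : Asym 6 2 b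
    b-asym = asym-0+ (asym-0+ bθ-asym (asym-extB q₀-asym s₀-asym K3 {e = 3} b₀-asym l)) (asym-scale 2 (asym-* qθ-asym q₁-asym))

    a-asym : Asym 6 (2 * (3 * 1 + 1 * (1 + l * 1) + 1 * 1)) a
    a-asym = asym-0+ (asym-0+ aθ-asym (asym-extA q₀-asym s₀-asym K3 {e = 3} a₀-asym l))
      (asym-scale 2 (asym-+ (asym-+ (asym-* sθ-asym q₁-asym) (asym-* qθ-asym s₁-asym)) (asym-* qθ-asym q₁-asym)))

    ν-asym : Asym 6 0 ν
    ν-asym = asym-0+ (asym-raise 4 (asym-0+ (asym-raise 0 (K1 2)) g-asym)) (asym-raise 3 q₁-asym)

  hub-limit : ∀ T U → (4 + j) * U ≡ T * (5 + l) → Limit (RatioValue Connected) T U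
  hub-limit T U h = record
    { X-asym = asym-* (asym-extS q-asym s-asym K4 (suc j))
                      (asym-0+ (asym-0+ (asym-raise 5 (K1 (suc j))) ν-asym) (asym-extB q-asym s-asym K4 {e = 2} b-asym (suc j)))
    ; Y-asym = asym-* (asym-0+ (K4 (suc j)) q-asym) (asym-extA q-asym s-asym K4 {e = 2} a-asym (suc j))
    ; limit = lim
    ; 0<ly = z<s
    ; values = λ k → ratio-extension {𝒞 = Connected} (proj₁ vertex-tree) closed j (family k) z<s z<s
    }
    where
    lim : (3 + suc j * 1) * 2 * U ≡ T * (1 * (2 * (3 * 1 + 1 * (1 + l * 1) + 1 * 1)))
    lim = begin
      (3 + suc j * 1) * 2 * U ≡⟨ eq₁ j U ⟩
      2 * ((4 + j) * U) ≡⟨ cong (2 *_) h ⟩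
      2 * (T * (5 + l)) ≡⟨ eq₂ T l ⟩
      T * (1 * (2 * (3 * 1 + 1 * (1 + l * 1) + 1 * 1))) ∎
      where
      open ≡-Reasoning
      eq₁ : ∀ j U → (3 + suc j * 1) * 2 * U ≡ 2 * ((4 + j) * U)
      eq₁ = solve-∀
      eq₂ : ∀ T l → 2 * (T * (5 + l)) ≡ T * (1 * (2 * (3 * 1 + 1 * (1 + l * 1) + 1 * 1)))
      eq₂ = solve-∀

dense-connected : DenseAbove 0ℚ (RatioValue Connected)
dense-connected = dense-limits (RatioValue Connected) 0ℚ ℚ.≤-refl λ
  { T zero () _
  ; zero (suc u) 0<U h → case quotient-<⁻¹ {1} {suc u} {0} {0} z<s 0<U h of λ ()
  -- The fraction is expanded by 5, so that its numerator is at least 4 and its denominator at least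
  -- 5.
  ; (suc t) (suc u) 0<U h → hub-limit (5 * t + 1) (5 * u) (suc t) (suc u) (eq t u) }
  where
  eq : ∀ t u → (4 + (5 * t + 1)) * suc u ≡ suc t * (5 + 5 * u)
  eq = solve-∀

-- Automorphisms and the complete graph

module _ (G : Graph n) (π : Fin n ↔ Fin n)
         (auto : ∀ x y → Adj G x y ⇔ Adj G (Inverse.to π x) (Inverse.to π y)) where
  private
    f : Fin n → Fin n
    f = Inverse.to π

    f-inj : ∀ {x y} → f x ≡ f y → x ≡ y
    f-inj e = trans (sym (Inverse.strictlyInverseʳ π _)) (trans (cong (Inverse.from π) e) (Inverse.strictlyInverseʳ π _))

    ∈-f : ∀ {x L} → f x ∈ List.map f L → x ∈ L
    ∈-f h with ∈-map⁻ f h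
    ... | _ , h′ , e = subst (_∈ _) (sym (f-inj e)) h′

  E-automorphism : ∀ i w x vis → E G i w (f x) (List.map f vis) ≡ E G i (λ x vis → w (f x) (List.map f vis)) x vis
  E-automorphism zero w x vis = refl
  E-automorphism (suc i) w x vis = trans (E-automorphism i (step G w) x vis) (E-cong G i λ {x} {vis} _ → trans
    (∑-permute π (λ z → w z (f x ∷ List.map f vis) when fresh? z (f x ∷ List.map f vis) when adj? G z (f x)))
    (∑-cong λ z → trans
      (cong (_when adj? G (f z) (f x)) (when-⇔ (fresh? (f z) (f x ∷ List.map f vis)) (fresh? z (x ∷ vis)) (λ φ h → φ (∈-map⁺ f h)) (λ φ h → φ (∈-f h))))
      (when-⇔ (adj? G (f z) (f x)) (adj? G z x) (Equivalence.from (auto z x)) (Equivalence.to (auto z x)))))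

  avpAt-automorphism : ∀ v → avpAt G (f v) ≡ avpAt G v
  avpAt-automorphism v = trans (avpAt-quotient G (f v)) (trans
    (cong₂ (λ a b → quotient a (1 + b)) (∑-cong {n} λ i → cong (toℕ i *_) (same (toℕ i))) (∑-cong {n} λ i → same (toℕ i)))
    (sym (avpAt-quotient G v)))
    where
    same : ∀ i → orientedAt G (f v) i ≡ orientedAt G v i
    same i = trans (∑-permute π λ y → E G i (λ x vis → 1 when (f v ∈? (x ∷ vis))) y []) (∑-cong λ y → trans
      (E-automorphism i (λ x vis → 1 when (f v ∈? (x ∷ vis))) y [])
      (E-cong G i λ {x} {vis} _ → when-⇔ (f v ∈? (f x ∷ List.map f vis)) (v ∈? (x ∷ vis)) ∈-f (∈-map⁺ f)))

complete-connected : ∀ n → Connected (complete (suc n))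
complete-connected n = s≤s z≤n , λ x y → case x ≟ y of λ { (yes refl) → ε ; (no x≢y) → x≢y ◅ ε }

degree-complete : ∀ n → degree (complete (suc n)) zero ≡ n
degree-complete n = trans (degree-∑ K zero) (trans (∑-suc _) (cong₂ _+_ (when-no (adj? K zero zero) (λ f → f refl))
  (trans (∑-cong λ x → when-yes (adj? K zero (suc x)) λ ()) (trans (∑-const n 1) (ℕ.*-identityʳ n)))))
  where K = complete (suc n)

-- In the complete graph transpositions are automorphisms, so all vertices have the same local
-- average and each attains the maximum.
maximum-degree : ∀ d → 1 ≤ d → ∃[ n ] Σ[ G ∈ Graph n ] Σ[ v ∈ Fin n ]
                 Connected G × degree G v ≡ d × (∀ w → avpAt G w ℚ.≤ avpAt G v)
maximum-degree d _ = suc d , K , zero , complete-connected d , degree-complete d , λ w →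
  ℚ.≤-reflexive (avpAt-automorphism K (transpose zero w) (auto w) zero)
  where
  K = complete (suc d)
  auto : ∀ w x y → Adj K x y ⇔ Adj K (Inverse.to (transpose zero w) x) (Inverse.to (transpose zero w) y)
  auto w x y = mk⇔ (λ x≢y e → x≢y (trans (sym (Inverse.strictlyInverseʳ π x)) (trans (cong (Inverse.from π) e) (Inverse.strictlyInverseʳ π y))))
                   (λ ne e → ne (cong (Inverse.to π) e))
    where π = transpose zero w

-- Deleting an edge

remove-added : ∀ (G : Graph n) a b (a≢b : a ≢ b) → ¬ Adj G a b → removeEdge (addEdge G a b a≢b) a b ≈ G
remove-added G a b a≢b ¬ab x y = mk⇔
  (λ { (inj₁ e , _) → e ; (inj₂ s , ¬s) → ⊥-elim (¬s s) })
  (λ e → inj₁ e , λ { (inj₁ (refl , refl)) → ¬ab e ; (inj₂ (refl , refl)) → ¬ab (symm G e) })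

avp-<-≈ : ∀ {n} (G H K : Graph (suc n)) (b a b₁ a₁ : ℕ) → pathCount G ≡ b → lengthSum G ≡ a → pathCount H ≡ b₁ → lengthSum H ≡ a₁ → H ≈ K →
          a * (suc n + b₁) < a₁ * (suc n + b) → avp G ℚ.< avp K
avp-<-≈ {n} G H K b a b₁ a₁ refl refl refl refl eq h = subst₂ ℚ._<_ (sym (avp-quotient G z<s)) (trans (sym (avp-quotient H z<s)) (avp-≈ {G = H} {K} eq))
  (quotient-< {suc n + b} {suc n + b₁} {a} {a₁} z<s z<s h)

-- The hub edge of K₂₄⁺ mostly adds short paths.
private
  K₂₄ K₂₄⁺ : Graph 6
  K₂₄ = biclique 2 4
  K₂₄⁺ = addEdge K₂₄ zero (suc zero) λ ()

  opaque
    -- The four counts are found by running the enumeration, for which the opaque definitions must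
    -- compute.
    unfolding ∑ _when_ fresh?

    counts : pathCount K₂₄⁺ ≡ 192 × lengthSum K₂₄⁺ ≡ 522 × pathCount K₂₄ ≡ 150 × lengthSum K₂₄ ≡ 416
    counts = refl , refl , refl , refl

removal-increases : ∃[ n ] Σ[ G ∈ Graph n ] Σ[ a ∈ Fin n ] Σ[ b ∈ Fin n ]
                    Connected G × Adj G a b × Connected (removeEdge G a b) × avp G ℚ.< avp (removeEdge G a b)
removal-increases = 6 , K₂₄⁺ , zero , suc zero , supergraph , inj₂ (inj₁ (refl , refl)) , same ,
  avp-<-≈ K₂₄⁺ K₂₄ (removeEdge K₂₄⁺ zero (suc zero)) 192 522 150 416 (proj₁ counts) (proj₁ (proj₂ counts)) (proj₁ (proj₂ (proj₂ counts))) (proj₂ (proj₂ (proj₂ counts)))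
    back (ℕ.≤ᵇ⇒≤ (suc (522 * 156)) (416 * 198) _)
  where
  connected : Connected K₂₄
  connected = biclique-connected {2} {4} zero zero
  back : K₂₄ ≈ removeEdge K₂₄⁺ zero (suc zero)
  back = ≈-sym {G = removeEdge K₂₄⁺ zero (suc zero)} {K₂₄} (remove-added K₂₄ zero (suc zero) (λ ()) id)
  supergraph : Connected K₂₄⁺
  supergraph = proj₁ connected , λ x y → Star.map inj₁ (proj₂ connected x y)
  same : Connected (removeEdge K₂₄⁺ zero (suc zero))
  same = proj₁ connected , λ x y → Star.map (λ {x} {y} → Equivalence.to (back x y)) (proj₂ connected x y)

-- Moving a leaf

module MoveLeaf {n : ℕ} (T : Graph n) (d : Fin n → Fin n → ℕ) (M : TreeMetric T d)
                (x w y : Fin n) (xw : Adj T x w) (leaf : ∀ z → Adj T x z → z ≡ w) (wy : Adj T w y) (x≢y : x ≢ y) where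
  open TreeMetric M

  moved : Graph n
  moved = addEdge (removeEdge T x w) x y x≢y

  not-adjacent : ¬ Adj T x y
  not-adjacent xy with leaf y xy
  ... | refl = irrefl T refl wy

  private
    -- The distances once `x` hangs at `y`. Between other vertices nothing changes, since no path
    -- between them uses a leaf.
    pick : ∀ {p q} → Dec (p ≡ x) → Dec (q ≡ x) → ℕ
    pick {p} {q} (yes _) (yes _) = 0
    pick {p} {q} (yes _) (no _) = suc (d y q)
    pick {p} {q} (no _) (yes _) = suc (d p y)
    pick {p} {q} (no _) (no _) = d p q

  opaque
    d′ : Fin n → Fin n → ℕ
    d′ p q = pick (p ≟ x) (q ≟ x)

    d′-xx : d′ x x ≡ 0
    d′-xx with x ≟ x
    ... | yes _ = refl
    ... | no f = ⊥-elim (f refl)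

    d′-x : ∀ {q} → q ≢ x → d′ x q ≡ suc (d y q)
    d′-x {q} q≢x with x ≟ x | q ≟ x
    ... | no f | _ = ⊥-elim (f refl)
    ... | yes _ | yes e = ⊥-elim (q≢x e)
    ... | yes _ | no _ = refl

    d′-to-x : ∀ {p} → p ≢ x → d′ p x ≡ suc (d p y)
    d′-to-x {p} p≢x with p ≟ x | x ≟ x
    ... | _ | no f = ⊥-elim (f refl)
    ... | yes e | yes _ = ⊥-elim (p≢x e)
    ... | no _ | yes _ = refl

    d′-old : ∀ {p q} → p ≢ x → q ≢ x → d′ p q ≡ d p q
    d′-old {p} {q} p≢x q≢x with p ≟ x | q ≟ x
    ... | yes e | _ = ⊥-elim (p≢x e)
    ... | no _ | yes e = ⊥-elim (q≢x e)
    ... | no _ | no _ = refl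

  private
    y≢x : y ≢ x
    y≢x = ≢-sym x≢y

    new-edge : Adj moved x y
    new-edge = inj₂ (inj₁ (refl , refl))

    old-edge : ∀ {p q} → p ≢ x → q ≢ x → Adj T p q → Adj moved p q
    old-edge p≢x q≢x e = inj₁ (e , λ { (inj₁ (h , _)) → p≢x h ; (inj₂ (_ , h)) → q≢x h })

    at-x : ∀ {q} → Adj moved x q → q ≡ y
    at-x (inj₁ (e , f)) = ⊥-elim (f (inj₁ (refl , leaf _ e)))
    at-x (inj₂ (inj₁ (_ , h))) = h
    at-x (inj₂ (inj₂ (h , _))) = ⊥-elim (x≢y h)

    elsewhere : ∀ {p q} → p ≢ x → q ≢ x → Adj moved p q → Adj T p q
    elsewhere p≢x q≢x (inj₁ (e , _)) = e
    elsewhere p≢x q≢x (inj₂ (inj₁ (h , _))) = ⊥-elim (p≢x h)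
    elsewhere p≢x q≢x (inj₂ (inj₂ (_ , h))) = ⊥-elim (q≢x h)

  towards-leaf : ∀ {q} → q ≢ x → d x q ≡ suc (d w q)
  towards-leaf {q} q≢x with d x q in e
  ... | zero = ⊥-elim (q≢x (sym (d-zero x q e)))
  ... | suc k with parent x q k e
  ... | z , xz , h with leaf z xz
  ... | refl = cong suc (sym h)

  private
    -- The leaf `x` is adjacent to `w` alone and lies further than `w` from any other target.
    parent-≢ : ∀ {p z q} → q ≢ x → Adj T p z → d p q ≡ suc (d z q) → z ≢ x
    parent-≢ {p} {q = q} q≢x e h refl with leaf p (symm T e)
    ... | refl = ℕ.m≢1+n+m (d p q) {1} (trans h (cong suc (towards-leaf q≢x)))

  moved-metric : TreeMetric moved d′
  moved-metric = record
    { d-refl = λ p → refl′ p (p ≟ x)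
    ; d-zero = λ p q h → zero′ p q (p ≟ x) (q ≟ x) h
    ; parent = λ p q k h → parent′ p q k (p ≟ x) (q ≟ x) h
    ; edge = λ p z q e → edge′ p z q (p ≟ x) (z ≟ x) (q ≟ x) e
    ; parents-≡ = λ p z z′ q e e′ h h′ → parents′ p z z′ q (p ≟ x) (z ≟ x) (z′ ≟ x) (q ≟ x) e e′ h h′
    }
    where
    refl′ : ∀ p → Dec (p ≡ x) → d′ p p ≡ 0
    refl′ p (yes refl) = d′-xx
    refl′ p (no f) = trans (d′-old f f) (d-refl p)

    zero′ : ∀ p q → Dec (p ≡ x) → Dec (q ≡ x) → d′ p q ≡ 0 → p ≡ q
    zero′ p q (yes refl) (yes refl) h = refl
    zero′ p q (yes refl) (no q≢x) h = contradiction (trans (sym (d′-x q≢x)) h) λ ()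
    zero′ p q (no p≢x) (yes refl) h = contradiction (trans (sym (d′-to-x p≢x)) h) λ ()
    zero′ p q (no p≢x) (no q≢x) h = d-zero p q (trans (sym (d′-old p≢x q≢x)) h)

    parent′ : ∀ p q k → Dec (p ≡ x) → Dec (q ≡ x) → d′ p q ≡ suc k → ∃[ z ] (Adj moved p z × d′ z q ≡ k)
    parent′ p q k (yes refl) (yes refl) h = contradiction (trans (sym d′-xx) h) λ ()
    parent′ p q k (yes refl) (no q≢x) h = y , new-edge , trans (d′-old y≢x q≢x) (ℕ.suc-injective (trans (sym (d′-x q≢x)) h))
    parent′ p q k (no p≢x) (no q≢x) h with parent p q k (trans (sym (d′-old p≢x q≢x)) h)
    ... | z , pz , h′ = z , old-edge p≢x z≢x pz , trans (d′-old z≢x q≢x) h′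
      where z≢x = parent-≢ q≢x pz (trans (trans (sym (d′-old p≢x q≢x)) h) (cong suc (sym h′)))
    parent′ p q zero (no p≢x) (yes refl) h with d-zero p y (ℕ.suc-injective (trans (sym (d′-to-x p≢x)) h))
    ... | refl = x , symm moved new-edge , d′-xx
    parent′ p q (suc k) (no p≢x) (yes refl) h with parent p y k (ℕ.suc-injective (trans (sym (d′-to-x p≢x)) h))
    ... | z , pz , h′ = z , old-edge p≢x z≢x pz , trans (d′-to-x z≢x) (cong suc h′)
      where z≢x = parent-≢ y≢x pz (trans (ℕ.suc-injective (trans (sym (d′-to-x p≢x)) h)) (cong suc (sym h′)))

    edge′ : ∀ p z q → Dec (p ≡ x) → Dec (z ≡ x) → Dec (q ≡ x) → Adj moved p z → d′ p q ≡ suc (d′ z q) ⊎ d′ z q ≡ suc (d′ p q)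
    edge′ p z q (yes refl) _ _ e with at-x e
    edge′ p z q (yes refl) _ (yes refl) e | refl = inj₂ (trans (d′-to-x y≢x) (cong suc (trans (d-refl y) (sym d′-xx))))
    edge′ p z q (yes refl) _ (no q≢x) e | refl = inj₁ (trans (d′-x q≢x) (cong suc (sym (d′-old y≢x q≢x))))
    edge′ p z q (no p≢x) (yes refl) _ e with at-x (symm moved e)
    edge′ p z q (no p≢x) (yes refl) (yes refl) e | refl = inj₁ (trans (d′-to-x y≢x) (cong suc (trans (d-refl y) (sym d′-xx))))
    edge′ p z q (no p≢x) (yes refl) (no q≢x) e | refl = inj₂ (trans (d′-x q≢x) (cong suc (sym (d′-old y≢x q≢x))))
    edge′ p z q (no p≢x) (no z≢x) (yes refl) e with edge p z y (elsewhere p≢x z≢x e)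
    ... | inj₁ h = inj₁ (trans (d′-to-x p≢x) (cong suc (trans h (sym (d′-to-x z≢x)))))
    ... | inj₂ h = inj₂ (trans (d′-to-x z≢x) (cong suc (trans h (sym (d′-to-x p≢x)))))
    edge′ p z q (no p≢x) (no z≢x) (no q≢x) e with edge p z q (elsewhere p≢x z≢x e)
    ... | inj₁ h = inj₁ (trans (d′-old p≢x q≢x) (trans h (cong suc (sym (d′-old z≢x q≢x)))))
    ... | inj₂ h = inj₂ (trans (d′-old z≢x q≢x) (trans h (cong suc (sym (d′-old p≢x q≢x)))))

    -- For the target `x` the only parent of `y` is `x`; for any other target the leaf `x` is
    -- further away than `y`.
    never-x : ∀ z q → Dec (q ≡ x) → z ≢ x → Adj moved y x → d′ y q ≡ suc (d′ x q) → d′ y q ≡ suc (d′ z q) → ⊥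
    never-x z q (yes refl) z≢x e h h′ = contradiction (ℕ.suc-injective (trans (sym (trans (d′-to-x y≢x) (cong suc (d-refl y)))) (trans h′ (cong suc (d′-to-x z≢x))))) λ ()
    never-x z q (no q≢x) z≢x e h h′ = ℕ.m≢1+n+m (d y q) {1} (trans (sym (d′-old y≢x q≢x)) (trans h (cong suc (d′-x q≢x))))

    parents′ : ∀ p z z′ q → Dec (p ≡ x) → Dec (z ≡ x) → Dec (z′ ≡ x) → Dec (q ≡ x) → Adj moved p z → Adj moved p z′ →
               d′ p q ≡ suc (d′ z q) → d′ p q ≡ suc (d′ z′ q) → z ≡ z′
    parents′ p z z′ q (yes refl) _ _ _ e e′ h h′ = trans (at-x e) (sym (at-x e′))
    parents′ p z z′ q (no _) (yes refl) (yes refl) _ e e′ h h′ = refl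
    parents′ p z z′ q (no _) (yes refl) (no z′≢x) Q e e′ h h′ with at-x (symm moved e)
    ... | refl = ⊥-elim (never-x z′ q Q z′≢x e h h′)
    parents′ p z z′ q (no _) (no z≢x) (yes refl) Q e e′ h h′ with at-x (symm moved e′)
    ... | refl = ⊥-elim (never-x z q Q z≢x e′ h′ h)
    parents′ p z z′ q (no p≢x) (no z≢x) (no z′≢x) (yes refl) e e′ h h′ = parents-≡ p z z′ y (elsewhere p≢x z≢x e) (elsewhere p≢x z′≢x e′)
      (ℕ.suc-injective (trans (sym (d′-to-x p≢x)) (trans h (cong suc (d′-to-x z≢x))))) (ℕ.suc-injective (trans (sym (d′-to-x p≢x)) (trans h′ (cong suc (d′-to-x z′≢x)))))
    parents′ p z z′ q (no p≢x) (no z≢x) (no z′≢x) (no q≢x) e e′ h h′ = parents-≡ p z z′ q (elsewhere p≢x z≢x e) (elsewhere p≢x z′≢x e′)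
      (trans (sym (d′-old p≢x q≢x)) (trans h (cong suc (d′-old z≢x q≢x)))) (trans (sym (d′-old p≢x q≢x)) (trans h′ (cong suc (d′-old z′≢x q≢x))))

  -- The sum of the distances from the leaf `x` to all other vertices when it hangs at `c`.
  reach : Fin n → ℕ
  reach c = ∑ λ q → suc (d c q) when ¬? (q ≟ x)

  private
    rest : ℕ
    rest = ∑ λ q → ∑ λ p → d p q when ¬? (p ≟ x) when ¬? (q ≟ x)

    -- Applied to the old distances with `c = w` and to the new ones with `c = y`; `rest` is common
    -- to both, so only the two values of `reach` are compared.
    total : ∀ (D : Fin n → Fin n → ℕ) c → D x x ≡ 0 → (∀ {q} → q ≢ x → D x q ≡ suc (d c q)) → (∀ {p} → p ≢ x → D p x ≡ suc (d p c)) →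
            (∀ {p q} → p ≢ x → q ≢ x → D p q ≡ d p q) → ∑ (λ q → ∑ λ p → D p q) ≡ rest + 2 * reach c
    total D c xx xq px pq = begin
      ∑ (λ q → ∑ λ p → D p q) ≡⟨ ∑-cong (λ q → ∑-cong λ p → cases p q (p ≟ x) (q ≟ x)) ⟩
      ∑ (λ q → ∑ λ p → α p q + (β p q + γ p q)) ≡⟨ trans (∑-cong λ q → trans (∑-+ (λ p → α p q) (λ p → β p q + γ p q)) (cong (∑ (λ p → α p q) ℕ.+_) (∑-+ (λ p → β p q) (λ p → γ p q)))) (trans (∑-+ _ _) (cong (rest ℕ.+_) (∑-+ _ _))) ⟩
      rest + (∑ (λ q → ∑ λ p → β p q) + ∑ (λ q → ∑ λ p → γ p q)) ≡⟨ cong (rest ℕ.+_) (cong₂ _+_ (∑-cong λ q → trans (∑-when (λ p → suc (d c q) when (p ≟ x)) (¬? (q ≟ x))) (cong (_when ¬? (q ≟ x)) (∑-δ x (λ _ → suc (d c q)))))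
                                                     (trans (∑-comm (λ q p → γ p q)) (∑-cong λ p → trans (∑-δ x (λ _ → suc (d p c) when ¬? (p ≟ x))) (cong (λ l → suc l when ¬? (p ≟ x)) (d-sym M p c))))) ⟩
      rest + (reach c + reach c) ≡⟨ cong (λ t → rest + (reach c + t)) (ℕ.+-identityʳ (reach c)) ⟨
      rest + 2 * reach c ∎
      where
      open ≡-Reasoning
      α β γ : Fin n → Fin n → ℕ
      α p q = d p q when ¬? (p ≟ x) when ¬? (q ≟ x)
      β p q = suc (d c q) when (p ≟ x) when ¬? (q ≟ x)
      γ p q = suc (d p c) when ¬? (p ≟ x) when (q ≟ x)
      two : ∀ {P Q : Set} k (a : Dec P) (b : Dec Q) → P → Q → k when a when b ≡ k
      two k a b p q = trans (when-yes b q) (when-yes a p)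
      outer : ∀ {P Q : Set} k (a : Dec P) (b : Dec Q) → ¬ Q → k when a when b ≡ 0
      outer k a b = when-no b
      inner : ∀ {P Q : Set} k (a : Dec P) (b : Dec Q) → ¬ P → k when a when b ≡ 0
      inner k a b ¬p = trans (cong (_when b) (when-no a ¬p)) (when-0 b)
      cases : ∀ p q → Dec (p ≡ x) → Dec (q ≡ x) → D p q ≡ α p q + (β p q + γ p q)
      cases p q (yes refl) (yes refl) = trans xx (sym (cong₂ _+_ (outer (d p q) (¬? (p ≟ x)) (¬? (q ≟ x)) (λ f → f refl))
        (cong₂ _+_ (outer (suc (d c q)) (p ≟ x) (¬? (q ≟ x)) (λ f → f refl)) (inner (suc (d p c)) (¬? (p ≟ x)) (q ≟ x) (λ f → f refl)))))
      cases p q (yes refl) (no q≢x) = trans (trans (xq q≢x) (sym (ℕ.+-identityʳ _))) (sym (cong₂ _+_ (inner (d p q) (¬? (p ≟ x)) (¬? (q ≟ x)) (λ f → f refl))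
        (cong₂ _+_ (two (suc (d c q)) (p ≟ x) (¬? (q ≟ x)) refl q≢x) (outer (suc (d p c)) (¬? (p ≟ x)) (q ≟ x) q≢x))))
      cases p q (no p≢x) (yes refl) = trans (px p≢x) (sym (cong₂ _+_ (outer (d p q) (¬? (p ≟ x)) (¬? (q ≟ x)) (λ f → f refl))
        (cong₂ _+_ (outer (suc (d c q)) (p ≟ x) (¬? (q ≟ x)) (λ f → f refl)) (two (suc (d p c)) (¬? (p ≟ x)) (q ≟ x) p≢x refl))))
      cases p q (no p≢x) (no q≢x) = trans (trans (pq p≢x q≢x) (sym (ℕ.+-identityʳ _))) (sym (cong₂ _+_ (two (d p q) (¬? (p ≟ x)) (¬? (q ≟ x)) p≢x q≢x)
        (cong₂ _+_ (inner (suc (d c q)) (p ≟ x) (¬? (q ≟ x)) p≢x) (outer (suc (d p c)) (¬? (p ≟ x)) (q ≟ x) q≢x))))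

  moved-improves : reach y < reach w → OneAssociate T moved × avp moved ℚ.< avp T
  moved-improves h = (metric⇒IsTree moved-metric 0<n , x , w , x , y , x≢y , xw , not-adjacent ∘ proj₁ , λ p q → mk⇔ id id) ,
    subst₂ ℚ._<_ (sym (avp≡ moved-metric)) (sym (avp≡ M)) (quotient-< {n + n * n} {n + n * n} {∑ λ q → ∑ λ p → d′ p q} {∑ λ q → ∑ λ p → d p q} 0<N 0<N
      (ℕ.*-monoˡ-< (n + n * n) {{ℕ.>-nonZero 0<N}} (subst₂ _<_ (sym (total d′ y d′-xx d′-x d′-to-x d′-old)) (sym (total d w (d-refl x) towards-leaf (λ {p} p≢x → trans (d-sym M p x) (trans (towards-leaf p≢x) (cong suc (d-sym M w p)))) (λ _ _ → refl)))
        (ℕ.+-monoʳ-< rest (ℕ.*-monoʳ-< 2 h)))))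
    where
    0<n : 0 < n
    0<n = ℕ.≤-trans (s≤s z≤n) (Fin.toℕ<n x)
    0<N : 0 < n + n * n
    0<N = ℕ.≤-trans 0<n (ℕ.m≤m+n n _)
    avp≡ : ∀ {G : Graph n} {D} → TreeMetric G D → avp G ≡ quotient (∑ λ q → ∑ λ p → D p q) (n + n * n)
    avp≡ {G} N = trans (avp-quotient G 0<n) (cong₂ (λ a b → quotient a (n + b)) (lengthSum-metric N) (pathCount-metric N))

-- The two sides of an edge of a tree

module EdgeSides {n : ℕ} (T : Graph n) (d : Fin n → Fin n → ℕ) (M : TreeMetric T d) where
  open TreeMetric M

  d-adj : ∀ {p q} → Adj T p q → d p q ≡ 1
  d-adj {p} {q} e with edge p q q e
  ... | inj₁ h = trans h (cong suc (d-refl q))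
  ... | inj₂ h = contradiction (trans (sym (d-refl q)) h) λ ()

  d-two : ∀ a u v → Adj T a u → Adj T u v → a ≢ v → d a v ≡ 2
  d-two a u v au uv a≢v with edge a u v au
  ... | inj₁ h = trans h (cong suc (d-adj uv))
  ... | inj₂ h = ⊥-elim (a≢v (d-zero a v (sym (ℕ.suc-injective (trans (sym (d-adj uv)) h)))))

  edgeʳ : ∀ p q z → Adj T p q → d z p ≡ suc (d z q) ⊎ d z q ≡ suc (d z p)
  edgeʳ p q z e = subst₂ (λ a b → a ≡ suc b ⊎ b ≡ suc a) (d-sym M p z) (d-sym M q z) (edge p q z e)

  Closer : Fin n → Fin n → Fin n → Set
  Closer u v z = d z v ≡ suc (d z u)

  closer? : ∀ u v z → Dec (Closer u v z)
  closer? u v z = d z v ℕ.≟ suc (d z u)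

  size : Fin n → Fin n → ℕ
  size u v = ∑ λ z → 1 when closer? u v z

  module _ (u v : Fin n) (uv : Adj T u v) where

    not-both : ∀ z → Closer u v z → ¬ Closer v u z
    not-both z h h′ = ℕ.m≢1+n+m (d z v) {1} (trans h (cong suc h′))

    -- A path leaving the edge from v through u increases its distance from every vertex on the side of v.
    beyond : ∀ {i p vis q} → Ext T u (v ∷ []) i p vis → Closer v u q →
             d p q ≡ suc i + d v q × (∀ {c L} → vis ≡ c ∷ L → Adj T p c × d p q ≡ suc (d c q))
    beyond {q = q} base h = du , λ { refl → uv , du }
      where
      du : d u q ≡ suc (d v q)
      du = trans (d-sym M u q) (trans h (cong suc (d-sym M q v)))
    beyond {q = q} (grow {x = p} {z = z} {vis = vis} e f ex) h with beyond ex h | edge z p q e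
    ... | hp , t | inj₁ h′ = trans h′ (cong suc hp) , λ { refl → e , h′ }
    beyond {q = q} (grow {x = p} {z = z} {vis = []} e f ex) h | hp , t | inj₂ h′ = contradiction (Ext-length ex) λ l → case trans l (ℕ.+-comm _ 1) of λ ()
    beyond {q = q} (grow {x = p} {z = z} {vis = c ∷ vis} e f ex) h | hp , t | inj₂ h′ =
      ⊥-elim (f (there (here (parents-≡ p z c q (symm T e) (proj₁ (t refl)) h′ (proj₂ (t refl))))))

    -- The path from `p` to `u` avoids `v`, which is further from `p` than `u`; prolonged by the
    -- edge it becomes a path to which `beyond` applies.
    additive : ∀ {p q} → Closer u v p → Closer v u q → d p q ≡ d p v + d v q
    additive {p} {q} hp hq with connecting M (d p u) p u refl
    ... | vis , ex = trans (proj₁ (beyond (Ext-append ex v∉) hq)) (cong (ℕ._+ d v q) (sym hp))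
      where
      v∉ : v ∉ (p ∷ vis)
      v∉ h with Ext-reverse ex
      ... | vis′ , ex′ , _ with Ext-reverse ex′
      ... | vis″ , ex″ , sub with proj₂ (path-unique T (metric⇒IsTree M (ℕ.≤-trans (s≤s z≤n) (Fin.toℕ<n u))) ex″ ex)
      ... | refl = ℕ.<⇒≱ (ℕ.n<1+n (d p u)) (ℕ.≤-trans (ℕ.≤-reflexive (trans (sym hp) (d-sym M p v))) (on-path-≤ M ex′ (sub h)))

    -- The distance 1 of `p` and `q` is the sum of those from `p` to `v` and from `v` to `q`, and
    -- the former is positive; so the edge is `u v` itself.
    leaving : ∀ {p q} → Closer u v p → Adj T p q → ¬ Closer u v q → d p v ≡ 1 × q ≡ v
    leaving {p} {q} hp e ¬hq with edgeʳ u v q uv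
    ... | inj₂ h = ⊥-elim (¬hq h)
    ... | inj₁ h = trans hp (cong suc dpu) , sym (d-zero v q dvq)
      where
      total : suc (d p u + d v q) ≡ 1
      total = trans (cong (ℕ._+ d v q) (sym hp)) (trans (sym (additive hp h)) (d-adj e))
      dpu : d p u ≡ 0
      dpu = ℕ.m+n≡0⇒m≡0 (d p u) (ℕ.suc-injective total)
      dvq : d v q ≡ 0
      dvq = ℕ.m+n≡0⇒n≡0 (d p u) (ℕ.suc-injective total)

argmax : ∀ {n} {P : Fin n → Set} (P? : ∀ x → Dec (P x)) (f : Fin n → ℕ) a → P a →
         ∃[ x ] (P x × f a ≤ f x × (∀ z → P z → f z ≤ f x))
argmax {suc n} {P} P? f a Pa with any? (λ x → P? (suc x))
... | no none = zero , P0 a Pa , le a Pa , le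
  where
  P0 : ∀ a → P a → P zero
  P0 zero p = p
  P0 (suc a) p = ⊥-elim (none (a , p))
  le : ∀ z → P z → f z ≤ f zero
  le zero _ = ℕ.≤-refl
  le (suc z) p = ⊥-elim (none (z , p))
... | yes (b , Pb) with argmax (λ x → P? (suc x)) (λ x → f (suc x)) b Pb
... | x , Px , _ , max with P? zero
... | no ¬P0 = suc x , Px , le a Pa , le
  where
  le : ∀ z → P z → f z ≤ f (suc x)
  le zero p = ⊥-elim (¬P0 p)
  le (suc z) p = max z p
... | yes P0 with ℕ.≤-total (f zero) (f (suc x))
... | inj₁ h = suc x , Px , le a Pa , le
  where
  le : ∀ z → P z → f z ≤ f (suc x)
  le zero p = h
  le (suc z) p = max z p
... | inj₂ h = zero , P0 , le a Pa , le
  where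
  le : ∀ z → P z → f z ≤ f zero
  le zero p = ℕ.≤-refl
  le (suc z) p = ℕ.≤-trans (max z p) h

module _ {n : ℕ} (T : Graph n) (d : Fin n → Fin n → ℕ) (M : TreeMetric T d) where
  open TreeMetric M
  open EdgeSides T d M

  -- A leaf x furthest from v on the smaller side u of the edge u v is moved one step towards v.
  module Improve (u v : Fin n) (uv : Adj T u v) (small : size u v ≤ size v u)
                 (x : Fin n) (Ux : Closer u v x) (maximal : ∀ z → Closer u v z → d z v ≤ d x v)
                 (k : ℕ) (dxv : d x v ≡ suc (suc k))
                 (w : Fin n) (xw : Adj T x w) (dwv : d w v ≡ suc k)
                 (y : Fin n) (wy : Adj T w y) (dyv : d y v ≡ k) where

    -- At distance at least 2 from `v`, `x` is not `u`, the only vertex of its side with a neighbour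
    -- across.
    neighbours-closer : ∀ z → Adj T x z → Closer u v z
    neighbours-closer z xz with closer? u v z
    ... | yes h = h
    ... | no ¬h = contradiction (trans (sym dxv) (proj₁ (leaving u v uv Ux xz ¬h))) λ ()

    -- Another neighbour of `x` would lie on the same side and further from `v`, against the choice
    -- of `x`.
    leaf : ∀ z → Adj T x z → z ≡ w
    leaf z xz with edge x z v xz
    ... | inj₁ h = parents-≡ x z w v xz xw h (trans dxv (cong suc (sym dwv)))
    ... | inj₂ h = ⊥-elim (ℕ.<⇒≱ (ℕ.≤-reflexive (sym h)) (maximal z (neighbours-closer z xz)))

    x≢y : x ≢ y
    x≢y e = ℕ.m≢1+n+m k {1} (trans (sym dyv) (trans (cong (λ z → d z v) (sym e)) dxv))

    open MoveLeaf T d M x w y xw leaf wy x≢y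

    Uw : Closer u v w
    Uw = neighbours-closer w xw

    -- Distances to the other side pass through `v`, to which `y` is one step closer than `w`. The
    -- case `y = v`, where `y` is itself on the other side, is treated apart.
    across : ∀ q → Closer v u q → d w q ≡ suc (d y q)
    across q Vq with closer? u v y
    ... | yes Uy = trans (additive u v uv Uw Vq) (trans (cong (ℕ._+ d v q) (trans dwv (cong suc (sym dyv)))) (cong suc (sym (additive u v uv Uy Vq))))
    ... | no ¬Uy with leaving u v uv Uw wy ¬Uy
    ... | dwv≡1 , y≡v = trans (additive u v uv Uw Vq) (trans (cong (ℕ._+ d v q) dwv≡1) (cong (λ z → suc (d z q)) (sym y≡v)))

    -- Hanging `x` at `y` instead of `w` gains 1 for every vertex on the side of `v` and loses at
    -- most 1 for those on the side of `u`. There is no loss for `x` itself, which `reach` omits;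
    -- this extra 1 makes the result strict even for sides of equal size.
    pointwise : ∀ q → (suc (d y q) when ¬? (q ≟ x)) + (1 when closer? v u q + 1 when (q ≟ x)) ≤ (suc (d w q) when ¬? (q ≟ x)) + 1 when closer? u v q
    pointwise q = go (q ≟ x) (closer? v u q)
      where
      go : Dec (q ≡ x) → Dec (Closer v u q) → (suc (d y q) when ¬? (q ≟ x)) + (1 when closer? v u q + 1 when (q ≟ x)) ≤ (suc (d w q) when ¬? (q ≟ x)) + 1 when closer? u v q
      go (yes refl) _ = ℕ.≤-reflexive (trans
        (cong₂ _+_ (when-no (¬? (q ≟ x)) (λ f → f refl)) (cong₂ _+_ (when-no (closer? v u q) (not-both u v uv q Ux)) (when-yes (q ≟ x) refl)))
        (sym (cong₂ _+_ (when-no (¬? (q ≟ x)) (λ f → f refl)) (when-yes (closer? u v q) Ux))))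
      go (no q≢x) (yes Vq) = ℕ.≤-trans (ℕ.≤-reflexive (trans
        (cong₂ _+_ (when-yes (¬? (q ≟ x)) q≢x) (cong₂ _+_ (when-yes (closer? v u q) Vq) (when-no (q ≟ x) q≢x)))
        (trans (ℕ.+-comm (suc (d y q)) 1) (trans (cong suc (sym (across q Vq))) (sym (when-yes (¬? (q ≟ x)) q≢x)))))) (ℕ.m≤m+n _ _)
      go (no q≢x) (no ¬Vq) with edgeʳ u v q uv
      ... | inj₁ h = ⊥-elim (¬Vq h)
      ... | inj₂ Uq = ℕ.≤-trans (ℕ.≤-reflexive (trans
        (cong₂ _+_ (when-yes (¬? (q ≟ x)) q≢x) (cong₂ _+_ (when-no (closer? v u q) ¬Vq) (when-no (q ≟ x) q≢x))) (ℕ.+-identityʳ _)))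
        (ℕ.≤-trans (s≤s near) (ℕ.≤-reflexive (trans (ℕ.+-comm 1 (suc (d w q))) (sym (cong₂ _+_ (when-yes (¬? (q ≟ x)) q≢x) (when-yes (closer? u v q) Uq))))))
        where
        near : d y q ≤ suc (d w q)
        near with edge w y q wy
        ... | inj₁ h = ℕ.≤-trans (ℕ.≤-trans (ℕ.n≤1+n _) (ℕ.≤-reflexive (sym h))) (ℕ.n≤1+n _)
        ... | inj₂ h = ℕ.≤-reflexive h

    shorter : reach y < reach w
    shorter = ℕ.+-cancelʳ-≤ (size u v) _ _ (begin
      suc (reach y) + size u v ≤⟨ ℕ.+-monoʳ-≤ (suc (reach y)) small ⟩
      suc (reach y) + size v u ≡⟨ trans (cong (ℕ._+ size v u) (ℕ.+-comm 1 (reach y))) (trans (ℕ.+-assoc (reach y) 1 _) (cong (reach y ℕ.+_) (ℕ.+-comm 1 (size v u)))) ⟩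
      reach y + (size v u + 1) ≡⟨ cong (λ t → reach y + (size v u + t)) (∑-δ x (λ _ → 1)) ⟨
      reach y + (size v u + ∑ (λ q → 1 when (q ≟ x))) ≡⟨ trans (∑-+ _ _) (cong (reach y ℕ.+_) (∑-+ _ _)) ⟨
      ∑ (λ q → (suc (d y q) when ¬? (q ≟ x)) + (1 when closer? v u q + 1 when (q ≟ x))) ≤⟨ ∑-mono pointwise ⟩
      ∑ (λ q → (suc (d w q) when ¬? (q ≟ x)) + 1 when closer? u v q) ≡⟨ ∑-+ _ _ ⟩
      reach w + size u v ∎)
      where open ℕ.≤-Reasoning

    improved : Σ[ T′ ∈ Graph n ] OneAssociate T T′ × avp T′ ℚ.< avp T
    improved = moved , moved-improves shorter

  -- The second neighbour `a` of `u` ensures that the furthest vertex on its side is at distance at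
  -- least 2 from `v`, so that `w` and `y` exist.
  improve : ∀ a u v → Adj T a u → Adj T u v → a ≢ v → size u v ≤ size v u →
            Σ[ T′ ∈ Graph n ] OneAssociate T T′ × avp T′ ℚ.< avp T
  improve a u v au uv a≢v small with argmax (closer? u v) (λ z → d z v) a (trans (d-two a u v au uv a≢v) (cong suc (sym (d-adj au))))
  ... | x , Ux , far , maximal with split (subst (_≤ d x v) (d-two a u v au uv a≢v) far)
    where
    split : ∀ {m} → 2 ≤ m → ∃[ k ] m ≡ suc (suc k)
    split (s≤s (s≤s {n = k} _)) = k , refl
  ... | k , dxv with parent x v (suc k) dxv
  ... | w , xw , dwv with parent w v k dwv
  ... | y , wy , dyv = Improve.improved u v uv small x Ux maximal k dxv w xw dwv y wy dyv

  improve-edge : ∀ a u v b → Adj T a u → Adj T u v → Adj T v b → a ≢ v → u ≢ b →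
                 Σ[ T′ ∈ Graph n ] OneAssociate T T′ × avp T′ ℚ.< avp T
  improve-edge a u v b au uv vb a≢v u≢b with ℕ.≤-total (size u v) (size v u)
  ... | inj₁ le = improve a u v au uv a≢v le
  ... | inj₂ le = improve b v u (symm T vb) (symm T uv) (≢-sym u≢b) le

-- Recognising stars

module _ {n : ℕ} (T : Graph (suc n)) (d : Fin (suc n) → Fin (suc n) → ℕ) (M : TreeMetric T d) where
  open TreeMetric M
  open EdgeSides T d M

  centre⇒star : ∀ c → (∀ x → x ≡ c ⊎ Adj T c x) → T ≅ star (suc n)
  centre⇒star c hub = transpose c zero , λ x y → mk⇔ (to x y) (back x y)
    where
    π = transpose c zero
    f : Fin (suc n) → Fin (suc n)
    f = Inverse.to π
    f-inj : ∀ {x y} → f x ≡ f y → x ≡ y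
    f-inj {x} {y} e = trans (sym (Inverse.strictlyInverseʳ π x)) (trans (cong (Inverse.from π) e) (Inverse.strictlyInverseʳ π y))
    f-c : f c ≡ zero
    f-c with c ≟ c
    ... | yes _ = refl
    ... | no h = ⊥-elim (h refl)
    centre : ∀ x → toℕ (f x) ≡ 0 → x ≡ c
    centre x h = f-inj (trans (toℕ-injective h) (sym f-c))
    no-triangle : ∀ {x y} → Adj T c x → Adj T c y → ¬ Adj T x y
    no-triangle {x} {y} cx cy xy with edge x y c xy
    ... | inj₁ h = contradiction (trans (sym (d-adj (symm T cx))) (trans h (cong suc (d-adj (symm T cy))))) λ ()
    ... | inj₂ h = contradiction (trans (sym (d-adj (symm T cy))) (trans h (cong suc (d-adj (symm T cx))))) λ ()
    to : ∀ x y → Adj T x y → Adj (star (suc n)) (f x) (f y)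
    to x y xy = (λ e → irrefl T (f-inj e) xy) , one-centre (hub x) (hub y)
      where
      one-centre : x ≡ c ⊎ Adj T c x → y ≡ c ⊎ Adj T c y → toℕ (f x) ≡ 0 ⊎ toℕ (f y) ≡ 0
      one-centre (inj₁ refl) _ = inj₁ (cong toℕ f-c)
      one-centre _ (inj₁ refl) = inj₂ (cong toℕ f-c)
      one-centre (inj₂ cx) (inj₂ cy) = ⊥-elim (no-triangle cx cy xy)
    back : ∀ x y → Adj (star (suc n)) (f x) (f y) → Adj T x y
    back x y (ne , inj₁ h) with centre x h | hub y
    ... | refl | inj₁ refl = ⊥-elim (ne refl)
    ... | refl | inj₂ cy = cy
    back x y (ne , inj₂ h) with centre y h | hub x
    ... | refl | inj₁ refl = ⊥-elim (ne refl)
    ... | refl | inj₂ cx = symm T cx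

  private
    path₃ : Fin (suc n) → Fin (suc n) → Fin (suc n) → Fin (suc n) → Set
    path₃ a u v b = Adj T a u × Adj T u v × Adj T v b × a ≢ v × u ≢ b

    fork : Fin (suc n) → Fin (suc n) → Fin (suc n) → Set
    fork c a b = Adj T c a × Adj T c b × a ≢ b

    path₃? : ∀ a u v b → Dec (path₃ a u v b)
    path₃? a u v b = adj? T a u ×-dec (adj? T u v ×-dec (adj? T v b ×-dec (¬? (a ≟ v) ×-dec ¬? (u ≟ b))))

    fork? : ∀ c a b → Dec (fork c a b)
    fork? c a b = adj? T c a ×-dec (adj? T c b ×-dec ¬? (a ≟ b))

    Hub : Fin (suc n) → Set
    Hub c = ∀ x → x ≡ c ⊎ Adj T c x

    -- By connectedness: a walk from `c` can only alternate between `c` and its neighbours.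
    spread : ∀ c → (∀ y z → Adj T c y → Adj T y z → z ≢ c → ⊥) → Hub c
    spread c h x = walk (proj₂ (proj₁ (metric⇒IsTree M z<s)) c x) (inj₁ refl)
      where
      walk : ∀ {y x} → Star (Adj T) y x → y ≡ c ⊎ Adj T c y → x ≡ c ⊎ Adj T c x
      walk ε p = p
      walk (e ◅ s) (inj₁ refl) = walk s (inj₂ e)
      walk (_◅_ {j = z} e s) (inj₂ cy) with z ≟ c
      ... | yes p = walk s (inj₁ p)
      ... | no ¬p = ⊥-elim (h _ z cy e ¬p)

  non-star⇒path₃ : ¬ (T ≅ star (suc n)) → ∃[ a ] ∃[ u ] ∃[ v ] ∃[ b ] path₃ a u v b
  non-star⇒path₃ ¬star = search (any? λ a → any? λ u → any? λ v → any? λ b → path₃? a u v b) (any? λ c → any? λ a → any? λ b → fork? c a b)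
    where
    Path₃ Fork : Set
    Path₃ = ∃[ a ] ∃[ u ] ∃[ v ] ∃[ b ] path₃ a u v b
    Fork = ∃[ c ] ∃[ a ] ∃[ b ] fork c a b
    search : Dec Path₃ → Dec Fork → Path₃
    search (yes p) _ = p
    -- If no vertex has two neighbours, any vertex can serve as the centre.
    search (no none) (no ¬fork) = ⊥-elim (¬star (centre⇒star zero (spread zero λ y z cy yz z≢c → ¬fork (y , zero , z , symm T cy , yz , ≢-sym z≢c))))
    search (no none) (yes (c , a , b , ca , cb , a≢b)) = ⊥-elim (¬star (centre⇒star c (spread c after)))
      where
      after : ∀ y z → Adj T c y → Adj T y z → z ≢ c → ⊥
      -- One of the two neighbours `a` and `b` of `c` differs from `y`, and the excluded path of
      -- length 3 starts there.
      after y z cy yz z≢c with a ≟ y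
      ... | no a≢y = none (a , c , y , z , symm T ca , cy , yz , a≢y , ≢-sym z≢c)
      ... | yes refl = none (b , c , y , z , symm T cb , cy , yz , ≢-sym a≢b , ≢-sym z≢c)

  non-star-improves′ : ¬ (T ≅ star (suc n)) → Σ[ T′ ∈ Graph (suc n) ] OneAssociate T T′ × avp T′ ℚ.< avp T
  non-star-improves′ ¬star = finish (non-star⇒path₃ ¬star)
    where
    finish : ∃[ a ] ∃[ u ] ∃[ v ] ∃[ b ] path₃ a u v b → Σ[ T′ ∈ Graph (suc n) ] OneAssociate T T′ × avp T′ ℚ.< avp T
    finish (a , u , v , b , au , uv , vb , a≢v , u≢b) = improve-edge T d M a u v b au uv vb a≢v u≢b

non-star-improves : ∀ n (T : Graph n) → IsTree T → ¬ (T ≅ star n) →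
                    Σ[ T′ ∈ Graph n ] OneAssociate T T′ × avp T′ ℚ.< avp T
non-star-improves zero T ((() , _) , _) ¬star
non-star-improves (suc n) T tree ¬star = non-star-improves′ T (dist T tree) (dist-metric T tree) ¬star

theorem1 : (∀ n (T : Graph n) → IsTree T →
    avp (star n) ℚ.≤ avp T × avp T ℚ.≤ avp (path n))
    × (∃[ n ] Σ[ T₁ ∈ Graph n ] Σ[ T₂ ∈ Graph n ]
    IsTree T₁ × IsTree T₂ × ¬ (T₁ ≅ T₂) × avp T₁ ≡ avp T₂)
    × (DenseAbove 0ℚ (RatioValue Connected) × DenseAbove ½ (RatioValue IsTree))
    × (∀ d → 1 ≤ d →
    ∃[ n ] Σ[ G ∈ Graph n ] Σ[ v ∈ Fin n ]
    Connected G × degree G v ≡ d × (∀ w → avpAt G w ℚ.≤ avpAt G v))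
    × (∀ n (T : Graph n) → IsTree T → ¬ (T ≅ star n) →
    Σ[ T′ ∈ Graph n ] OneAssociate T T′ × avp T′ ℚ.< avp T)
    × ((∃[ n ] Σ[ G ∈ Graph n ] Σ[ a ∈ Fin n ] Σ[ b ∈ Fin n ]
    Connected G × Adj G a b × Connected (removeEdge G a b) ×
    avp G ℚ.< avp (removeEdge G a b))
    × (∃[ n ] Σ[ T ∈ Graph (suc n) ] Σ[ a ∈ Fin (suc n) ] Σ[ b ∈ Fin (suc n) ]
    IsTree T × (Σ[ f ∈ Adj T a b ] avp T ℚ.< avp (contract T a b f))))
    × (∀ r → 3 ≤ r →
    ∃[ C ] ∀ N → ∃[ n ] Σ[ G ∈ Graph n ]
    N ≤ n × Connected G × (∀ v → r ≤ degree G v) ×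
    avp G ℚ.≤ + (C * ⌊log₂ n ⌋) ℚ./ 1)
    × (∀ n (G : Graph n) → Connected G →
    avp (star n) ℚ.≤ avp G × avp G ℚ.≤ avp (complete n))
theorem1 =
    (λ n T tree → avp-star≤ T (proj₁ tree) , avp≤path T tree)
  , same-avp
  , (dense-connected , dense-trees)
  , maximum-degree
  , non-star-improves
  , (removal-increases , contraction-increases)
  , small-avp
  , λ n G connected → avp-star≤ G connected , avp≤complete G (proj₁ connected)
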